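{- There exist absolute constants $c, C>0$ such that for all integers $n$ and $k\geq 2$, the minimum number $T(n,k)$ of adaptive queries needed to solve white-peg Mastermind with $n$ positions and $k$ colors satisfies $$c\left(n\frac{\log k}{\log n}+\frac{k}{n}\right)\leq T(n,k)\leq C\left(n\frac{\log k}{\log n}+\frac{k}{n}\right),$$ i.e. $T(n,k)=\Theta\left(n\frac{\log k}{\log n}+k/n\right)$.
   Context: White-peg Mastermind with $n$ positions and $k$ colors: Codemaker chooses a hidden codeword $x\in[k]^n$. Codebreaker adaptively asks queries $q\in[k]^n$ (each query may depend on all previous answers) and after each query is told both the number of black pegs $bp(x,q)=|\{i\in[n]: x_i=q_i\}|$ and the number of white pegs $wp(x,q)=\max_{\sigma}|\{i\in[n]: x_i=q_{\sigma(i)}\}|-bp(x,q)$, where $\sigma$ ranges over all permutations of $[n]$. The game is solved once the answers received determine $x$ uniquely. The minimum number of adaptive queries needed is the least $T$ such that Codebreaker has an adaptive strategy that determines every possible codeword within $T$ queries. -}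

module Defs where

open import Data.Nat using (ℕ; zero; suc; _+_; _*_; _∸_; _≤_)
open import Data.Nat.Logarithm using (⌊log₂_⌋)
open import Data.Fin using (Fin)
open import Data.Fin.Properties using (_≟_)
open import Data.Fin.Permutation using (Permutation′; _⟨$⟩ʳ_)
open import Data.Vec using (Vec; lookup; allFin; count)
open import Data.Product using (Σ; ∃; _×_)
open import Data.Empty using (⊥)
open import Data.Unit using (⊤)
open import Relation.Binary.PropositionalEquality using (_≡_)

Code : ℕ → ℕ → Set
Code n k = Vec (Fin k) n

matches : ∀ {n k} → Code n k → Code n k → Permutation′ n → ℕ
matches {n} x q σ = count (λ i → lookup x i ≟ lookup q (σ ⟨$⟩ʳ i)) (allFin n)

bp : ∀ {n k} → Code n k → Code n k → ℕ
bp {n} x q = count (λ i → lookup x i ≟ lookup q i) (allFin n)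

IsMaxMatch : ∀ {n k} → Code n k → Code n k → ℕ → Set
IsMaxMatch {n} x q m =
  (Σ (Permutation′ n) λ σ → matches x q σ ≡ m) × (∀ σ → matches x q σ ≤ m)

Answer : ∀ {n k} → Code n k → Code n k → ℕ → ℕ → Set
Answer x q b w = (bp x q ≡ b) × ∃ λ m → IsMaxMatch x q m × (w ≡ m ∸ b)

data Strategy (n k : ℕ) : Set where
  stop : Strategy n k
  ask  : Code n k → (ℕ → ℕ → Strategy n k) → Strategy n k

-- Wins T S s : starting with the set S of codewords consistent with the
-- answers so far, strategy s uses at most T further queries and, on every
-- branch, the codewords consistent with all answers received are at most one
-- (i.e. the answers determine x uniquely).
Wins : ∀ {n k} → ℕ → (Code n k → Set) → Strategy n k → Set
Wins T S stop = ∀ x y → S x → S y → x ≡ y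
Wins zero S (ask q f) = ⊥
Wins (suc T) S (ask q f) =
  ∀ b w → Wins T (λ x → S x × Answer x q b w) (f b w)

SolvableIn : ℕ → ℕ → ℕ → Set
SolvableIn n k T = Σ (Strategy n k) λ s → Wins T (λ _ → ⊤) s

IsMinQueries : ℕ → ℕ → ℕ → Set
IsMinQueries n k T = SolvableIn n k T × (∀ T′ → SolvableIn n k T′ → T ≤ T′)

{-# OPTIONS --safe #-}
module Submission where

-- Lower bound: the (n + 1)² possible answers to a query give k ^ n ≤ (n + 1) ^ (2 T), and on the
-- branch of zero answers two unasked colours cannot be told apart, so k ≤ T n + 1.
--
-- Upper bound: counting items on sets of leaves of a binary tree.  A colour with m occurrences
-- below a node is followed down by asking for its count in the left half; an item with
-- 2 ^ j ≤ m < 2 ^ (j + 1) needs j + 1 bits.  The answers of 2 ^ q subtrees are combined with the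
-- signs of a Hadamard matrix, in whose rows further counts of up to q − |y| bits can be hidden
-- (row y) without any loss (Cantor–Mills coin weighing).  So while half of the subtrees of a node
-- are solved, the other half are prepared for free; only the preparation along the first branch is
-- paid for, which is a geometric series, and the items of class j cost O(2 ^ h j / 2 ^ j) queries
-- for a tree of height h.  Summed over j, a tree of n leaves costs O(n) queries.
-- For k ≤ n, blocks of about k positions are solved in parallel, again by combining their answers
-- with the signs of the matrix.  For n < k the total number of pegs tells how many of n colours occur,
-- so k / n queries find the relevant groups of n colours; to find the colours that occur, the groups
-- serve as leaves and the places inside a group as items, and at most n colours remain.

-- A hidden number must be a natural number that fits the capacity of its row, whereas the replies
-- combined by the signs may be any integers. The game `Bounded` records this asymmetry: plain
-- counts can ride along, signed queries cannot. A word of length 2 (j + 1) or its complement has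
-- capacity j + 1, so two rounds carry every reply about an item of class j. This is why the
-- subtrees start 2 j + 3 levels down, and these levels are the factor j in the cost.
--
-- The items of class j at a node number at most its load divided by 2 ^ j, so the load must not
-- exceed the number of leaves. With one peg per leaf this is automatic. A group may contain many
-- colours that occur; its leaf is then kept at a distance from the others, and a node with an empty
-- half needs no query at all.
--
-- A sum over part of the positions requires a blank at the others. For n < k some colour is absent.
-- For k ≤ n there may be none, and a blank for each position is found by weighing two colours
-- against each other, which is again coin weighing.

open import Defs
open import Data.Nat using (ℕ)
open import Data.Bool using (Bool; true; false; not)
open import Data.Maybe using (Maybe; just; nothing; maybe)
open import Data.Product using (Σ; _×_; _,_; proj₁; proj₂; uncurry)
open import Data.Sum using (_⊎_; inj₁; inj₂)
open import Data.Unit using (⊤; tt)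
open import Data.Empty using (⊥-elim)
open import Relation.Nullary using (¬_; yes; no; Dec)
open import Function using (_∘_; id)
open import Relation.Binary.PropositionalEquality

-- Decision trees for abstract guessing games

module Learning where

  open import Data.Nat using (ℕ; zero; suc; _+_; _*_; _≤_; s≤s)
  open import Data.Fin using (Fin; zero; suc)
  open import Data.Vec using (Vec; []; _∷_)

  -- `Ok` is a promise that a tree must keep for every object still consistent. `Bounded` uses it to
  -- cap replies, so that they can be hidden in a row.
  record Game : Set₁ where
    field
      Hidden Query Reply : Set
      val : Hidden → Query → Reply
      Ok  : Hidden → Query → Set
  open Game public

  -- A decision tree of depth at most t for the hidden objects satisfying S; its leaves hold
  -- a value that is related by R to every object consistent with the replies.
  data Learn (G : Game) {B : Set} (R : Hidden G → B → Set) :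
             (S : Hidden G → Set) → ℕ → Set₁ where
    done : ∀ {S t} (b : B) → (∀ x → S x → R x b) → Learn G R S t
    ask  : ∀ {S t} (q : Query G) → (∀ x → S x → Ok G x q) →
           (∀ r → Learn G R (λ x → S x × val G x q ≡ r) t) → Learn G R S (suc t)

  module _ {G : Game} where

    mapL : ∀ {B B′ : Set} {R : Hidden G → B → Set} {R′ : Hidden G → B′ → Set} {S S′ t} (g : B → B′) →
           (∀ x → S′ x → S x) → (∀ x b → S′ x → R x b → R′ x (g b)) → Learn G R S t → Learn G R′ S′ t
    mapL g s r (done b p) = done (g b) (λ x sx → r x b sx (p x (s x sx)))
    mapL g s r (ask q ok k) = ask q (λ x sx → ok x (s x sx))
      (λ a → mapL g (λ x (sx , e) → s x sx , e) (λ x b (sx , _) → r x b sx) (k a))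

    weaken : ∀ {B : Set} {R : Hidden G → B → Set} {S S′ t} →
             (∀ x → S′ x → S x) → Learn G R S t → Learn G R S′ t
    weaken s = mapL (λ b → b) s (λ _ _ _ r → r)

    relax : ∀ {B : Set} {R : Hidden G → B → Set} {S t t′} → t ≤ t′ → Learn G R S t → Learn G R S t′
    relax _ (done b p) = done b p
    relax (s≤s le) (ask q ok k) = ask q ok (λ r → relax le (k r))

    bind : ∀ {B B′ : Set} {R : Hidden G → B → Set} {R′ : Hidden G → B′ → Set} {S s t} →
           Learn G R S s → (∀ b → Learn G R′ (λ x → S x × R x b) t) → Learn G R′ S (s + t)
    bind {s = s} {t} (done b p) k = relax (m≤n+m t s) (weaken (λ x sx → sx , p x sx) (k b))
      where open import Data.Nat.Properties using (m≤n+m)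
    bind (ask q ok l) k = ask q ok λ r →
      bind (l r) (λ b → weaken (λ x ((sx , _) , rb) → sx , rb) (k b))

    query : ∀ {S} (q : Query G) → (∀ x → S x → Ok G x q) → Learn G (λ x r → val G x q ≡ r) S 1
    query q ok = ask q ok (λ r → done r (λ x → proj₂))

    learnFin : ∀ {B : Set} {S t} n {R : Fin n → Hidden G → B → Set} →
               (∀ i → Learn G (R i) S t) → Learn G (λ x (f : Fin n → B) → ∀ i → R i x (f i)) S (n * t)
    learnFin zero l = done (λ ()) (λ _ _ ())
    learnFin {B} {S} (suc n) {R} l = bind (l zero) λ b →
      mapL (cons b) (λ _ → proj₁) (λ { x f (_ , r) rs zero → r ; x f (_ , r) rs (suc i) → rs i })
           (learnFin n (λ i → l (suc i)))
      where
      cons : B → (Fin n → B) → Fin (suc n) → B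
      cons b f zero = b
      cons b f (suc i) = f i

    -- Trees that run in lockstep must not stop early: a finished tree is padded with the harmless
    -- query q₀.
    next : ∀ {B : Set} {R : Hidden G → B → Set} {S t} (q₀ : Query G) → (∀ x → Ok G x q₀) →
           Learn G R S (suc t) →
           Σ (Query G) λ q → (∀ x → S x → Ok G x q) × (∀ r → Learn G R (λ x → S x × val G x q ≡ r) t)
    next q₀ ok₀ (done b p) = q₀ , (λ x _ → ok₀ x) , λ _ → done b (λ x (sx , _) → p x sx)
    next q₀ ok₀ (ask q ok k) = q , ok , k

  result : ∀ {G : Game} {B : Set} {R : Hidden G → B → Set} {S} → Learn G R S zero →
           Σ B λ b → ∀ x → S x → R x b
  result (done b p) = b , p

  simulate : ∀ {G G′ : Game} {B : Set} {R : Hidden G → B → Set} {S t d}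
             (φ : Hidden G′ → Hidden G) {S′ : Hidden G′ → Set} →
             (∀ q → Learn G′ (λ x r → val G (φ x) q ≡ r) S′ d) →
             Learn G R S t → Learn G′ (λ x → R (φ x)) (λ x → S (φ x) × S′ x) (t * d)
  simulate φ sim (done b p) = done b (λ x (sx , _) → p (φ x) sx)
  simulate φ sim (ask q ok k) = bind (weaken (λ _ → proj₂) (sim q)) λ r →
    weaken (λ x ((sx , s′) , e) → (sx , e) , s′) (simulate φ sim (k r))

  reindex : ∀ {G G′ : Game} {B : Set} {R : Hidden G → B → Set} {S t}
            (φ : Hidden G′ → Hidden G) (ψ : Query G → Query G′) (α : Reply G′ → Reply G) →
            (∀ x q r → val G′ x (ψ q) ≡ r → val G (φ x) q ≡ α r) →
            (∀ x q → Ok G (φ x) q → Ok G′ x (ψ q)) →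
            Learn G R S t → Learn G′ (λ x → R (φ x)) (λ x → S (φ x)) t
  reindex φ ψ α hv ho (done b p) = done b (λ x → p (φ x))
  reindex φ ψ α hv ho (ask q ok k) = ask (ψ q) (λ x sx → ho x q (ok (φ x) sx)) λ r →
    weaken (λ x (sx , e) → sx , hv x q r e) (reindex φ ψ α hv ho (k (α r)))

  Word : ℕ → Set
  Word = Vec Bool

  rep : ℕ → ℕ → ℕ
  rep zero t = t
  rep (suc q) t = rep q t + rep q t

  learnWords : ∀ {G : Game} {B : Set} {S t} q {R : Word q → Hidden G → B → Set} →
               (∀ c → Learn G (R c) S t) → Learn G (λ x (f : Word q → B) → ∀ c → R c x (f c)) S (rep q t)
  learnWords zero l = mapL (λ b _ → b) (λ _ s → s) (λ { x b _ r [] → r }) (l [])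
  learnWords {B = B} (suc q) l = bind (learnWords q (λ c → l (false ∷ c))) λ f →
    mapL (cons f) (λ _ → proj₁) (λ { x g (_ , r) rs (false ∷ c) → r c ; x g (_ , r) rs (true ∷ c) → rs c })
         (learnWords q (λ c → l (true ∷ c)))
    where
    cons : (Word q → B) → (Word q → B) → Word (suc q) → B
    cons f g (false ∷ c) = f c
    cons f g (true ∷ c) = g c

-- Powers of two, finite sums, enumeration of decidable subsets

module Sums where

  open import Data.Nat using (ℕ; zero; suc; _<_; _≤_; s≤s; z≤n; _+_; _*_; _≤?_)
  open import Data.Nat.Properties
  open import Data.Nat.Tactic.RingSolver using (solve-∀)
  open import Data.Fin using (Fin; zero; suc)
  import Data.Fin.Properties as Fin

  pow2 : ℕ → ℕ
  pow2 zero = 1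
  pow2 (suc q) = pow2 q + pow2 q

  pow2>0 : ∀ b → 0 < pow2 b
  pow2>0 zero = s≤s z≤n
  pow2>0 (suc b) = ≤-trans (pow2>0 b) (m≤m+n _ _)

  pow2-mono : ∀ {m n} → m ≤ n → pow2 m ≤ pow2 n
  pow2-mono {n = n} z≤n = pow2>0 n
  pow2-mono (s≤s le) = +-mono-≤ (pow2-mono le) (pow2-mono le)

  pow2-+ : ∀ m n → pow2 (m + n) ≡ pow2 m * pow2 n
  pow2-+ zero n = sym (+-identityʳ _)
  pow2-+ (suc m) n = trans (cong₂ _+_ (pow2-+ m n) (pow2-+ m n)) (sym (*-distribʳ-+ (pow2 n) (pow2 m) (pow2 m)))

  sumF : ∀ n → (Fin n → ℕ) → ℕ
  sumF zero f = 0
  sumF (suc n) f = f zero + sumF n (λ i → f (suc i))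

  sumF-cong : ∀ n {f g : Fin n → ℕ} → (∀ i → f i ≡ g i) → sumF n f ≡ sumF n g
  sumF-cong zero e = refl
  sumF-cong (suc n) e = cong₂ _+_ (e zero) (sumF-cong n (λ i → e (suc i)))

  sumF-mono : ∀ n {f g : Fin n → ℕ} → (∀ i → f i ≤ g i) → sumF n f ≤ sumF n g
  sumF-mono zero e = z≤n
  sumF-mono (suc n) e = +-mono-≤ (e zero) (sumF-mono n (λ i → e (suc i)))

  sumF-+ : ∀ n (f g : Fin n → ℕ) → sumF n (λ i → f i + g i) ≡ sumF n f + sumF n g
  sumF-+ zero f g = refl
  sumF-+ (suc n) f g = trans (cong (f zero + g zero +_) (sumF-+ n _ _)) (lem (f zero) (g zero) _ _)
    where
    lem : ∀ a b c d → a + b + (c + d) ≡ (a + c) + (b + d)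
    lem = solve-∀

  sumF-zero : ∀ n → sumF n (λ _ → 0) ≡ 0
  sumF-zero zero = refl
  sumF-zero (suc n) = sumF-zero n

  ≤-sumF : ∀ n (f : Fin n → ℕ) i → f i ≤ sumF n f
  ≤-sumF (suc n) f zero = m≤m+n _ _
  ≤-sumF (suc n) f (suc i) = ≤-trans (≤-sumF n (λ i → f (suc i)) i) (m≤n+m _ _)

  sumF-swap : ∀ m n (g : Fin m → Fin n → ℕ) → sumF m (λ v → sumF n (g v)) ≡ sumF n (λ i → sumF m (λ v → g v i))
  sumF-swap zero n g = sym (sumF-zero n)
  sumF-swap (suc m) n g = trans (cong (sumF n (g zero) +_) (sumF-swap m n _)) (sym (sumF-+ n _ _))

  sumF-*ˡ : ∀ n c (f : Fin n → ℕ) → sumF n (λ i → c * f i) ≡ c * sumF n f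
  sumF-*ˡ zero c f = sym (*-zeroʳ c)
  sumF-*ˡ (suc n) c f = trans (cong (c * f zero +_) (sumF-*ˡ n c _)) (sym (*-distribˡ-+ c (f zero) _))

  sumF-single : ∀ n (g : Fin n → ℕ) i → (∀ j → ¬ j ≡ i → g j ≡ 0) → sumF n g ≡ g i
  sumF-single (suc n) g zero z = trans (cong (g zero +_) (trans (sumF-cong n (λ j → z (suc j) λ ())) (sumF-zero n))) (+-identityʳ _)
  sumF-single (suc n) g (suc i) z =
    cong₂ _+_ (z zero λ ()) (sumF-single n _ i (λ j ne → z (suc j) (ne ∘ Fin.suc-injective)))

  sumF≤1 : ∀ n (g : Fin n → ℕ) → (∀ i → g i ≤ 1) → (∀ i j → 1 ≤ g i → 1 ≤ g j → i ≡ j) → sumF n g ≤ 1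
  sumF≤1 zero g le u = z≤n
  sumF≤1 (suc n) g le u with 1 ≤? g zero
  ... | yes p = subst (_≤ 1) (sym (sumF-single (suc n) g zero zero-else)) (le zero)
    where
    zero-else : ∀ j → ¬ j ≡ zero → g j ≡ 0
    zero-else j ne with 1 ≤? g j
    ... | yes p′ = ⊥-elim (ne (u j zero p′ p))
    ... | no np = n<1⇒n≡0 (≰⇒> np)
  ... | no np = ≤-trans (≤-reflexive (cong (_+ sumF n (g ∘ suc)) (n<1⇒n≡0 (≰⇒> np))))
    (sumF≤1 n (g ∘ suc) (le ∘ suc) (λ i j p r → Fin.suc-injective (u (suc i) (suc j) p r)))

  sumF-pos : ∀ n (f : Fin n → ℕ) → 1 ≤ sumF n f → Σ (Fin n) λ i → 1 ≤ f i
  sumF-pos (suc n) f le with f zero in eq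
  ... | suc _ = zero , subst (1 ≤_) (sym eq) (s≤s z≤n)
  ... | zero with sumF-pos n (f ∘ suc) le
  ... | i , p = suc i , p

  -- `size*` is Markov's inequality: elements that each carry weight c are at most the total weight
  -- divided by c. It bounds the items of a class at a node.
  record Enumeration {n} (P : Fin n → Set) : Set where
    field
      size      : ℕ
      item      : Fin size → Fin n
      sound     : ∀ i → P (item i)
      find      : ∀ v → P v → Fin size
      item-find : ∀ v p → item (find v p) ≡ v
      injective : ∀ i j → item i ≡ item j → i ≡ j
      size*     : ∀ c f → (∀ v → P v → c ≤ f v) → size * c ≤ sumF n f

  enumerate : ∀ n {P : Fin n → Set} → (∀ v → Dec (P v)) → Enumeration P
  enumerate zero P? = record
    { size = 0 ; item = λ () ; sound = λ () ; find = λ () ; item-find = λ () ; injective = λ () ; size* = λ _ _ _ → z≤n }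
  enumerate (suc n) {P} P? with P? zero | enumerate n (P? ∘ suc)
  ... | no ¬p | E = record
    { size = size ; item = suc ∘ item ; sound = sound
    ; find = λ { zero p → ⊥-elim (¬p p) ; (suc v) p → find v p }
    ; item-find = λ { zero p → ⊥-elim (¬p p) ; (suc v) p → cong suc (item-find v p) }
    ; injective = λ i j e → injective i j (Fin.suc-injective e)
    ; size* = λ c f le → ≤-trans (size* c (f ∘ suc) (λ v → le (suc v))) (m≤n+m _ (f zero)) }
    where open Enumeration E
  ... | yes p₀ | E = record
    { size = suc size ; item = item′
    ; sound = λ { zero → p₀ ; (suc i) → sound i }
    ; find = λ { zero p → zero ; (suc v) p → suc (find v p) }
    ; item-find = λ { zero p → refl ; (suc v) p → cong suc (item-find v p) }
    ; injective = λ { zero zero e → refl ; (suc i) (suc j) e → cong suc (injective i j (Fin.suc-injective e)) }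
    ; size* = λ c f le → +-mono-≤ (le zero p₀) (size* c (f ∘ suc) (λ v → le (suc v))) }
    where
    open Enumeration E
    item′ : Fin (suc size) → Fin (suc n)
    item′ zero = zero
    item′ (suc i) = suc (item i)

-- Sign matrices with room for hidden digits

module Hadamard where

  open import Data.Nat as ℕ using (ℕ; zero; suc; _<_; s≤s; z≤n)
  import Data.Nat.Properties as ℕ
  open import Data.Nat.DivMod using (m≡m%n+[m/n]*n; m%n<n; m<n*o⇒m/o<n)
  import Data.Nat.DivMod as ℕ
  open import Data.Integer using (ℤ; +_; -_; _+_; _-_; _*_; ∣_∣; 0ℤ)
  import Data.Integer.Properties as ℤ
  open import Data.Integer.DivMod using (_%ℕ_; _/ℕ_; n%ℕd<d; a≡a%ℕn+[a/ℕn]*n)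
  open import Data.Integer.Tactic.RingSolver using (solve-∀)
  open import Data.Vec using ([]; _∷_; map)
  open Learning
  open Sums

  -- Row y of the Sylvester-Hadamard matrix applied to a, one letter for each doubling.
  enc : ∀ q → (Word q → ℤ) → Word q → ℤ
  enc zero a [] = a []
  enc (suc q) a (true ∷ y) = enc q (λ c → a (false ∷ c)) y + enc q (λ c → a (true ∷ c)) y
  enc (suc q) a (false ∷ y) = enc q (λ c → a (false ∷ c)) y - enc q (λ c → a (true ∷ c)) y

  -- A sum row minus the difference row beside it is twice the second half, so each sum letter
  -- leaves one more binary digit for an offset.
  cap : ∀ {q} → Word q → ℕ
  cap [] = 0
  cap (true ∷ y) = suc (cap y)
  cap (false ∷ y) = cap y

  enc-sub : ∀ q (a b : Word q → ℤ) y → enc q (λ c → a c - b c) y ≡ enc q a y - enc q b y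
  enc-sub zero a b [] = refl
  enc-sub (suc q) a b (true ∷ y)
    rewrite enc-sub q (λ c → a (false ∷ c)) (λ c → b (false ∷ c)) y
          | enc-sub q (λ c → a (true ∷ c)) (λ c → b (true ∷ c)) y = lem (enc q (λ c → a (false ∷ c)) y) (enc q (λ c → b (false ∷ c)) y) (enc q (λ c → a (true ∷ c)) y) (enc q (λ c → b (true ∷ c)) y)
    where
    lem : ∀ u v w z → (u - v) + (w - z) ≡ (u + w) - (v + z)
    lem = solve-∀
  enc-sub (suc q) a b (false ∷ y)
    rewrite enc-sub q (λ c → a (false ∷ c)) (λ c → b (false ∷ c)) y
          | enc-sub q (λ c → a (true ∷ c)) (λ c → b (true ∷ c)) y = lem (enc q (λ c → a (false ∷ c)) y) (enc q (λ c → b (false ∷ c)) y) (enc q (λ c → a (true ∷ c)) y) (enc q (λ c → b (true ∷ c)) y)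
    where
    lem : ∀ u v w z → (u - v) - (w - z) ≡ (u - w) - (v - z)
    lem = solve-∀

  halves-unique : ∀ (u v : ℤ) (r s : ℕ) → r < 2 → s < 2 → + r + u * + 2 ≡ + s + v * + 2 → r ≡ s × u ≡ v
  halves-unique u v r s r< s< eq = r≡s , u≡v
    where
    lem : ∀ r s u v → (r + u * + 2) - (s + v * + 2) ≡ (r - s) - (v - u) * + 2
    lem = solve-∀
    diff : + r - + s ≡ (v - u) * + 2
    diff = ℤ.i-j≡0⇒i≡j _ _ (trans (sym (lem (+ r) (+ s) u v)) (ℤ.i≡j⇒i-j≡0 eq))
    abs< : ∀ r s → r < 2 → s < 2 → ∣ + r - + s ∣ < 2
    abs< 0 0 _ _ = s≤s z≤n
    abs< 0 1 _ _ = s≤s (s≤s z≤n)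
    abs< 1 0 _ _ = s≤s (s≤s z≤n)
    abs< 1 1 _ _ = s≤s z≤n
    abs< (suc (suc _)) _ (s≤s (s≤s ())) _
    abs< _ (suc (suc _)) _ (s≤s (s≤s ()))
    small : ∀ n → n ℕ.* 2 < 2 → n ≡ 0
    small zero _ = refl
    small (suc n) (s≤s (s≤s ()))
    v-u≡0 : v - u ≡ 0ℤ
    v-u≡0 = ℤ.∣i∣≡0⇒i≡0 (small ∣ v - u ∣ (subst (_< 2)
      (trans (cong ∣_∣ diff) (ℤ.abs-* (v - u) (+ 2))) (abs< r s r< s<)))
    u≡v : u ≡ v
    u≡v = sym (ℤ.i-j≡0⇒i≡j _ _ v-u≡0)
    r≡s : r ≡ s
    r≡s = ℤ.+-injective (ℤ.i-j≡0⇒i≡j _ _ (trans diff (cong (_* + 2) v-u≡0)))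

  half : ℤ → ℤ
  half z = z /ℕ 2

  half-spec : ∀ z (u : ℤ) n → z ≡ u * + 2 + + n → half z ≡ u + + (n ℕ./ 2) × z %ℕ 2 ≡ n ℕ.% 2
  half-spec z u n eq = proj₂ both , proj₁ both
    where
    lem : ∀ r u s → u * + 2 + (r + s * + 2) ≡ r + (u + s) * + 2
    lem = solve-∀
    eq′ : + n ≡ + (n ℕ.% 2) + + (n ℕ./ 2) * + 2
    eq′ = trans (cong +_ (m≡m%n+[m/n]*n n 2))
          (trans (ℤ.pos-+ (n ℕ.% 2) _) (cong (λ k → + (n ℕ.% 2) + k) (ℤ.pos-* (n ℕ./ 2) 2)))
    both : z %ℕ 2 ≡ n ℕ.% 2 × half z ≡ u + + (n ℕ./ 2)
    both = halves-unique _ _ _ _ (n%ℕd<d z 2) (m%n<n n 2)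
      (trans (sym (a≡a%ℕn+[a/ℕn]*n z 2)) (trans eq (trans (cong (λ k → u * + 2 + k) eq′)
        (lem (+ (n ℕ.% 2)) u (+ (n ℕ./ 2))))))

  dec : ∀ q → (Word q → ℤ) → (Word q → ℤ) × (Word q → ℤ)
  dec zero r = r , λ _ → 0ℤ
  dec (suc q) r = join (λ c → w c + b c) b , join e₁ e₀
    where
    w = proj₁ (dec q (λ y → r (false ∷ y)))
    e₁ = proj₂ (dec q (λ y → r (false ∷ y)))
    z : Word q → ℤ
    z y = r (true ∷ y) - r (false ∷ y) + e₁ y
    b = proj₁ (dec q (λ y → half (z y)))
    e₀ : Word q → ℤ
    e₀ y = + (z y %ℕ 2) + proj₂ (dec q (λ y → half (z y))) y * + 2
    join : (Word q → ℤ) → (Word q → ℤ) → Word (suc q) → ℤ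
    join f g (false ∷ c) = f c
    join f g (true ∷ c) = g c

  -- The difference rows determine a false − a true and their own offsets; then the
  -- sum rows leave twice the second half, so that the lowest bit of each offset is visible.
  dec-enc : ∀ q (a : Word q → ℤ) (n : Word q → ℕ) (r : Word q → ℤ) →
            (∀ y → n y < pow2 (cap y)) → (∀ y → r y ≡ enc q a y + + n y) →
            (∀ c → a c ≡ proj₁ (dec q r) c) × (∀ y → + n y ≡ proj₂ (dec q r) y)
  dec-enc zero a n r n< eq = (λ { [] → sym (trans (eq []) (trans (cong (λ k → a [] + + k) n≡0) (ℤ.+-identityʳ _))) }) ,
                             λ { [] → cong +_ n≡0 }
    where
    n≡0 : n [] ≡ 0
    n≡0 = ℕ.n<1⇒n≡0 (n< [])
  dec-enc (suc q) a n r n< eq = (λ { (false ∷ c) → a-false c ; (true ∷ c) → a-true c }) ,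
                                λ { (false ∷ y) → proj₂ IH₁ y ; (true ∷ y) → e₀-ok y }
    where
    A B : Word q → ℤ
    A c = a (false ∷ c)
    B c = a (true ∷ c)
    IH₁ = dec-enc q (λ c → A c - B c) (λ y → n (false ∷ y)) (λ y → r (false ∷ y)) (λ y → n< (false ∷ y))
      λ y → trans (eq (false ∷ y)) (cong (_+ + n (false ∷ y)) (sym (enc-sub q A B y)))
    e₁ = proj₂ (dec q (λ y → r (false ∷ y)))
    z : Word q → ℤ
    z y = r (true ∷ y) - r (false ∷ y) + e₁ y
    lem : ∀ u v k l → (u + v + k) - (u - v + l) + l ≡ v * + 2 + k
    lem = solve-∀
    z≡ : ∀ y → z y ≡ enc q B y * + 2 + + n (true ∷ y)
    z≡ y = trans (cong₂ _+_ (cong₂ _-_ (eq (true ∷ y)) (eq (false ∷ y))) (sym (proj₂ IH₁ y))) (lem (enc q A y) _ _ _)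
    hs = λ y → half-spec (z y) (enc q B y) (n (true ∷ y)) (z≡ y)
    IH₀ = dec-enc q B (λ y → n (true ∷ y) ℕ./ 2) (λ y → half (z y))
      -- The lowest digit is read off here, so the halved offset fits the capacity with one sum
      -- letter fewer.
      (λ y → m<n*o⇒m/o<n (subst (n (true ∷ y) <_) (dbl (pow2 (cap y))) (n< (true ∷ y))))
      (λ y → proj₁ (hs y))
      where
      dbl : ∀ m → m ℕ.+ m ≡ m ℕ.* 2
      dbl m = trans (cong (m ℕ.+_) (sym (ℕ.+-identityʳ m))) (ℕ.*-comm 2 m)
    a-true = proj₁ IH₀
    lem′ : ∀ u v → u ≡ (u - v) + v
    lem′ = solve-∀
    a-false : ∀ c → A c ≡ _
    a-false c = trans (lem′ (A c) (B c)) (cong₂ _+_ (proj₁ IH₁ c) (a-true c))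
    e₀-ok : ∀ y → + n (true ∷ y) ≡ _
    e₀-ok y = trans (cong +_ (m≡m%n+[m/n]*n (n (true ∷ y)) 2))
      (trans (ℤ.pos-+ (n (true ∷ y) ℕ.% 2) _)
        (cong₂ _+_ (cong +_ (sym (proj₂ (hs y))))
          (trans (ℤ.pos-* (n (true ∷ y) ℕ./ 2) 2) (cong (_* + 2) (proj₂ IH₀ y)))))

  cap-not : ∀ {q} (y : Word q) → cap y ℕ.+ cap (map not y) ≡ q
  cap-not [] = refl
  cap-not (true ∷ y) = cong suc (cap-not y)
  cap-not (false ∷ y) = trans (ℕ.+-suc _ _) (cong suc (cap-not y))

-- Signed queries on binary trees and the parallel round

module Signed (κ : ℕ) where

  open import Data.Nat as ℕ using (zero; suc; _<_; _≤_)
  import Data.Nat.Properties as ℕ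
  open import Data.Integer using (ℤ; +_; -_; _+_; _-_; 0ℤ)
  import Data.Integer.Properties as ℤ
  open import Data.Integer.Tactic.RingSolver using (solve-∀)
  open import Data.Fin using (Fin)
  open import Data.Vec using ([]; _∷_; map)
  open Learning
  open Hadamard
  open Sums using (pow2; pow2>0; pow2-mono)

  sumW : ∀ h → (Word h → ℕ) → ℕ
  sumW zero f = f []
  sumW (suc h) f = sumW h (λ w → f (false ∷ w)) ℕ.+ sumW h (λ w → f (true ∷ w))

  Hid : ℕ → Set
  Hid h = Fin κ → Word h → ℕ

  -- A query puts one colour on each position, so a leaf is asked about at most one item at a time.
  Asg : ℕ → Set
  Asg h = Word h → Maybe (Fin κ)

  hit : Maybe (Fin κ) → (Fin κ → ℕ) → ℕ
  hit nothing f = 0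
  hit (just v) f = f v

  val⁺ : ∀ {h} → Asg h → Hid h → ℕ
  val⁺ {h} Q H = sumW h (λ w → hit (Q w) (λ v → H v w))

  -- Signs cannot be played: a signed query stands for the difference of two queries, and a change
  -- of sign swaps them.
  data SQ (h : ℕ) : Set where
    _⊝_ : Asg h → Asg h → SQ h

  sval : ∀ {h} → SQ h → Hid h → ℤ
  sval (P ⊝ N) H = + val⁺ P H - + val⁺ N H

  sub : ∀ {h} → Bool → Hid (suc h) → Hid h
  sub b H v w = H v (b ∷ w)

  subs : ∀ {q h} → Word q → Hid (q ℕ.+ h) → Hid h
  subs [] H = H
  subs (b ∷ c) H = subs c (sub b H)

  none : ∀ {h} → Asg h
  none _ = nothing

  blank : ∀ {h} → SQ h
  blank = none ⊝ none

  sumW-zero : ∀ h → sumW h (λ _ → 0) ≡ 0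
  sumW-zero zero = refl
  sumW-zero (suc h) = cong₂ ℕ._+_ (sumW-zero h) (sumW-zero h)

  sval-blank : ∀ {h} (H : Hid h) → sval blank H ≡ 0ℤ
  sval-blank {h} H rewrite sumW-zero h = refl

  joinA : ∀ {h} → Asg h → Asg h → Asg (suc h)
  joinA P R (false ∷ w) = P w
  joinA P R (true ∷ w) = R w

  join : ∀ {h} → SQ h → SQ h → SQ (suc h)
  join (P ⊝ N) (P′ ⊝ N′) = joinA P P′ ⊝ joinA N N′

  sval-join : ∀ {h} (Q Q′ : SQ h) (H : Hid (suc h)) →
              sval (join Q Q′) H ≡ sval Q (sub false H) + sval Q′ (sub true H)
  sval-join (P ⊝ N) (P′ ⊝ N′) H = trans
    (cong₂ _-_ (ℤ.pos-+ (val⁺ P _) (val⁺ P′ _)) (ℤ.pos-+ (val⁺ N _) (val⁺ N′ _)))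
    (lem (+ val⁺ P _) (+ val⁺ P′ _) (+ val⁺ N _) (+ val⁺ N′ _))
    where
    lem : ∀ a b c d → (a + b) - (c + d) ≡ (a - c) + (b - d)
    lem = solve-∀

  neg : ∀ {h} → SQ h → SQ h
  neg (P ⊝ N) = N ⊝ P

  sval-neg : ∀ {h} (Q : SQ h) (H : Hid h) → sval (neg Q) H ≡ - sval Q H
  sval-neg (P ⊝ N) H = lem (+ val⁺ N H) (+ val⁺ P H)
    where
    lem : ∀ a b → a - b ≡ - (b - a)
    lem = solve-∀

  at : ∀ {q h} → Word q → SQ h → SQ (q ℕ.+ h)
  at [] Q = Q
  at (false ∷ c) Q = join (at c Q) blank
  at (true ∷ c) Q = join blank (at c Q)

  sval-at : ∀ {q h} (c : Word q) (Q : SQ h) H → sval (at c Q) H ≡ sval Q (subs c H)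
  sval-at [] Q H = refl
  sval-at (false ∷ c) Q H = trans (sval-join (at c Q) blank H)
    (trans (cong₂ _+_ (sval-at c Q _) (sval-blank (sub true H))) (ℤ.+-identityʳ _))
  sval-at (true ∷ c) Q H = trans (sval-join blank (at c Q) H)
    (trans (cong₂ _+_ (sval-blank (sub false H)) (sval-at c Q _)) (ℤ.+-identityˡ _))

  row : ∀ {q h} → (Word q → SQ h) → Word q → SQ (q ℕ.+ h)
  row f [] = f []
  row f (true ∷ y) = join (row (λ c → f (false ∷ c)) y) (row (λ c → f (true ∷ c)) y)
  row f (false ∷ y) = join (row (λ c → f (false ∷ c)) y) (neg (row (λ c → f (true ∷ c)) y))

  sval-row : ∀ {q h} (f : Word q → SQ h) y H →
             sval (row f y) H ≡ enc q (λ c → sval (f c) (subs c H)) y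
  sval-row f [] H = refl
  sval-row f (true ∷ y) H = trans (sval-join (row (λ c → f (false ∷ c)) y) _ H)
    (cong₂ _+_ (sval-row (λ c → f (false ∷ c)) y _) (sval-row (λ c → f (true ∷ c)) y _))
  sval-row f (false ∷ y) H = trans (sval-join (row (λ c → f (false ∷ c)) y) _ H)
    (cong₂ _+_ (sval-row (λ c → f (false ∷ c)) y _)
      (trans (sval-neg (row (λ c → f (true ∷ c)) y) _) (cong -_ (sval-row (λ c → f (true ∷ c)) y _))))

  Free : ℕ → Game
  Free h = record { Hidden = Hid h ; Query = SQ h ; Reply = ℤ ; val = λ H q → sval q H ; Ok = λ _ _ → ⊤ }

  -- The promise makes each reply an admissible offset for every row of capacity at least b.
  Bounded : ℕ → ℕ → Game
  Bounded b h = record (Free h) { Ok = λ H q → Σ ℕ λ n → n < pow2 b × sval q H ≡ + n }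

  forget : ∀ {b h} {B : Set} {R : Hid h → B → Set} {S t} → Learn (Bounded b h) R S t → Learn (Free h) R S t
  forget = reindex (λ H → H) (λ q → q) (λ r → r) (λ _ _ _ e → e) (λ _ _ _ → tt)

  embed : ∀ {q h} (c : Word q) {B : Set} {R : Hid h → B → Set} {S t} → Learn (Free h) R S t →
          Learn (Free (q ℕ.+ h)) (λ H → R (subs c H)) (λ H → S (subs c H)) t
  embed c = reindex (subs c) (at c) (λ r → r) (λ H q r e → trans (sym (sval-at c q H)) e) (λ _ _ _ → tt)

  embedᵇ : ∀ {b q h} (c : Word q) {B : Set} {R : Hid h → B → Set} {S t} → Learn (Bounded b h) R S t →
           Learn (Bounded b (q ℕ.+ h)) (λ H → R (subs c H)) (λ H → S (subs c H)) t
  embedᵇ c = reindex (subs c) (at c) (λ r → r) (λ H q r e → trans (sym (sval-at c q H)) e)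
    (λ H q (n , n< , e) → n , n< , trans (sval-at c q H) e)

  blank-ok : ∀ {b h} (H : Hid h) → Ok (Bounded b h) H blank
  blank-ok {b} H = 0 , pow2>0 b , sval-blank H

  flip : ∀ {q} → Bool → Word q → Word q
  flip true y = map not y
  flip false y = y

  flip-flip : ∀ {q} b (y : Word q) → flip b (flip b y) ≡ y
  flip-flip false y = refl
  flip-flip true [] = refl
  flip-flip true (false ∷ y) = cong (false ∷_) (flip-flip true y)
  flip-flip true (true ∷ y) = cong (true ∷_) (flip-flip true y)

  -- The second half of the tree rides along: row y carries the one query of its subtree flip p y.
  round : ∀ {q h S} (p : Bool) (f g : Word q → SQ h) →
          (∀ (H : Hid (suc (q ℕ.+ h))) → S H → ∀ c →
            Σ ℕ λ n → n < pow2 (cap (flip p c)) × sval (g c) (subs c (sub true H)) ≡ + n) →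
          Learn (Free (suc (q ℕ.+ h)))
            (λ H (a , e) → (∀ c → sval (f c) (subs c (sub false H)) ≡ a c) ×
                           (∀ c → sval (g c) (subs c (sub true H)) ≡ e c))
            S (rep q 1)
  round {q} {h} {S} p f g ok = mapL decode (λ _ s → s) spec (learnWords q λ y → query (Q y) (λ _ _ → tt))
    where
    Q : Word q → SQ (suc (q ℕ.+ h))
    Q y = join (row f y) (at (flip p y) (g (flip p y)))
    decode : (Word q → ℤ) → (Word q → ℤ) × (Word q → ℤ)
    decode r = proj₁ (dec q r) , λ c → proj₂ (dec q r) (flip p c)
    spec : ∀ H r → S H → (∀ y → sval (Q y) H ≡ r y) → _
    spec H r s eq = proj₁ d , λ c → trans (proj₂ (proj₂ (ok H s c)))
        (trans (cong (λ c′ → + proj₁ (ok H s c′)) (sym (flip-flip p c))) (proj₂ d (flip p c)))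
      where
      n : Word q → ℕ
      n y = proj₁ (ok H s (flip p y))
      d = dec-enc q (λ c → sval (f c) (subs c (sub false H))) n r
        (λ y → subst (λ y′ → n y < pow2 (cap y′)) (flip-flip p y) (proj₁ (proj₂ (ok H s (flip p y)))))
        (λ y → trans (sym (eq y)) (trans (sval-join (row f y) _ H)
          (cong₂ _+_ (sval-row f y (sub false H))
            (trans (sval-at (flip p y) (g (flip p y)) (sub true H)) (proj₂ (proj₂ (ok H s (flip p y))))))))

  -- Unfolds by two, since in `par` the first half advances in both rounds while the second half
  -- advances once.
  dbl : ℕ → ℕ
  dbl zero = zero
  dbl (suc t) = suc (suc (dbl t))

  cost : ℕ → ℕ → ℕ
  cost q zero = 0
  cost q (suc t) = rep q 1 ℕ.+ (rep q 1 ℕ.+ cost q t)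

  -- A row of small capacity is one of large capacity in the flipped round, so in two rounds
  -- every subtree of the second half gets its query answered once.
  par : ∀ {b h t} {B B′ : Set} {R : Word (b ℕ.+ b) → Hid h → B → Set} {R′ : Word (b ℕ.+ b) → Hid h → B′ → Set}
          {S S′ : Word (b ℕ.+ b) → Hid h → Set} →
        (∀ c → Learn (Free h) (R c) (S c) (dbl t)) →
        (∀ c → Learn (Bounded b h) (R′ c) (S′ c) t) →
        Learn (Free (suc (b ℕ.+ b ℕ.+ h)))
          (λ H ((f , f′) : (Word (b ℕ.+ b) → B) × (Word (b ℕ.+ b) → B′)) →
            (∀ c → R c (subs c (sub false H)) (f c)) × (∀ c → R′ c (subs c (sub true H)) (f′ c)))
          (λ H → (∀ c → S c (subs c (sub false H))) × (∀ c → S′ c (subs c (sub true H))))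
          (cost (b ℕ.+ b) t)
  par {t = zero} τ η = done ((λ c → proj₁ (result (τ c))) , (λ c → proj₁ (result (η c))))
    λ H (s , s′) → (λ c → proj₂ (result (τ c)) _ (s c)) , (λ c → proj₂ (result (η c)) _ (s′ c))
  par {b} {h} {suc t} {R = R} {R′} {S} {S′} τ η =
    bind (round false Q₁ (λ c → pick (ok? c) (Qʰ c) blank) small₁) λ (a₁ , e₁) →
    bind (round true (λ c → Q₂ c (a₁ c)) (λ c → pick (ok? c) blank (Qʰ c)) (λ H s → small₂ H (proj₁ s))) λ (a₂ , e₂) →
    weaken (λ H (((s , s′) , (p₁ , q₁)) , (p₂ , q₂)) →
             (λ c → (s c , p₁ c) , p₂ c) ,
             (λ c → s′ c , answer (ok? c) (Qʰ c) _ (q₁ c) (q₂ c)))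
      (par {b} {h} {t} (λ c → proj₂ (proj₂ (nx₂ c (a₁ c))) (a₂ c))
                   (λ c → proj₂ (proj₂ (nxʰ c)) (pick (ok? c) (e₁ c) (e₂ c))))
    where
    q = b ℕ.+ b
    pick : ∀ {P X : Set} → Dec P → X → X → X
    pick (yes _) x y = x
    pick (no _) x y = y
    ok? : (c : Word q) → Dec (b ≤ cap c)
    ok? c = b ℕ.≤? cap c
    nx₁ = λ c → next blank (λ _ → tt) (τ c)
    Q₁ = λ c → proj₁ (nx₁ c)
    nx₂ = λ c a → next blank (λ _ → tt) (proj₂ (proj₂ (nx₁ c)) a)
    Q₂ = λ c a → proj₁ (nx₂ c a)
    nxʰ = λ c → next blank (blank-ok {b}) (η c)
    Qʰ = λ c → proj₁ (nxʰ c)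
    small : ∀ {c : Word q} {n} → (d : Dec (b ≤ cap c)) → (H : Hid h) → S′ c H → n ≡ cap c →
            Σ ℕ λ k → k < pow2 n × sval (pick d (Qʰ c) blank) H ≡ + k
    small {c} (yes b≤) H s refl with k , k< , e ← proj₁ (proj₂ (nxʰ c)) H s =
      k , ℕ.≤-trans k< (pow2-mono b≤) , e
    small {c} (no _) H s refl = blank-ok {cap c} H
    small₁ : ∀ H → _ → ∀ c → _
    small₁ H (_ , s′) c = small (ok? c) _ (s′ c) refl
    small′ : ∀ {c : Word q} → (d : Dec (b ≤ cap c)) → (H : Hid h) → S′ c H →
            Σ ℕ λ k → k < pow2 (cap (map not c)) × sval (pick d blank (Qʰ c)) H ≡ + k
    small′ {c} (yes _) H s = blank-ok {cap (map not c)} H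
    -- The capacities of c and its complement add up to b + b, so one below b forces the other to be
    -- at least b.
    small′ {c} (no b≰) H s with k , k< , e ← proj₁ (proj₂ (nxʰ c)) H s =
      k , ℕ.≤-trans k< (pow2-mono (ℕ.≮⇒≥ λ lt → ℕ.<-irrefl (cap-not c) (ℕ.+-mono-< (ℕ.≰⇒> b≰) lt))) , e
    small₂ : ∀ H → _ → ∀ c → _
    small₂ H (_ , s′) c = small′ (ok? c) _ (s′ c)
    answer : ∀ {P : Set} (d : Dec P) (Q : SQ h) (H : Hid h) {e₁ e₂ : ℤ} →
             sval (pick d Q blank) H ≡ e₁ → sval (pick d blank Q) H ≡ e₂ → sval Q H ≡ pick d e₁ e₂
    answer (yes _) Q H p₁ p₂ = p₁
    answer (no _) Q H p₁ p₂ = p₂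

-- Determining the items of one size class in a tree

module Stages (κ : ℕ) where

  open import Data.Nat using (zero; suc; _<_; _≤_; z≤n; _+_; _*_; _∸_; _/_; NonZero; >-nonZero; _<?_; _≤?_)
  open import Data.Nat.Properties
  open import Data.Nat.DivMod using (m*n/n≡m; /-monoˡ-≤; m/n*n≤m)
  open import Data.Nat.Tactic.RingSolver using (solve-∀)
  open import Data.Integer using (ℤ; ∣_∣) renaming (+_ to pos; _+_ to _+ᶻ_; _-_ to _-ᶻ_)
  import Data.Integer.Properties as ℤ
  open import Data.Fin using (Fin; zero; suc)
  open import Data.Vec using ([]; _∷_)
  open import Data.List using (List; []; _∷_)
  open import Data.List.Relation.Unary.Any using (there)
  open import Relation.Nullary.Decidable using (_×-dec_)
  open Learning
  open Sums
  open Signed κ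

  rep≡ : ∀ q t → rep q t ≡ pow2 q * t
  rep≡ zero t = sym (+-identityʳ t)
  rep≡ (suc q) t = trans (cong₂ _+_ (rep≡ q t) (rep≡ q t)) (sym (*-distribʳ-+ t (pow2 q) (pow2 q)))

  dbl≡ : ∀ t → dbl t ≡ 2 * t
  dbl≡ zero = refl
  dbl≡ (suc t) = trans (cong (λ k → suc (suc k)) (dbl≡ t)) (lem t)
    where
    lem : ∀ t → suc (suc (2 * t)) ≡ 2 * suc t
    lem = solve-∀

  cost≡ : ∀ q t → cost q t ≡ 2 * pow2 q * t
  cost≡ q zero = sym (*-zeroʳ (2 * pow2 q))
  cost≡ q (suc t) rewrite rep≡ q 1 | cost≡ q t = lem (pow2 q) t
    where
    lem : ∀ x t → x * 1 + (x * 1 + 2 * x * t) ≡ 2 * x * suc t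
    lem = solve-∀

  cnt : ∀ {h} → Hid h → Fin κ → ℕ
  cnt {h} H v = sumW h (H v)

  load : ∀ {h} → Hid h → ℕ
  load H = sumF κ (cnt H)

  cnt-sub≤ : ∀ {h} b (H : Hid (suc h)) v → cnt (sub b H) v ≤ cnt H v
  cnt-sub≤ false H v = m≤m+n _ _
  cnt-sub≤ true H v = m≤n+m _ _

  -- `T π b v` is the count claimed for item v in child b of the node at path π; the count at the
  -- root is passed separately as m. Paths are plain lists, so that tables for all heights share one
  -- type.
  Tab : Set
  Tab = List Bool → Bool → Fin κ → ℕ

  below : {X : Set} → Bool → (List Bool → X) → List Bool → X
  below b T π = T (b ∷ π)

  belowW : {X : Set} → ∀ {q} → Word q → (List Bool → X) → List Bool → X
  belowW [] T = T
  belowW (b ∷ c) T = belowW c (below b T)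

  glue : {X : Set} → ∀ q → (List Bool → X) → (Word q → List Bool → X) → List Bool → X
  glue zero T f π = f [] π
  glue (suc q) T f [] = T []
  glue (suc q) T f (b ∷ π) = glue q (below b T) (λ c → f (b ∷ c)) π

  belowW-glue : {X : Set} → ∀ q (T : List Bool → X) f (c : Word q) → belowW c (glue q T f) ≡ f c
  belowW-glue zero T f [] = refl
  belowW-glue (suc q) T f (b ∷ c) = belowW-glue q (below b T) (λ c → f (b ∷ c)) c

  -- just b marks a node whose b-child is known to be empty; such nodes need not be balanced.
  Shape : Set
  Shape = List Bool → Maybe Bool

  -- A load of at most the number of leaves, divided by 2 ^ j, bounds the items of class j. A node
  -- with an empty half needs no such bound, since its counts pass to the other half unchanged.
  Node : ∀ {h} → Maybe Bool → Hid (suc h) → Set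
  Node {h} nothing H = load H ≤ pow2 (suc h)
  Node (just b) H = ∀ v → cnt (sub b H) v ≡ 0

  data Good : ∀ h → Shape → Hid h → Set where
    tip  : ∀ {sh H} → Good zero sh H
    fork : ∀ {h sh H} → Node (sh []) H → (∀ b → Good h (below b sh) (sub b H)) → Good (suc h) sh H

  Good-subs : ∀ {q h sh} (c : Word q) {H : Hid (q + h)} → Good (q + h) sh H → Good h (belowW c sh) (subs c H)
  Good-subs [] g = g
  Good-subs (b ∷ c) (fork _ g) = Good-subs c (g b)

  -- The threshold concerns the node and not the child: a rare item of the child is recorded if it
  -- is frequent at the node. The entries of infrequent items must be 0, so that these are never
  -- taken for active ones.
  record Exact {h} (j : ℕ) (H : Hid (suc h)) (f : Bool → Fin κ → ℕ) : Set where
    constructor exactly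
    field at-items : ∀ b v → (pow2 j ≤ cnt H v → f b v ≡ cnt (sub b H) v) × (cnt H v < pow2 j → f b v ≡ 0)
  open Exact

  data Known (j : ℕ) : ℕ → ∀ {h} → Hid h → Tab → Set where
    top  : ∀ {h} {H : Hid h} {T} → Known j zero H T
    tip  : ∀ {d} {H : Hid zero} {T} → Known j (suc d) H T
    fork : ∀ {d h} {H : Hid (suc h)} {T} → Exact j H (T []) →
           (∀ b → Known j d (sub b H) (below b T)) → Known j (suc d) H T

  Known-below : ∀ {j q h} (c : Word q) {H : Hid (q + h)} {T} → Known j (q + h) H T → Known j h (subs c H) (belowW c T)
  Known-below [] k = k
  Known-below (b ∷ c) (fork _ k) = Known-below c (k b)

  Known-top : ∀ {j} q {h} {H : Hid (q + h)} {T} → Known j (q + h) H T → Known j q H T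
  Known-top zero k = top
  Known-top (suc q) (fork e k) = fork e λ b → Known-top q (k b)

  Known-glue-top : ∀ {j} q {h} {H : Hid (q + h)} {T f} → Known j q H T → Known j q H (glue q T f)
  Known-glue-top zero k = top
  Known-glue-top (suc q) (fork e k) = fork e λ b → Known-glue-top q (k b)

  Known-glue : ∀ {j} q {h} {H : Hid (q + h)} {T f} → Known j q H T → (∀ c → Known j h (subs c H) (f c)) →
               Known j (q + h) H (glue q T f)
  Known-glue zero _ k = k []
  Known-glue (suc q) (fork e k) k′ = fork e λ b → Known-glue q (k b) (λ c → k′ (b ∷ c))

  rootAt : ∀ {q} → Word q → (Fin κ → ℕ) → Tab → Fin κ → ℕ
  rootAt [] m T = m
  rootAt (b ∷ c) m T = rootAt c (T [] b) (below b T)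

  elem : ∀ {h} → Fin κ → SQ (suc h)
  elem v = join ((λ _ → just v) ⊝ none) blank

  sval-elem : ∀ {h} v (H : Hid (suc h)) → sval (elem v) H ≡ pos (cnt (sub false H) v)
  sval-elem {h} v H = trans (sval-join ((λ _ → just v) ⊝ none) blank H)
    (trans (cong₂ _+ᶻ_ (cong (λ k → pos (cnt (sub false H) v) -ᶻ pos k) (sumW-zero h)) (sval-blank (sub true H)))
      (trans (ℤ.+-identityʳ _) (ℤ.+-identityʳ _)))

  module Class (j : ℕ) where

    private instance
      nz : NonZero (pow2 j)
      nz = >-nonZero (pow2>0 j)

    -- At a balanced node of height h at most β h items occur 2 ^ j times or more.
    β : ℕ → ℕ
    β h = pow2 h / pow2 j

    sp : ℕ → ℕ → ℕ
    sp zero h = 0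
    sp (suc d) zero = 0
    sp (suc d) (suc h) = β (suc h) + (sp d h + sp d h)

    β-suc : ∀ h → β h + β h ≤ β (suc h)
    β-suc h = ≤-trans (≤-reflexive (sym (m*n/n≡m (β h + β h) (pow2 j))))
      (/-monoˡ-≤ (pow2 j) (≤-trans (≤-reflexive (*-distribʳ-+ (pow2 j) (β h) (β h)))
        (+-mono-≤ (m/n*n≤m (pow2 h) (pow2 j)) (m/n*n≤m (pow2 h) (pow2 j)))))

    sp≤ : ∀ d h → sp d h ≤ d * β h
    sp≤ zero h = z≤n
    sp≤ (suc d) zero = z≤n
    sp≤ (suc d) (suc h) = +-monoʳ-≤ (β (suc h)) (≤-trans (+-mono-≤ (sp≤ d h) (sp≤ d h))
      (≤-trans (≤-reflexive (sym (*-distribˡ-+ d (β h) (β h)))) (*-monoʳ-≤ d (β-suc h))))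

    -- What a child inherits from `Exact` at its parent: an item too rare at the parent is recorded
    -- as 0 although it may occur in the child.
    record RootOk {h} (H : Hid h) (m : Fin κ → ℕ) : Set where
      constructor rootOk
      field root : ∀ v → m v ≡ cnt H v ⊎ (m v ≡ 0 × cnt H v < pow2 j)
    open RootOk

    RootOk-child : ∀ {h} {H : Hid (suc h)} {f} → Exact j H f → ∀ b → RootOk (sub b H) (f b)
    RootOk-child {H = H} {f} ex b = rootOk go
      where
      go : ∀ v → f b v ≡ cnt (sub b H) v ⊎ (f b v ≡ 0 × cnt (sub b H) v < pow2 j)
      go v with pow2 j ≤? cnt H v
      ... | yes le = inj₁ (proj₁ (at-items ex b v) le)
      ... | no gt = inj₂ (proj₂ (at-items ex b v) (≰⇒> gt) , ≤-<-trans (cnt-sub≤ b H v) (≰⇒> gt))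

    RootOk-at : ∀ {q h} (c : Word q) {H : Hid (q + h)} {m T} → RootOk H m → Known j q H T →
                RootOk (subs c H) (rootAt c m T)
    RootOk-at [] r k = r
    RootOk-at (b ∷ c) r (fork e k) = RootOk-at c (RootOk-child e b) (k b)

    big : ∀ {h} {H : Hid h} {m} → RootOk H m → ∀ v → pow2 j ≤ m v → m v ≡ cnt H v
    big r v le with root r v
    ... | inj₁ e = e
    ... | inj₂ (e , _) = ⊥-elim (<⇒≱ (pow2>0 j) (subst (pow2 j ≤_) e le))

    small : ∀ {h} {H : Hid h} {m} → RootOk H m → ∀ v → m v < pow2 j → cnt H v < pow2 j
    small r v lt with root r v
    ... | inj₁ e = subst (_< pow2 j) e lt
    ... | inj₂ (_ , l) = l

    Active : (Fin κ → ℕ) → Fin κ → Set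
    Active m v = pow2 j ≤ m v × m v < pow2 (suc j)

    active? : ∀ m v → Dec (Active m v)
    active? m v = (pow2 j ≤? m v) ×-dec (m v <? pow2 (suc j))

    exact : ∀ {h} {H : Hid (suc h)} {m} f → RootOk H m →
            (∀ b v → m v < pow2 j → f b v ≡ 0) →
            (∀ b v → pow2 j ≤ m v → m v ≡ cnt H v → f b v ≡ cnt (sub b H) v) → Exact j H f
    exact {h} {H} {m} f r lo hi = exactly go
      where
      go : ∀ b v → (pow2 j ≤ cnt H v → f b v ≡ cnt (sub b H) v) × (cnt H v < pow2 j → f b v ≡ 0)
      go b v with pow2 j ≤? m v
      ... | yes le = (λ _ → hi b v le (big r v le)) ,
                   (λ lt → ⊥-elim (<⇒≱ lt (subst (pow2 j ≤_) (big r v le) le)))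
      ... | no gt = (λ le → ⊥-elim (<⇒≱ (small r v (≰⇒> gt)) le)) , (λ _ → lo b v (≰⇒> gt))

    -- Items above the class are copied from g and items below it are set to 0, so only the active
    -- ones are asked. Their counts are below 2 ^ (j + 1), which keeps the promise of `Bounded`.
    node : ∀ {h} (s : Maybe Bool) (m : Fin κ → ℕ) (g : Bool → Fin κ → ℕ) →
           Learn (Bounded (suc j) (suc h)) (λ H f → Exact j H f)
             (λ H → RootOk H m × Node s H × Exact (suc j) H g) (β (suc h))
    node {h} (just b₀) m g = done f (λ H (r , z , _) → exact f r lo (λ b v le e → hi H z b v le e))
      where
      f : Bool → Fin κ → ℕ
      f b v with pow2 j ≤? m v
      ... | no _ = 0
      f b v | yes _ with b Data.Bool.≟ b₀
      ... | yes _ = 0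
      ... | no _ = m v
      lo : ∀ b v → m v < pow2 j → f b v ≡ 0
      lo b v lt with pow2 j ≤? m v
      ... | yes le = ⊥-elim (<⇒≱ lt le)
      ... | no _ = refl
      other : ∀ (H : Hid (suc h)) b b′ v → ¬ b ≡ b′ → cnt (sub b′ H) v ≡ 0 → cnt H v ≡ cnt (sub b H) v
      other H false false v ne z = ⊥-elim (ne refl)
      other H false true v ne z = trans (cong (cnt (sub false H) v +_) z) (+-identityʳ _)
      other H true false v ne z = cong (_+ cnt (sub true H) v) z
      other H true true v ne z = ⊥-elim (ne refl)
      hi : ∀ H → (∀ v → cnt (sub b₀ H) v ≡ 0) → ∀ b v → pow2 j ≤ m v → m v ≡ cnt H v → f b v ≡ cnt (sub b H) v
      hi H z b v le e with pow2 j ≤? m v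
      ... | no gt = ⊥-elim (gt le)
      hi H z b v le e | yes _ with b Data.Bool.≟ b₀
      ... | yes refl = sym (z v)
      ... | no ne = trans e (other H b b₀ v ne (z v))
    node {h} nothing m g with size ≤? β (suc h)
      where open Enumeration (enumerate κ (active? m))
    -- More active items than the load allows: no object is consistent, and any table will do.
    ... | no gt = done g λ H (r , ld , _) → ⊥-elim (gt (≤-trans
      (≤-reflexive (sym (m*n/n≡m size (pow2 j))))
      (/-monoˡ-≤ (pow2 j) (≤-trans (size* (pow2 j) (cnt H)
        (λ v (le , _) → subst (pow2 j ≤_) (big r v le) le)) ld))))
      where open Enumeration (enumerate κ (active? m))
    ... | yes le = relax (≤-trans (≤-reflexive (*-identityʳ size)) le) (mapL f (λ _ s → s)
        (λ H ρ (r , _ , eg) rs → exact (f ρ) r (lo ρ) (hi H ρ eg rs))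
        (learnFin size λ i → query (elem (item i)) λ H (r , _) → cnt (sub false H) (item i) ,
          ≤-<-trans (cnt-sub≤ false H (item i)) (fits H r i) , sval-elem (item i) H))
      where
      open Enumeration (enumerate κ (active? m))
      fits : ∀ H → RootOk H m → ∀ i → cnt H (item i) < pow2 (suc j)
      fits H r i = subst (_< pow2 (suc j)) (big r (item i) (proj₁ (sound i))) (proj₂ (sound i))
      left : ∀ H ρ → (∀ i → sval (elem (item i)) H ≡ ρ i) → ∀ v p → ∣ ρ (find v p) ∣ ≡ cnt (sub false H) v
      left H ρ rs v p = trans (cong ∣_∣ (trans (sym (rs (find v p))) (sval-elem _ H)))
        (cong (cnt (sub false H)) (item-find v p))
      f : (Fin size → ℤ) → Bool → Fin κ → ℕ
      f ρ b v with pow2 j ≤? m v | m v <? pow2 (suc j)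
      ... | no _ | _ = 0
      ... | yes _ | no _ = g b v
      f ρ false v | yes lo | yes hi = ∣ ρ (find v (lo , hi)) ∣
      f ρ true v | yes lo | yes hi = m v ∸ ∣ ρ (find v (lo , hi)) ∣
      lo : ∀ ρ b v → m v < pow2 j → f ρ b v ≡ 0
      lo ρ b v lt with pow2 j ≤? m v | m v <? pow2 (suc j)
      ... | yes le | _ = ⊥-elim (<⇒≱ lt le)
      ... | no _ | yes _ = refl
      ... | no _ | no _ = refl
      hi : ∀ H ρ → Exact (suc j) H g → (∀ i → sval (elem (item i)) H ≡ ρ i) →
           ∀ b v → pow2 j ≤ m v → m v ≡ cnt H v → f ρ b v ≡ cnt (sub b H) v
      hi H ρ eg rs b v le e with pow2 j ≤? m v | m v <? pow2 (suc j)
      ... | no gt | _ = ⊥-elim (gt le)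
      ... | yes _ | no gt = proj₁ (at-items eg b v) (subst (pow2 (suc j) ≤_) e (≮⇒≥ gt))
      hi H ρ eg rs false v le e | yes p | yes p′ = left H ρ rs v (p , p′)
      hi H ρ eg rs true v le e | yes p | yes p′ =
        trans (cong₂ _∸_ e (left H ρ rs v (p , p′))) (m+n∸m≡n (cnt (sub false H) v) (cnt (sub true H) v))

    split : ∀ d h sh (m : Fin κ → ℕ) (T : Tab) →
            Learn (Bounded (suc j) h) (λ H T′ → Known j d H T′)
              (λ H → RootOk H m × Good h sh H × Known (suc j) d H T) (sp d h)
    split zero h sh m T = done T (λ _ _ → top)
    split (suc d) zero sh m T = done T (λ _ _ → tip)
    split (suc d) (suc h) sh m T =
      bind (weaken (λ { H (r , fork n _ , fork e _) → r , n , e }) (node (sh []) m (T []))) λ f →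
      bind (weaken (λ { H ((r , fork _ g , fork _ k) , e) → RootOk-child e false , g false , k false })
             (embedᵇ {suc j} (false ∷ []) (split d h (below false sh) (f false) (below false T)))) λ T₀ →
      mapL (paste f T₀)
           (λ { H (((r , fork _ g , fork _ k) , e) , _) → RootOk-child e true , g true , k true })
           (λ { H T₁ ((_ , e) , k₀) k₁ → fork e λ { false → k₀ ; true → k₁ } })
           (embedᵇ {suc j} (true ∷ []) (split d h (below true sh) (f true) (below true T)))
      where
      paste : (Bool → Fin κ → ℕ) → Tab → Tab → Tab
      paste f T₀ T₁ [] = f
      paste f T₀ T₁ (false ∷ π) = T₀ π
      paste f T₀ T₁ (true ∷ π) = T₁ π

    -- A word of length q or its complement has capacity j + 1, the number of bits of an active
    -- reply; one more letter selects the half of the subtrees.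
    q D : ℕ
    q = suc j + suc j
    D = suc q

    -- Preparing a node determines the counts D levels below and prepares half of the nodes there;
    -- the other half are prepared while the first half are solved.
    module Levels (r₀ : ℕ) (r₀≤ : r₀ ≤ D) where

      -- Each level adds D to the height, so the base absorbs the remainder r₀ of the division by D.
      ht : ℕ → ℕ
      ht zero = j + r₀
      ht (suc ℓ) = suc (q + ht ℓ)

      u : ℕ → ℕ
      u zero = pow2 r₀
      u (suc ℓ) = pow2 D * u ℓ

      -- Walking down D levels costs D * u ℓ, and preparing half of the subtrees below costs as much
      -- again: the factor 2 is the sum of the geometric series.
      s : ℕ → ℕ
      s ℓ = 2 * D * u ℓ

      pow2-ht : ∀ ℓ → pow2 (ht ℓ) ≡ u ℓ * pow2 j
      pow2-ht zero = trans (pow2-+ j r₀) (*-comm (pow2 j) (pow2 r₀))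
      pow2-ht (suc ℓ) = trans (pow2-+ D (ht ℓ)) (trans (cong (pow2 D *_) (pow2-ht ℓ)) (sym (*-assoc (pow2 D) (u ℓ) (pow2 j))))

      β-ht : ∀ ℓ → β (ht ℓ) ≡ u ℓ
      β-ht ℓ = trans (cong (_/ pow2 j) (pow2-ht ℓ)) (m*n/n≡m (u ℓ) (pow2 j))

      Pre : ∀ ℓ → Hid (ht ℓ) → Tab → Set
      Pre zero H T = Known j (ht zero) H T
      Pre (suc ℓ) H T = Known j D H T ×
        (∀ c → Pre ℓ (subs (false ∷ c) H) (belowW {q = D} (false ∷ c) T)) ×
        (∀ c → Known (suc j) (ht ℓ) (subs (true ∷ c) H) (belowW {q = D} (true ∷ c) T))

      cost₀ : sp (ht zero) (ht zero) ≤ s zero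
      cost₀ = ≤-trans (sp≤ (ht zero) (ht zero)) (*-mono-≤ {j + r₀} {2 * D}
        (+-mono-≤ (≤-trans (m≤m+n j (suc j)) (≤-trans (n≤1+n _) (n≤1+n _))) (≤-trans r₀≤ (≤-reflexive (sym (+-identityʳ D)))))
        (≤-reflexive (β-ht zero)))

      cost₁ : ∀ ℓ → sp D (ht (suc ℓ)) + rep q (s ℓ) ≤ s (suc ℓ)
      cost₁ ℓ = ≤-trans (+-mono-≤ (≤-trans (sp≤ D (ht (suc ℓ))) (≤-reflexive (cong (D *_) (β-ht (suc ℓ)))))
                                  (≤-reflexive (rep≡ q (s ℓ))))
                        (≤-reflexive (lem D (pow2 q) (u ℓ)))
        where
        lem : ∀ d x y → d * ((x + x) * y) + x * (2 * d * y) ≡ 2 * d * ((x + x) * y)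
        lem = solve-∀

      -- Solving the first half in parallel and the second half in turn each cost `s (suc ℓ)`.
      cost₂ : ∀ ℓ → cost q (s ℓ) + rep q (dbl (s ℓ)) ≤ dbl (s (suc ℓ))
      cost₂ ℓ rewrite cost≡ q (s ℓ) | dbl≡ (s ℓ) | rep≡ q (2 * s ℓ) | dbl≡ (s (suc ℓ)) =
        ≤-reflexive (lem D (pow2 q) (u ℓ))
        where
        lem : ∀ d x y → 2 * x * (2 * d * y) + x * (2 * (2 * d * y)) ≡ 2 * (2 * d * ((x + x) * y))
        lem = solve-∀

      prep : ∀ ℓ sh m T → Learn (Bounded (suc j) (ht ℓ)) (λ H T′ → Pre ℓ H T′)
               (λ H → RootOk H m × Good (ht ℓ) sh H × Known (suc j) (ht ℓ) H T) (s ℓ)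
      prep zero sh m T = relax cost₀ (split (ht zero) (ht zero) sh m T)
      prep (suc ℓ) sh m T = relax (cost₁ ℓ)
        (bind (weaken (λ H (r , g , k) → r , g , Known-top D k) (split D (ht (suc ℓ)) sh m T)) λ T₁ →
         mapL (λ F → glue D T₁ (sel F))
           (λ H ((r , g , k) , k₁) c → RootOk-at (false ∷ c) r k₁ , Good-subs {q = D} (false ∷ c) g , Known-below {q = D} (false ∷ c) k)
           (λ H F ((_ , _ , k) , k₁) ks → Known-glue-top D k₁ ,
              (λ c → subst (Pre ℓ _) (sym (belowW-glue D T₁ (sel F) (false ∷ c))) (ks c)) ,
              (λ c → subst (Known (suc j) (ht ℓ) _) (sym (belowW-glue D T₁ (sel F) (true ∷ c))) (Known-below {q = D} (true ∷ c) k)))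
           (learnWords q λ c → weaken (λ H p → p c)
             (embedᵇ {suc j} {D} (false ∷ c) (prep ℓ (belowW {q = D} (false ∷ c) sh) (rootAt {D} (false ∷ c) m T₁) (belowW {q = D} (false ∷ c) T)))))
        where
        sel : (Word q → Tab) → Word D → Tab
        sel F (false ∷ c) = F c
        -- Subtrees not yet prepared keep the table of the class above, which their own preparation
        -- needs later.
        sel F (true ∷ c) = belowW {q = D} (true ∷ c) T

      -- The budget is twice that of `prep`, exactly the ratio at which `par` runs a solving tree
      -- beside a preparing one.
      solve : ∀ ℓ sh m T → Learn (Free (ht ℓ)) (λ H T′ → Known j (ht ℓ) H T′)
                (λ H → RootOk H m × Good (ht ℓ) sh H × Pre ℓ H T) (dbl (s ℓ))
      solve zero sh m T = done T (λ H (_ , _ , k) → k)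
      solve (suc ℓ) sh m T = relax (cost₂ ℓ)
        (bind (weaken (λ H (r , g , (k , p , k′)) →
                  (λ c → RootOk-at (false ∷ c) r k , Good-subs {q = D} (false ∷ c) g , p c) ,
                  (λ c → RootOk-at (true ∷ c) r k , Good-subs {q = D} (true ∷ c) g , k′ c))
                (par {suc j} {ht ℓ} {s ℓ}
                  (λ c → solve ℓ (belowW {q = D} (false ∷ c) sh) (rootAt {D} (false ∷ c) m T) (belowW {q = D} (false ∷ c) T))
                  (λ c → prep ℓ (belowW {q = D} (true ∷ c) sh) (rootAt {D} (true ∷ c) m T) (belowW {q = D} (true ∷ c) T))))
          λ (F , F′) →
          mapL (λ F″ → glue D T (sel F F″))
            (λ H ((r , g , (k , _)) , (_ , p)) c → RootOk-at (true ∷ c) r k , Good-subs {q = D} (true ∷ c) g , p c)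
            (λ { H F″ ((_ , _ , (k , _)) , (k₀ , _)) k₁ → Known-glue D k λ { (false ∷ c) → k₀ c ; (true ∷ c) → k₁ c } })
            (learnWords q λ c → weaken (λ H p → p c)
              (embed {q = D} (true ∷ c) (solve ℓ (belowW {q = D} (true ∷ c) sh) (rootAt {D} (true ∷ c) m T) (F′ c)))))
        where
        sel : (Word q → Tab) → (Word q → Tab) → Word D → Tab
        sel F F″ (false ∷ c) = F c
        sel F F″ (true ∷ c) = F″ c

      stage : ∀ ℓ sh m T → Learn (Free (ht ℓ)) (λ H T′ → Known j (ht ℓ) H T′)
                (λ H → RootOk H m × Good (ht ℓ) sh H × Known (suc j) (ht ℓ) H T) (3 * s ℓ)
      stage ℓ sh m T = relax (≤-reflexive (lem (s ℓ)))
        (bind (forget {suc j} (prep ℓ sh m T)) λ T₁ →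
         weaken (λ H ((r , g , _) , p) → r , g , p) (solve ℓ sh m T₁))
        where
        lem : ∀ t → t + dbl t ≡ 3 * t
        lem t = cong (t +_) (dbl≡ t)

-- All classes together, and many blocks at once

module Blocks (κ : ℕ) where

  open import Data.Nat using (zero; suc; _<_; _≤_; z≤n; _+_; _*_; _/_; _%_; _≤?_)
  open import Data.Nat.Properties
  open import Data.Nat.DivMod using (m≡m%n+[m/n]*n; m%n<n)
  open import Data.Nat.Tactic.RingSolver using (solve-∀)
  open import Data.Integer using (ℤ; ∣_∣) renaming (+_ to pos; _+_ to _+ᶻ_; _-_ to _-ᶻ_)
  import Data.Integer.Properties as ℤ
  open import Data.Fin using (Fin; zero; suc)
  open import Data.Vec using ([]; _∷_; _++_)
  open import Data.List using ([])
  open Learning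
  open Sums
  open Signed κ
  open Stages κ

  stageAt : ∀ j g sh m T → Learn (Free (j + g)) (λ H T′ → Known j (j + g) H T′)
              (λ H → Class.RootOk j H m × Good (j + g) sh H × Known (suc j) (j + g) H T)
              (6 * (2 * j + 3) * pow2 g)
  stageAt j g sh m T = cast (j + g) (height) (stage ℓ sh m T)
    where
    open Class j
    ℓ = g / D
    open Levels (g % D) (<⇒≤ (m%n<n g D))
    ht≡ : ∀ ℓ → ht ℓ ≡ j + (g % D + ℓ * D)
    ht≡ zero = cong (j +_) (sym (+-identityʳ _))
    ht≡ (suc ℓ) = trans (cong (D +_) (ht≡ ℓ)) (lem D j (g % D) (ℓ * D))
      where
      lem : ∀ d j r x → d + (j + (r + x)) ≡ j + (r + (d + x))
      lem = solve-∀
    u≡ : ∀ ℓ → u ℓ ≡ pow2 (g % D + ℓ * D)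
    u≡ zero = cong pow2 (sym (+-identityʳ (g % D)))
    u≡ (suc ℓ) = trans (cong (pow2 D *_) (u≡ ℓ)) (trans (sym (pow2-+ D _)) (cong pow2 (lem D (g % D) (ℓ * D))))
      where
      lem : ∀ d r x → d + (r + x) ≡ r + (d + x)
      lem = solve-∀
    height : ht ℓ ≡ j + g
    height = trans (ht≡ ℓ) (cong (j +_) (sym (m≡m%n+[m/n]*n g D)))
    cost≤ : 3 * s ℓ ≤ 6 * (2 * j + 3) * pow2 g
    cost≤ = ≤-reflexive (trans (cong (λ x → 3 * (2 * D * x)) (trans (u≡ ℓ) (cong pow2 (sym (m≡m%n+[m/n]*n g D)))))
      (lem j (pow2 g)))
      where
      lem : ∀ j x → 3 * (2 * suc (suc j + suc j) * x) ≡ 6 * (2 * j + 3) * x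
      lem = solve-∀
    cast : ∀ h → ht ℓ ≡ h →
           Learn (Free (ht ℓ)) (λ H T′ → Known j (ht ℓ) H T′) (λ H → RootOk H m × Good (ht ℓ) sh H × Known (suc j) (ht ℓ) H T) (3 * s ℓ) →
           Learn (Free h) (λ H T′ → Known j h H T′) (λ H → RootOk H m × Good h sh H × Known (suc j) h H T) (6 * (2 * j + 3) * pow2 g)
    cast h refl = relax cost≤

  stagesCost : ℕ → ℕ → ℕ
  stagesCost zero g = 0
  stagesCost (suc j) g = 6 * (2 * j + 3) * pow2 g + stagesCost j (suc g)

  -- The second summand is a potential: with x = 2 ^ g, 6 (2 j + 3) x + 6 (2 j + 7) x = 12 (2 j + 5)
  -- x, so passing to the next class leaves the total unchanged.
  stagesCost≡ : ∀ j g → stagesCost j g + 6 * pow2 g * (2 * j + 5) ≡ 30 * pow2 (j + g)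
  stagesCost≡ zero g = lem (pow2 g)
    where
    lem : ∀ x → 6 * x * 5 ≡ 30 * x
    lem = solve-∀
  stagesCost≡ (suc j) g = trans (lem j (pow2 g) (stagesCost j (suc g)))
    (trans (stagesCost≡ j (suc g)) (cong (λ k → 30 * pow2 k) (+-suc j g)))
    where
    lem : ∀ j x c → 6 * (2 * j + 3) * x + c + 6 * x * (2 * suc j + 5) ≡ c + 6 * (x + x) * (2 * j + 5)
    lem = solve-∀

  Root : ∀ {h} → Hid h → (Fin κ → ℕ) → Set
  Root H m = ∀ v → m v ≡ cnt H v

  stages : ∀ p j g → suc p ≡ j + g → ∀ sh m T → Learn (Free p) (λ H T′ → Known 0 p H T′)
             (λ H → Root H m × Good p sh H × Known j p H T) (stagesCost j g)
  stages p zero g eq sh m T = done T λ H (_ , _ , k) → k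
  stages p (suc j) g eq sh m T with refl ← suc-injective eq =
    bind (weaken (λ H (r , gd , k) → Class.rootOk (λ v → inj₁ (r v)) , gd , k) (stageAt j g sh m T)) λ T′ →
    weaken (λ H ((r , gd , _) , k) → r , gd , k) (stages p j (suc g) (sym (+-suc j g)) sh m T′)

  nothingKnown : ∀ {j} d {h} {H : Hid h} → (∀ v → cnt H v < pow2 j) → Known j d H (λ _ _ _ → 0)
  nothingKnown zero lt = top
  nothingKnown (suc d) {zero} lt = tip
  nothingKnown (suc d) {suc h} {H} lt = fork
    (exactly λ b v → (λ le → ⊥-elim (<⇒≱ (lt v) le)) , λ _ → refl)
    (λ b → nothingKnown d (λ v → ≤-<-trans (cnt-sub≤ b H v) (lt v)))

  -- For class 0 the threshold is 1: an item below it at a node does not occur there, so a recorded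
  -- 0 is the true count and the table is right everywhere.
  leaves : ∀ {p} {H : Hid p} {m T} → Root H m → Known 0 p H T → ∀ v w → H v w ≡ rootAt w m T v
  leaves {zero} r k v [] = sym (r v)
  leaves {suc p} {H} {T = T} r (fork e k) v (b ∷ w) = leaves r′ (k b) v w
    where
    r′ : Root (sub b H) (T [] b)
    r′ v with 1 ≤? cnt H v
    ... | yes le = proj₁ (Exact.at-items e b v) le
    ... | no gt = trans (proj₂ (Exact.at-items e b v) (≰⇒> gt))
                        (sym (n≤0⇒n≡0 (≤-trans (cnt-sub≤ b H v) (≤-pred (≰⇒> gt)))))

  Table : ℕ → Set
  Table p = Fin κ → Word p → ℕ

  Is : ∀ {p} → Hid p → Table p → Set
  Is H X = ∀ v w → H v w ≡ X v w

  -- All counts lie below 2 ^ (p + 1), so for class p + 1 the zero table is already correct and the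
  -- stages descend from there.
  solveAll : ∀ p sh m → Learn (Free p) Is
               (λ H → Root H m × Good p sh H × (∀ v → cnt H v < pow2 (suc p))) (60 * pow2 p)
  solveAll p sh m = relax cost≤ (mapL (λ T v w → rootAt w m T v)
      (λ H (r , g , lt) → r , g , nothingKnown p lt)
      (λ H T (r , _) k → leaves r k)
      (stages p (suc p) 0 (cong suc (sym (+-identityʳ p))) sh m (λ _ _ _ → 0)))
    where
    lem : ∀ x → 30 * (x + x) ≡ 60 * x
    lem = solve-∀
    cost≤ : stagesCost (suc p) 0 ≤ 60 * pow2 p
    cost≤ = ≤-trans (m≤m+n _ _) (≤-reflexive (trans (stagesCost≡ (suc p) 0)
      (trans (cong (λ k → 30 * (pow2 k + pow2 k)) (+-identityʳ p)) (lem (pow2 p)))))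

  LeafOk : ℕ → ∀ {h} → Hid h → Set
  LeafOk B H = ∀ w → sumF κ (λ v → H v w) ≤ B

  sumW-mono : ∀ h {f g : Word h → ℕ} → (∀ i → f i ≤ g i) → sumW h f ≤ sumW h g
  sumW-mono zero e = e []
  sumW-mono (suc h) e = +-mono-≤ (sumW-mono h (λ i → e (false ∷ i))) (sumW-mono h (λ i → e (true ∷ i)))

  sumW-const : ∀ h → sumW h (λ _ → 1) ≡ pow2 h
  sumW-const zero = refl
  sumW-const (suc h) = cong₂ _+_ (sumW-const h) (sumW-const h)

  hit≤ : ∀ m (f : Fin κ → ℕ) → hit m f ≤ sumF κ f
  hit≤ nothing f = z≤n
  hit≤ (just v) f = ≤-sumF κ f v

  val≤ : ∀ {h} (Q : Asg h) (H : Hid h) → LeafOk 1 H → val⁺ Q H ≤ pow2 h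
  val≤ {h} Q H ok = ≤-trans (sumW-mono h (λ w → ≤-trans (hit≤ (Q w) (λ v → H v w)) (ok w))) (≤-reflexive (sumW-const h))

  load≤ : ∀ {h} (H : Hid h) → LeafOk 1 H → load H ≤ pow2 h
  load≤ {zero} H ok = ok []
  load≤ {suc h} H ok = ≤-trans (≤-reflexive (sumF-+ κ (cnt (sub false H)) (cnt (sub true H))))
    (+-mono-≤ (load≤ (sub false H) (λ w → ok (false ∷ w))) (load≤ (sub true H) (λ w → ok (true ∷ w))))

  good : ∀ h (H : Hid h) → LeafOk 1 H → Good h (λ _ → nothing) H
  good zero H ok = tip
  good (suc h) H ok = fork (load≤ H ok) (λ b → good h (sub b H) (λ w → ok (b ∷ w)))

  pow2<suc : ∀ {n} p → n ≤ pow2 p → n < pow2 (suc p)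
  pow2<suc p le = ≤-<-trans le (m<m+n (pow2 p) (pow2>0 p))

  blockCost : ℕ → ℕ
  blockCost p = κ * 1 + 60 * pow2 p * 2

  sval⁺ : ∀ {h} (P : Asg h) (H : Hid h) → sval (P ⊝ none) H ≡ pos (val⁺ P H)
  sval⁺ {h} P H = trans (cong (λ k → pos (val⁺ P H) -ᶻ pos k) (sumW-zero h)) (ℤ.+-identityʳ _)

  -- A hidden reply must be a bounded natural number, so a block that rides along asks the two parts
  -- of a signed query separately, at twice the cost.
  unsigned : ∀ {b h} {S : Hid h → Set} → (∀ H → S H → ∀ Q → val⁺ Q H < pow2 b) → (Q : SQ h) →
             Learn (Bounded b h) (λ H r → sval Q H ≡ r) S 2
  unsigned lt (P ⊝ N) = bind (query (P ⊝ none) (λ H s → val⁺ P H , lt H s P , sval⁺ P H)) λ r →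
    mapL (λ r′ → r -ᶻ r′) (λ _ → proj₁)
      (λ H r′ (_ , e) e′ → cong₂ _-ᶻ_ (trans (sym (sval⁺ P H)) e) (trans (sym (sval⁺ N H)) e′))
      (query (N ⊝ none) (λ H s → val⁺ N H , lt H s N , sval⁺ N H))

  block : ∀ p → Learn (Bounded (suc p) p) Is (LeafOk 1) (blockCost p)
  block p = bind
    (mapL (λ f v → ∣ f v ∣) (λ _ s → s) (λ H f s e v → cong ∣_∣ (trans (sym (e v)) (sval⁺ _ H)))
      (learnFin κ λ v → query ((λ _ → just v) ⊝ none) λ H ok → cnt H v , lt H ok (λ _ → just v) , sval⁺ _ H))
    λ m → weaken (λ H (ok , r) → (r , good p H ok , λ v → lt H ok (λ _ → just v)) , ok)
      (simulate (λ H → H) (unsigned {suc p} lt) (solveAll p (λ _ → nothing) m))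
    where
    lt : ∀ H → LeafOk 1 H → ∀ Q → val⁺ Q H < pow2 (suc p)
    lt H ok Q = pow2<suc p (val≤ Q H ok)

  module Multi (b p t : ℕ) {B : Set} {R : Hid p → B → Set} {S : Hid p → Set}
               (τ : Learn (Bounded b p) R S t) where

    q = b + b

    hh : ℕ → ℕ
    hh zero = p
    hh (suc L) = suc (q + hh L)

    -- `Idx` names the blocks that a guest tree solves one after the other. They lie in its `false`
    -- halves only; the other leaves pad the guest to the height of its host.
    Idx Slot : ℕ → Set
    Idx zero = ⊤
    Idx (suc L) = Word q × Idx L
    Slot zero = ⊤
    Slot (suc L) = (Word q × Slot L) ⊎ (Word q × Idx L)

    subI : ∀ {L} → Idx L → Hid (hh L) → Hid p
    subI {zero} ι H = H
    subI {suc L} (c , ι) H = subI ι (subs {suc q} (false ∷ c) H)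

    subS : ∀ {L} → Slot L → Hid (hh L) → Hid p
    subS {zero} σ H = H
    subS {suc L} (inj₁ (c , σ)) H = subS σ (subs {suc q} (false ∷ c) H)
    subS {suc L} (inj₂ (c , ι)) H = subI ι (subs {suc q} (true ∷ c) H)

    seqCost : ℕ → ℕ
    seqCost zero = t
    seqCost (suc L) = rep q (seqCost L)

    sequential : ∀ L → Learn (Bounded b (hh L)) (λ H (f : Idx L → B) → ∀ ι → R (subI ι H) (f ι))
                   (λ H → ∀ ι → S (subI ι H)) (seqCost L)
    sequential zero = mapL (λ x _ → x) (λ H s → s tt) (λ H x s r _ → r) τ
    sequential (suc L) = mapL (λ f (c , ι) → f c ι) (λ H s c ι → s (c , ι)) (λ { H f s r (c , ι) → r c ι })
      (learnWords q λ c → weaken (λ H s → s c) (embedᵇ {b} {suc q} (false ∷ c) (sequential L)))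

    -- Twice the cost of `sequential L` pays for all slots, which are L + 1 times as many as the
    -- indices, because each level adds guests that ride along. This is where the logarithmic factor
    -- is gained.
    parallel : ∀ L → Learn (Free (hh L)) (λ H (f : Slot L → B) → ∀ σ → R (subS σ H) (f σ))
                 (λ H → ∀ σ → S (subS σ H)) (dbl (seqCost L))
    parallel zero = relax (≤-trans (m≤m+n t _) (≤-reflexive (sym (dbl≡ t))))
      (mapL (λ x _ → x) (λ H s → s tt) (λ H x s r _ → r) (forget {b} τ))
    parallel (suc L) = relax cost≤
      (mapL out (λ H s → (λ c σ → s (inj₁ (c , σ))) , (λ c ι → s (inj₂ (c , ι))))
        (λ { H fs s (r , r′) (inj₁ (c , σ)) → r c σ ; H fs s (r , r′) (inj₂ (c , ι)) → r′ c ι })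
        (par {b} {hh L} {seqCost L} (λ _ → parallel L) (λ _ → sequential L)))
      where
      out : (Word q → Slot L → B) × (Word q → Idx L → B) → Slot (suc L) → B
      out (f , g) (inj₁ (c , σ)) = f c σ
      out (f , g) (inj₂ (c , ι)) = g c ι
      lem : ∀ x y → 2 * x * y ≡ 2 * (x * y)
      lem = solve-∀
      cost≤ : cost q (seqCost L) ≤ dbl (rep q (seqCost L))
      cost≤ = ≤-reflexive (trans (cost≡ q (seqCost L)) (trans (lem (pow2 q) (seqCost L))
        (trans (cong (2 *_) (sym (rep≡ q (seqCost L)))) (sym (dbl≡ _)))))

    addrI : ∀ {L} → Idx L → Word p → Word (hh L)
    addrI {zero} ι w = w
    addrI {suc L} (c , ι) w = false ∷ (c ++ addrI ι w)

    addrS : ∀ {L} → Slot L → Word p → Word (hh L)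
    addrS {zero} σ w = w
    addrS {suc L} (inj₁ (c , σ)) w = false ∷ (c ++ addrS σ w)
    addrS {suc L} (inj₂ (c , ι)) w = true ∷ (c ++ addrI ι w)

    subs-++ : ∀ {k h} (c : Word k) (H : Hid (k + h)) v w → subs c H v w ≡ H v (c ++ w)
    subs-++ [] H v w = refl
    subs-++ (b ∷ c) H v w = subs-++ c (sub b H) v w

    subI-addr : ∀ L (ι : Idx L) H v w → subI ι H v w ≡ H v (addrI ι w)
    subI-addr zero ι H v w = refl
    subI-addr (suc L) (c , ι) H v w = trans (subI-addr L ι _ v w) (subs-++ (false ∷ c) H v (addrI ι w))

    subS-addr : ∀ L (σ : Slot L) H v w → subS σ H v w ≡ H v (addrS σ w)
    subS-addr zero σ H v w = refl
    subS-addr (suc L) (inj₁ (c , σ)) H v w = trans (subS-addr L σ _ v w) (subs-++ (false ∷ c) H v (addrS σ w))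
    subS-addr (suc L) (inj₂ (c , ι)) H v w = trans (subI-addr L ι _ v w) (subs-++ (true ∷ c) H v (addrI ι w))

-- Binary logarithms and the size of the tree

module Numbers where

  open import Data.Nat using (ℕ; zero; suc; _<_; _≤_; s≤s; z≤n; _+_; _*_; _∸_; _^_; _/_; ⌊_/2⌋; NonZero; >-nonZero)
  open import Data.Nat.Properties
  open import Data.Nat.DivMod using (m≡m%n+[m/n]*n; m%n<n; m/n*n≤m)
  open import Data.Nat.Induction using (<-rec)
  open import Data.Nat.Logarithm using (⌊log₂_⌋; ⌊log₂⌋-mono-≤; ⌊log₂⌊n/2⌋⌋≡⌊log₂n⌋∸1; ⌊log₂[2^n]⌋≡n)
  open import Data.Nat.Tactic.RingSolver using (solve-∀)
  open Sums

  pow2≡2^ : ∀ m → pow2 m ≡ 2 ^ m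
  pow2≡2^ zero = refl
  pow2≡2^ (suc m) = cong₂ _+_ (pow2≡2^ m) (trans (pow2≡2^ m) (sym (+-identityʳ _)))

  pow2≤⇒≤log : ∀ m n → pow2 m ≤ n → m ≤ ⌊log₂ n ⌋
  pow2≤⇒≤log m n le = ≤-trans (≤-reflexive (sym (⌊log₂[2^n]⌋≡n m))) (⌊log₂⌋-mono-≤ (subst (_≤ n) (pow2≡2^ m) le))

  n<pow2-suc-log : ∀ n → n < pow2 (suc ⌊log₂ n ⌋)
  n<pow2-suc-log n = ≰⇒> λ le → <⇒≱ ≤-refl (pow2≤⇒≤log (suc ⌊log₂ n ⌋) n le)

  pow2-log≤ : ∀ n → 1 ≤ n → pow2 ⌊log₂ n ⌋ ≤ n
  pow2-log≤ = <-rec _ go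
    where
    go : ∀ n → (∀ {m} → m < n → 1 ≤ m → pow2 ⌊log₂ m ⌋ ≤ m) → 1 ≤ n → pow2 ⌊log₂ n ⌋ ≤ n
    go (suc zero) rec _ = ≤-refl
    go n@(suc (suc k)) rec _ = begin
      pow2 ⌊log₂ n ⌋                     ≡⟨ cong pow2 (sym (m+[n∸m]≡n (pow2≤⇒≤log 1 n (s≤s (s≤s z≤n))))) ⟩
      pow2 (1 + (⌊log₂ n ⌋ ∸ 1))         ≡⟨ cong (λ l → pow2 (1 + l)) (sym (⌊log₂⌊n/2⌋⌋≡⌊log₂n⌋∸1 n)) ⟩
      pow2 ⌊log₂ m ⌋ + pow2 ⌊log₂ m ⌋    ≤⟨ +-mono-≤ ih ih ⟩
      m + m                              ≤⟨ +-monoʳ-≤ m (⌊n/2⌋≤⌈n/2⌉ n) ⟩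
      m + _                              ≡⟨ ⌊n/2⌋+⌈n/2⌉≡n n ⟩
      n                                  ∎
      where
      open ≤-Reasoning
      m = ⌊ n /2⌋
      ih = rec (⌊n/2⌋<n (suc k)) (s≤s z≤n)

  suc≤pow2 : ∀ m → suc m ≤ pow2 m
  suc≤pow2 zero = ≤-refl
  suc≤pow2 (suc m) = ≤-trans (≤-reflexive (+-comm 1 (suc m))) (+-mono-≤ (suc≤pow2 m) (pow2>0 m))

  log≤ : ∀ n → 1 ≤ n → ⌊log₂ n ⌋ ≤ n
  log≤ n 1≤n = ≤-trans (n≤1+n _) (≤-trans (suc≤pow2 _) (pow2-log≤ n 1≤n))

  m<suc[m/n]*n : ∀ m n .{{_ : NonZero n}} → m < suc (m / n) * n
  m<suc[m/n]*n m n = ≤-trans (s≤s (≤-reflexive (m≡m%n+[m/n]*n m n))) (+-monoˡ-≤ _ (m%n<n m n))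

  -- Numbers of blocks handled sequentially by one host, and in parallel by a tree with L levels.
  hostBlocks treeBlocks : ℕ → ℕ → ℕ
  hostBlocks b zero = 1
  hostBlocks b (suc L) = pow2 (b + b) * hostBlocks b L
  treeBlocks b zero = 1
  treeBlocks b (suc L) = pow2 (b + b) * treeBlocks b L + pow2 (b + b) * hostBlocks b L

  hostBlocks≡ : ∀ b L → hostBlocks b L ≡ pow2 (L * (b + b))
  hostBlocks≡ b zero = refl
  hostBlocks≡ b (suc L) = trans (cong (pow2 (b + b) *_) (hostBlocks≡ b L)) (sym (pow2-+ (b + b) _))

  treeBlocks≡ : ∀ b L → treeBlocks b L ≡ suc L * hostBlocks b L
  treeBlocks≡ b zero = refl
  treeBlocks≡ b (suc L) = trans (cong (λ x → pow2 (b + b) * x + pow2 (b + b) * hostBlocks b L) (treeBlocks≡ b L))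
    (lem (pow2 (b + b)) (suc L) (hostBlocks b L))
    where
    lem : ∀ q l x → q * (l * x) + q * x ≡ suc l * (q * x)
    lem = solve-∀

  -- The largest tree with at most n leaves in its blocks has about log n / b levels.
  chooseTree : ∀ b p n → 1 ≤ b → p ≤ b → pow2 p ≤ n → Σ ℕ λ L → Σ ℕ λ g →
               n ≤ g * (treeBlocks b L * pow2 p) ×
               (∀ t → g * (2 * (hostBlocks b L * t)) * pow2 p * ⌊log₂ n ⌋ ≤ 32 * b * t * n)
  chooseTree b p n 1≤b p≤b p≤n = L , suc (n / M) , <⇒≤ (m<suc[m/n]*n n M) , bound
    where
    l = ⌊log₂ n ⌋
    instance
      nz : NonZero (4 * b)
      nz = >-nonZero (*-mono-≤ {1} {4} (s≤s z≤n) 1≤b)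
    -- With x levels the blocks have at most 2 ^ (x + 2 b x + p) leaves, and 4 b (x + 1) bounds this
    -- exponent. If the quotient is 0, a single block is used, which fits since `pow2 p ≤ n`.
    X = l / (4 * b)
    L = X ∸ 1
    M = treeBlocks b L * pow2 p
    M>0 : 0 < M
    M>0 = *-mono-≤ (≤-trans (*-mono-≤ {1} {suc L} (s≤s z≤n) (subst (1 ≤_) (sym (hostBlocks≡ b L)) (pow2>0 (L * (b + b)))))
                            (≤-reflexive (sym (treeBlocks≡ b L)))) (pow2>0 p)
    instance
      nzM : NonZero M
      nzM = >-nonZero M>0
    l≤ : l ≤ 8 * b * suc L
    l≤ = ≤-trans (<⇒≤ (m<suc[m/n]*n l (4 * b))) (case X)
      where
      lem : ∀ x b → suc (suc x) * (4 * b) + 4 * b * x ≡ 8 * b * suc x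
      lem = solve-∀
      case : ∀ X → suc X * (4 * b) ≤ 8 * b * suc (X ∸ 1)
      case zero = ≤-trans (m≤m+n _ (4 * b)) (≤-reflexive (lem₀ b))
        where
        lem₀ : ∀ b → 1 * (4 * b) + 4 * b ≡ 8 * b * 1
        lem₀ = solve-∀
      case (suc x) = ≤-trans (m≤m+n _ _) (≤-reflexive (lem x b))
    M≤n : M ≤ n
    M≤n = case X (m/n*n≤m l (4 * b))
      where
      case : ∀ X → X * (4 * b) ≤ l → treeBlocks b (X ∸ 1) * pow2 p ≤ n
      case zero _ = ≤-trans (≤-reflexive (*-identityˡ _)) p≤n
      case (suc x) le = begin
        treeBlocks b x * pow2 p                    ≡⟨ cong (_* pow2 p) (treeBlocks≡ b x) ⟩
        suc x * hostBlocks b x * pow2 p            ≤⟨ *-monoˡ-≤ (pow2 p) (*-mono-≤ (suc≤pow2 x) (≤-reflexive (hostBlocks≡ b x))) ⟩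
        pow2 x * pow2 (x * (b + b)) * pow2 p       ≡⟨ cong (_* pow2 p) (sym (pow2-+ x _)) ⟩
        pow2 (x + x * (b + b)) * pow2 p            ≡⟨ sym (pow2-+ (x + x * (b + b)) p) ⟩
        pow2 (x + x * (b + b) + p)                 ≤⟨ pow2-mono (≤-trans expo le) ⟩
        pow2 l                                     ≤⟨ pow2-log≤ n (≤-trans (pow2>0 p) p≤n) ⟩
        n                                          ∎
        where
        open ≤-Reasoning
        lem : ∀ x b → (x * b + x * (b + b) + b) + (x * b + 3 * b) ≡ suc x * (4 * b)
        lem = solve-∀
        expo : x + x * (b + b) + p ≤ suc x * (4 * b)
        expo = ≤-trans (+-mono-≤ (+-monoˡ-≤ (x * (b + b)) (≤-trans (≤-reflexive (sym (*-identityʳ x))) (*-monoʳ-≤ x 1≤b))) p≤b)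
          (≤-trans (m≤m+n _ _) (≤-reflexive (lem x b)))
    bound : ∀ t → suc (n / M) * (2 * (hostBlocks b L * t)) * pow2 p * l ≤ 32 * b * t * n
    bound t = begin
      suc (n / M) * (2 * (hostBlocks b L * t)) * pow2 p * l               ≤⟨ *-monoʳ-≤ (suc (n / M) * (2 * (hostBlocks b L * t)) * pow2 p) l≤ ⟩
      suc (n / M) * (2 * (hostBlocks b L * t)) * pow2 p * (8 * b * suc L) ≡⟨ lem (suc (n / M)) (hostBlocks b L) t (pow2 p) b (suc L) ⟩
      16 * b * t * (suc (n / M) * (suc L * hostBlocks b L * pow2 p))      ≡⟨ cong (λ x → 16 * b * t * (suc (n / M) * (x * pow2 p))) (sym (treeBlocks≡ b L)) ⟩
      16 * b * t * (M + n / M * M)                                        ≤⟨ *-monoʳ-≤ (16 * b * t) (+-mono-≤ M≤n (m/n*n≤m n M)) ⟩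
      16 * b * t * (n + n)                                                ≡⟨ lem′ b t n ⟩
      32 * b * t * n                                                      ∎
      where
      open ≤-Reasoning
      lem : ∀ g h t p b l → g * (2 * (h * t)) * p * (8 * b * l) ≡ 16 * b * t * (g * (l * h * p))
      lem = solve-∀
      lem′ : ∀ b t n → 16 * b * t * (n + n) ≡ 32 * b * t * n
      lem′ = solve-∀

-- Placing positions on the leaves of trees

module Placing (κ : ℕ) where

  open import Data.Nat using (zero; suc; _≤_; z≤n; _+_; _*_)
  open import Data.Nat.Properties
  open import Data.Integer using () renaming (+_ to pos; _-_ to _-ᶻ_)
  open import Data.Fin using (Fin; zero; suc; remQuot; splitAt; inject≤; combine)
  open import Data.Fin as Fin using ()
  import Data.Fin.Properties as Fin
  open import Data.Maybe.Properties using (just-injective)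
  open import Data.Vec using ([]; _∷_; _++_)
  open import Data.Vec.Properties using (++-injective; ∷-injective)
  open import Data.Product.Properties using (,-injective)
  open import Data.Sum.Properties using (inj₁-injective; inj₂-injective)
  open Learning
  open Sums
  open Numbers using (hostBlocks; treeBlocks; chooseTree)
  open import Data.Nat.Logarithm using (⌊log₂_⌋)
  open import Data.Nat.Tactic.RingSolver using (solve-∀)
  open Signed κ
  open Stages κ
  open Blocks κ

  record Inj (n : ℕ) (A : Set) : Set where
    constructor inj
    field
      to : Fin n → A
      injective : ∀ i j → to i ≡ to j → i ≡ j
  open Inj

  _×ᴵ_ : ∀ {a b A B} → Inj a A → Inj b B → Inj (a * b) (A × B)
  _×ᴵ_ {a} {b} (inj f p) (inj g r) = inj
    (λ i → f (proj₁ (remQuot {a} b i)) , g (proj₂ (remQuot {a} b i)))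
    λ i j e → trans (sym (Fin.combine-remQuot {a} b i))
      (trans (cong₂ combine (p _ _ (proj₁ (,-injective e))) (r _ _ (proj₂ (,-injective e)))) (Fin.combine-remQuot {a} b j))

  _⊎ᴵ_ : ∀ {a b A B} → Inj a A → Inj b B → Inj (a + b) (A ⊎ B)
  _⊎ᴵ_ {a} {b} {A} {B} (inj f p) (inj g r) = inj (h ∘ splitAt a)
    λ i j e → trans (sym (Fin.join-splitAt a b i)) (trans (cong (Fin.join a b) (h-inj _ _ e)) (Fin.join-splitAt a b j))
    where
    h : Fin a ⊎ Fin b → A ⊎ B
    h (inj₁ i) = inj₁ (f i)
    h (inj₂ i) = inj₂ (g i)
    h-inj : ∀ x y → h x ≡ h y → x ≡ y
    h-inj (inj₁ i) (inj₁ j) e = cong inj₁ (p i j (inj₁-injective e))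
    h-inj (inj₂ i) (inj₂ j) e = cong inj₂ (r i j (inj₂-injective e))

  mapᴵ : ∀ {n A B} (f : A → B) → (∀ x y → f x ≡ f y → x ≡ y) → Inj n A → Inj n B
  mapᴵ f p (inj g r) = inj (f ∘ g) (λ i j e → r i j (p _ _ e))

  unit : Inj 1 ⊤
  unit = inj _ λ { zero zero _ → refl }

  words : ∀ q → Inj (pow2 q) (Word q)
  words zero = mapᴵ (λ _ → []) (λ _ _ _ → refl) unit
  words (suc q) = mapᴵ f f-inj (words q ⊎ᴵ words q)
    where
    f : Word q ⊎ Word q → Word (suc q)
    f (inj₁ w) = false ∷ w
    f (inj₂ w) = true ∷ w
    f-inj : ∀ x y → f x ≡ f y → x ≡ y
    f-inj (inj₁ _) (inj₁ _) e = cong inj₁ (proj₂ (∷-injective e))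
    f-inj (inj₂ _) (inj₂ _) e = cong inj₂ (proj₂ (∷-injective e))
    f-inj (inj₁ _) (inj₂ _) ()
    f-inj (inj₂ _) (inj₁ _) ()

  eqW : ∀ {h} → Word h → Word h → ℕ
  eqW [] [] = 1
  eqW (false ∷ a) (false ∷ b) = eqW a b
  eqW (false ∷ a) (true ∷ b) = 0
  eqW (true ∷ a) (false ∷ b) = 0
  eqW (true ∷ a) (true ∷ b) = eqW a b

  eqW-refl : ∀ {h} (w : Word h) → eqW w w ≡ 1
  eqW-refl [] = refl
  eqW-refl (false ∷ w) = eqW-refl w
  eqW-refl (true ∷ w) = eqW-refl w

  eqW-sound : ∀ {h} (a b : Word h) → a ≡ b ⊎ eqW a b ≡ 0
  eqW-sound [] [] = inj₁ refl
  eqW-sound (false ∷ a) (true ∷ b) = inj₂ refl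
  eqW-sound (true ∷ a) (false ∷ b) = inj₂ refl
  eqW-sound (false ∷ a) (false ∷ b) with eqW-sound a b
  ... | inj₁ e = inj₁ (cong (false ∷_) e)
  ... | inj₂ z = inj₂ z
  eqW-sound (true ∷ a) (true ∷ b) with eqW-sound a b
  ... | inj₁ e = inj₁ (cong (true ∷_) e)
  ... | inj₂ z = inj₂ z

  sumW-cong : ∀ h {f g : Word h → ℕ} → (∀ w → f w ≡ g w) → sumW h f ≡ sumW h g
  sumW-cong zero e = e []
  sumW-cong (suc h) e = cong₂ _+_ (sumW-cong h (e ∘ (false ∷_))) (sumW-cong h (e ∘ (true ∷_)))

  sumW-eqW : ∀ h (w : Word h) (g : Word h → ℕ) → sumW h (λ w′ → eqW w w′ * g w′) ≡ g w
  sumW-eqW zero [] g = +-identityʳ _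
  sumW-eqW (suc h) (false ∷ w) g = trans (cong₂ _+_ (sumW-eqW h w _) (sumW-zero h)) (+-identityʳ _)
  sumW-eqW (suc h) (true ∷ w) g = cong₂ _+_ (sumW-zero h) (sumW-eqW h w _)

  sumW-sumF : ∀ h n (g : Word h → Fin n → ℕ) → sumW h (λ w → sumF n (g w)) ≡ sumF n (λ i → sumW h (λ w → g w i))
  sumW-sumF zero n g = refl
  sumW-sumF (suc h) n g = trans (cong₂ _+_ (sumW-sumF h n _) (sumW-sumF h n _)) (sym (sumF-+ n _ _))

  ind : ∀ {h} → Maybe (Word h) → Word h → ℕ
  ind nothing w = 0
  ind (just w′) w = eqW w′ w

  module Placement {h n : ℕ} (ℓ : Fin n → Maybe (Word h)) where

    placed : (Fin n → Fin κ → ℕ) → Hid h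
    placed f v w = sumF n (λ i → ind (ℓ i) w * f i v)

    asg : Asg h → Maybe (Word h) → Maybe (Fin κ)
    asg Q nothing = nothing
    asg Q (just w) = Q w

    val-placed : ∀ f (Q : Asg h) → val⁺ Q (placed f) ≡ sumF n (λ i → hit (asg Q (ℓ i)) (f i))
    val-placed f Q = trans (sumW-cong h (λ w → hit-sum (Q w) w))
      (trans (sumW-sumF h n _) (sumF-cong n (λ i → at-leaf (ℓ i) (f i))))
      where
      hit-sum : ∀ m w → hit m (λ v → placed f v w) ≡ sumF n (λ i → ind (ℓ i) w * hit m (f i))
      hit-sum nothing w = sym (trans (sumF-cong n (λ i → *-zeroʳ (ind (ℓ i) w))) (sumF-zero n))
      hit-sum (just v) w = refl
      at-leaf : ∀ l g → sumW h (λ w → ind l w * hit (Q w) g) ≡ hit (asg Q l) g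
      at-leaf nothing g = sumW-zero h
      at-leaf (just w) g = sumW-eqW h w (λ w → hit (Q w) g)

    module _ (ℓ-inj : ∀ i j w → ℓ i ≡ just w → ℓ j ≡ just w → i ≡ j) where

      ind-sound : ∀ (l : Maybe (Word h)) w → l ≡ just w ⊎ ind l w ≡ 0
      ind-sound nothing w = inj₂ refl
      ind-sound (just w′) w with eqW-sound w′ w
      ... | inj₁ e = inj₁ (cong just e)
      ... | inj₂ z = inj₂ z

      at-placed : ∀ f i v w → ℓ i ≡ just w → placed f v w ≡ f i v
      at-placed f i v w e = trans (sumF-single n _ i other)
        (trans (cong (λ l → ind l w * f i v) e) (trans (cong (_* f i v) (eqW-refl w)) (+-identityʳ _)))
        where
        other : ∀ j → ¬ j ≡ i → ind (ℓ j) w * f j v ≡ 0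
        other j ne with ind-sound (ℓ j) w
        ... | inj₁ e′ = ⊥-elim (ne (ℓ-inj j i w e′ e))
        ... | inj₂ z = cong (_* f j v) z

      leaf-placed : ∀ f B → (∀ i → sumF κ (f i) ≤ B) → LeafOk B (placed f)
      leaf-placed f B le w = begin
        sumF κ (λ v → sumF n (λ i → ind (ℓ i) w * f i v)) ≡⟨ sumF-swap κ n _ ⟩
        sumF n (λ i → sumF κ (λ v → ind (ℓ i) w * f i v)) ≡⟨ sumF-cong n (λ i → sumF-*ˡ κ (ind (ℓ i) w) (f i)) ⟩
        sumF n (λ i → ind (ℓ i) w * sumF κ (f i))         ≤⟨ sumF-mono n (λ i → *-monoʳ-≤ (ind (ℓ i) w) (le i)) ⟩
        sumF n (λ i → ind (ℓ i) w * B)                    ≡⟨ sumF-cong n (λ i → *-comm (ind (ℓ i) w) B) ⟩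
        sumF n (λ i → B * ind (ℓ i) w)                    ≡⟨ sumF-*ˡ n B _ ⟩
        B * sumF n (λ i → ind (ℓ i) w)                    ≤⟨ *-monoʳ-≤ B (sumF≤1 n _ (λ i → ind≤1 (ℓ i) w) unique) ⟩
        B * 1                                             ≡⟨ *-identityʳ B ⟩
        B                                                 ∎
        where
        open ≤-Reasoning
        eqW≤1 : ∀ {h} (a b : Word h) → eqW a b ≤ 1
        eqW≤1 a b with eqW-sound a b
        ... | inj₁ refl = ≤-reflexive (eqW-refl a)
        ... | inj₂ z = ≤-trans (≤-reflexive z) z≤n
        ind≤1 : ∀ (l : Maybe (Word h)) w → ind l w ≤ 1
        ind≤1 nothing w = z≤n
        ind≤1 (just w′) w = eqW≤1 w′ w
        unique : ∀ i j → 1 ≤ ind (ℓ i) w → 1 ≤ ind (ℓ j) w → i ≡ j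
        unique i j p r with ind-sound (ℓ i) w | ind-sound (ℓ j) w
        ... | inj₁ e | inj₁ e′ = ℓ-inj i j w e e′
        ... | inj₂ z | _ = ⊥-elim (<⇒≢ p (sym z))
        ... | inj₁ _ | inj₂ z = ⊥-elim (<⇒≢ r (sym z))

  -- The interface between trees and Mastermind. It is met by black pegs for positions and by the
  -- total number of pegs for groups of colours; a signed query takes two evaluations.
  record Evaluates (G : Game) (n d : ℕ) (S : Hidden G → Set) (f : Hidden G → Fin n → Fin κ → ℕ) : Set₁ where
    field eval : (Q : Fin n → Maybe (Fin κ)) → Learn G (λ x r → sumF n (λ i → hit (Q i) (f x i)) ≡ r) S d
  open Evaluates

  module _ {G : Game} {n d : ℕ} {S : Hidden G → Set} {f : Hidden G → Fin n → Fin κ → ℕ} (E : Evaluates G n d S f) where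

    evalSigned : ∀ {h} (ℓ : Fin n → Maybe (Word h)) (Q : SQ h) →
                 Learn G (λ x r → sval Q (Placement.placed ℓ (f x)) ≡ r) S (d + d)
    evalSigned ℓ (P ⊝ N) = bind (eval E (λ i → asg P (ℓ i))) λ r →
      mapL (λ r′ → pos r -ᶻ pos r′) (λ _ → proj₁)
        (λ x r′ (_ , e) e′ → cong₂ (λ a b → pos a -ᶻ pos b)
          (trans (val-placed (f x) P) e) (trans (val-placed (f x) N) e′))
        (eval E (λ i → asg N (ℓ i)))
      where open Placement ℓ

    module Groups (b p t B : ℕ) (τ : Learn (Bounded b p) Is (LeafOk B) t) (L g : ℕ) where

      open Multi b p t τ

      seqCost≡ : ∀ L → seqCost L ≡ hostBlocks b L * t
      seqCost≡ zero = sym (+-identityʳ t)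
      seqCost≡ (suc L) = trans (rep≡ q (seqCost L)) (trans (cong (pow2 q *_) (seqCost≡ L)) (sym (*-assoc (pow2 q) (hostBlocks b L) t)))

      idxs : ∀ L → Inj (hostBlocks b L) (Idx L)
      idxs zero = unit
      idxs (suc L) = words q ×ᴵ idxs L

      slots : ∀ L → Inj (treeBlocks b L) (Slot L)
      slots zero = unit
      slots (suc L) = (words q ×ᴵ slots L) ⊎ᴵ (words q ×ᴵ idxs L)

      ++-split : ∀ {m k} (a a′ : Word m) {w w′ : Word k} {b b′} → _≡_ {A = Word (suc (m + k))} (b ∷ (a ++ w)) (b′ ∷ (a′ ++ w′)) → a ≡ a′ × w ≡ w′
      ++-split a a′ e = ++-injective a a′ (proj₂ (∷-injective e))

      addrI-inj : ∀ L (ι ι′ : Idx L) w w′ → addrI {L} ι w ≡ addrI {L} ι′ w′ → ι ≡ ι′ × w ≡ w′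
      addrI-inj zero ι ι′ w w′ e = refl , e
      addrI-inj (suc L) (c , ι) (c′ , ι′) w w′ e with ++-split c c′ e
      ... | refl , e′ with addrI-inj L ι ι′ w w′ e′
      ... | refl , e″ = refl , e″

      addrS-inj : ∀ L (σ σ′ : Slot L) w w′ → addrS {L} σ w ≡ addrS {L} σ′ w′ → σ ≡ σ′ × w ≡ w′
      addrS-inj zero σ σ′ w w′ e = refl , e
      addrS-inj (suc L) (inj₁ (c , σ)) (inj₁ (c′ , σ′)) w w′ e with ++-split c c′ e
      ... | refl , e′ with addrS-inj L σ σ′ w w′ e′
      ... | refl , e″ = refl , e″
      addrS-inj (suc L) (inj₂ (c , ι)) (inj₂ (c′ , ι′)) w w′ e with ++-split c c′ e
      ... | refl , e′ with addrI-inj L ι ι′ w w′ e′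
      ... | refl , e″ = refl , e″
      addrS-inj (suc L) (inj₁ _) (inj₂ _) w w′ ()
      addrS-inj (suc L) (inj₂ _) (inj₁ _) w w′ ()

      learnGroups : n ≤ g * (treeBlocks b L * pow2 p) → (∀ x → S x → ∀ i → sumF κ (f x i) ≤ B) →
                    Learn G (λ x (F : Fin n → Fin κ → ℕ) → ∀ i v → f x i v ≡ F i v) S (g * (dbl (seqCost L) * (d + d)))
      learnGroups n≤ f≤ = mapL (λ X i v → X (grp i) (slot i) v (off i)) (λ _ s → s)
          (λ x X s r i v → trans (sym (at-placed (ℓ (grp i)) (ℓ-inj (grp i)) (f x) i v _ (ℓ-grp i)))
            (trans (sym (subS-addr L (slot i) _ v (off i))) (r (grp i) (slot i) v (off i))))
          (learnFin g λ γ → weaken (λ x s → (λ σ w → ≤-trans (≤-reflexive (sumF-cong κ (λ v → subS-addr L σ _ v w)))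
                (leaf-placed (ℓ γ) (ℓ-inj γ) (f x) B (f≤ x s) (addrS σ w))) , s)
            (simulate (λ x → placed (ℓ γ) (f x)) (evalSigned (ℓ γ)) (parallel L)))
        where
        open Placement
        pos-of : Fin n → Fin g × Fin (treeBlocks b L) × Fin (pow2 p)
        pos-of i = proj₁ γr , remQuot {treeBlocks b L} (pow2 p) (proj₂ γr)
          where γr = remQuot {g} (treeBlocks b L * pow2 p) (inject≤ i n≤)
        grp = proj₁ ∘ pos-of
        slot = λ i → to (slots L) (proj₁ (proj₂ (pos-of i)))
        off = λ i → to (words p) (proj₂ (proj₂ (pos-of i)))
        pos-inj : ∀ i j → pos-of i ≡ pos-of j → i ≡ j
        pos-inj i j e = Fin.inject≤-injective n≤ n≤ i j
          (trans (sym (Fin.combine-remQuot {g} (treeBlocks b L * pow2 p) _))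
            (trans (cong₂ combine (cong proj₁ e)
              (trans (sym (Fin.combine-remQuot {treeBlocks b L} (pow2 p) _))
                (trans (cong (uncurry combine) (cong proj₂ e)) (Fin.combine-remQuot {treeBlocks b L} (pow2 p) _))))
              (Fin.combine-remQuot {g} (treeBlocks b L * pow2 p) _)))
        here? : ∀ {γ γ′ : Fin g} → Dec (γ ≡ γ′) → Word (hh L) → Maybe (Word (hh L))
        here? (yes _) w = just w
        here? (no _) w = nothing
        ℓ : Fin g → Fin n → Maybe (Word (hh L))
        ℓ γ i = here? (grp i Fin.≟ γ) (addrS (slot i) (off i))
        ℓ-grp : ∀ i → ℓ (grp i) i ≡ just (addrS (slot i) (off i))
        ℓ-grp i with grp i Fin.≟ grp i
        ... | yes _ = refl
        ... | no ne = ⊥-elim (ne refl)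
        ℓ-just : ∀ γ i w → ℓ γ i ≡ just w → grp i ≡ γ × addrS {L} (slot i) (off i) ≡ w
        ℓ-just γ i w e with grp i Fin.≟ γ
        ... | yes p = p , just-injective e
        ℓ-inj : ∀ γ i j w → ℓ γ i ≡ just w → ℓ γ j ≡ just w → i ≡ j
        ℓ-inj γ i j w e e′ with ℓ-just γ i w e | ℓ-just γ j w e′
        ... | eg , ea | eg′ , ea′ with addrS-inj L (slot i) (slot j) (off i) (off j) (trans ea (sym ea′))
        ... | es , eo = pos-inj i j (cong₂ _,_ (trans eg (sym eg′))
          (cong₂ _,_ (injective (slots L) _ _ es) (injective (words p) _ _ eo)))

    learnItems : ∀ b p t B → Learn (Bounded b p) Is (LeafOk B) t → 1 ≤ b → p ≤ b → pow2 p ≤ n →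
                 (∀ x → S x → ∀ i → sumF κ (f x i) ≤ B) →
                 Σ ℕ λ T → T * pow2 p * ⌊log₂ n ⌋ ≤ 32 * b * t * n * (d + d) ×
                           Learn G (λ x (F : Fin n → Fin κ → ℕ) → ∀ i v → f x i v ≡ F i v) S T
    learnItems b p t B τ 1≤b p≤b p≤n f≤ = from (chooseTree b p n 1≤b p≤b p≤n)
      where
      from : (Σ ℕ λ L → Σ ℕ λ g → n ≤ g * (treeBlocks b L * pow2 p) ×
               (∀ t → g * (2 * (hostBlocks b L * t)) * pow2 p * ⌊log₂ n ⌋ ≤ 32 * b * t * n)) →
             Σ ℕ λ T → T * pow2 p * ⌊log₂ n ⌋ ≤ 32 * b * t * n * (d + d) ×
                       Learn G (λ x (F : Fin n → Fin κ → ℕ) → ∀ i v → f x i v ≡ F i v) S T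
      from (L , g , n≤ , bound) = g * (dbl (seqCost L) * (d + d)) , cost≤ , learnGroups n≤ f≤
        where
        open Groups b p t B τ L g
        open Multi b p t τ using (seqCost)
        lem : ∀ g x d p l → g * (x * d) * p * l ≡ g * x * p * l * d
        lem = solve-∀
        cost≤ : g * (dbl (seqCost L) * (d + d)) * pow2 p * ⌊log₂ n ⌋ ≤ 32 * b * t * n * (d + d)
        cost≤ = ≤-trans (≤-reflexive (trans (lem g (dbl (seqCost L)) (d + d) (pow2 p) ⌊log₂ n ⌋)
            (cong (λ x → g * x * pow2 p * ⌊log₂ n ⌋ * (d + d)) (trans (dbl≡ (seqCost L)) (cong (2 *_) (seqCost≡ L))))))
          (*-monoˡ-≤ (d + d) (bound t))

-- Peg counts as sums; maximal matchings

module Matching where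

  open import Defs
  open import Data.Nat as ℕ using (ℕ; zero; suc; _≤_; z≤n; _+_; _∸_)
  open import Data.Nat.Properties hiding (_≟_)
  open import Data.Fin using (Fin; zero; suc; punchIn)
  open import Data.Fin.Properties using (_≟_; any?)
  open import Data.Fin.Permutation using (Permutation′; _⟨$⟩ʳ_; _≈_; insert; remove; insert-punchIn; insert-remove; transpose; _∘ₚ_)
  import Data.Fin.Permutation as Perm
  open import Data.Vec using (lookup; tabulate; allFin; count)
  open import Data.Vec.Properties using (count≤n)
  import Relation.Nullary.Decidable as Dec
  open import Algebra.Properties.CommutativeMonoid.Sum +-0-commutativeMonoid using (sum; sum-permute)
  open Sums

  ⟦_⟧ : ∀ {P : Set} → Dec P → ℕ
  ⟦ yes _ ⟧ = 1
  ⟦ no _ ⟧ = 0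

  ⟦⟧-yes : ∀ {P : Set} (d : Dec P) → P → ⟦ d ⟧ ≡ 1
  ⟦⟧-yes (yes _) p = refl
  ⟦⟧-yes (no ¬p) p = ⊥-elim (¬p p)

  ⟦⟧-no : ∀ {P : Set} (d : Dec P) → ¬ P → ⟦ d ⟧ ≡ 0
  ⟦⟧-no (yes p) ¬p = ⊥-elim (¬p p)
  ⟦⟧-no (no _) ¬p = refl

  ⟦⟧≤1 : ∀ {P : Set} (d : Dec P) → ⟦ d ⟧ ≤ 1
  ⟦⟧≤1 (yes _) = ≤-refl
  ⟦⟧≤1 (no _) = z≤n

  count-tabulate : ∀ {A : Set} {P : A → Set} (P? : ∀ a → Dec (P a)) n (f : Fin n → A) →
                   count P? (tabulate f) ≡ sumF n (λ i → ⟦ P? (f i) ⟧)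
  count-tabulate P? zero f = refl
  count-tabulate P? (suc n) f with P? (f zero)
  ... | yes _ = cong suc (count-tabulate P? n (f ∘ suc))
  ... | no _ = count-tabulate P? n (f ∘ suc)

  sumF≡sum : ∀ n (f : Fin n → ℕ) → sumF n f ≡ sum f
  sumF≡sum zero f = refl
  sumF≡sum (suc n) f = cong (f zero +_) (sumF≡sum n (f ∘ suc))

  sumF-permute : ∀ n (f : Fin n → ℕ) (π : Permutation′ n) → sumF n (λ i → f (π ⟨$⟩ʳ i)) ≡ sumF n f
  sumF-permute n f π = trans (sumF≡sum n _) (trans (sym (sum-permute f π)) (sym (sumF≡sum n f)))

  module _ {n k : ℕ} (x q : Code n k) where

    bp-sum : bp x q ≡ sumF n (λ i → ⟦ lookup x i ≟ lookup q i ⟧)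
    bp-sum = count-tabulate (λ i → lookup x i ≟ lookup q i) n id

    matches-sum : ∀ σ → matches x q σ ≡ sumF n (λ i → ⟦ lookup x i ≟ lookup q (σ ⟨$⟩ʳ i) ⟧)
    matches-sum σ = count-tabulate (λ i → lookup x i ≟ lookup q (σ ⟨$⟩ʳ i)) n id

    matches-≈ : ∀ σ τ → σ ≈ τ → matches x q σ ≡ matches x q τ
    matches-≈ σ τ e = trans (matches-sum σ) (trans
      (sumF-cong n (λ i → cong (λ j → ⟦ lookup x i ≟ lookup q j ⟧) (e i))) (sym (matches-sum τ)))

    matches≤n : ∀ σ → matches x q σ ≤ n
    matches≤n σ = count≤n (λ i → lookup x i ≟ lookup q (σ ⟨$⟩ʳ i)) (allFin n)

  insert-≈ : ∀ {n} j (σ τ : Permutation′ n) → σ ≈ τ → insert zero j σ ≈ insert zero j τ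
  insert-≈ j σ τ e zero = refl
  insert-≈ j σ τ e (suc i) = trans (insert-punchIn zero j σ i)
    (trans (cong (punchIn j) (e i)) (sym (insert-punchIn zero j τ i)))

  -- A permutation is the image of zero together with a permutation of the rest. Reassembling it
  -- gives only pointwise equality, so the predicate has to respect `_≈_`.
  anyPermutation? : ∀ n {P : Permutation′ n → Set} → (∀ σ → Dec (P σ)) → (∀ σ τ → σ ≈ τ → P σ → P τ) →
                    Dec (Σ (Permutation′ n) P)
  anyPermutation? zero P? resp = Dec.map′ (Perm.id ,_) (λ (σ , p) → resp σ Perm.id (λ ()) p) (P? Perm.id)
  anyPermutation? (suc n) P? resp = Dec.map′
    (λ (j , σ , p) → insert zero j σ , p)
    (λ (σ , p) → σ ⟨$⟩ʳ zero , remove zero σ , resp σ _ (λ i → sym (insert-remove zero σ i)) p)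
    (any? λ j → anyPermutation? n (λ σ → P? (insert zero j σ)) (λ σ τ e → resp _ _ (insert-≈ j σ τ e)))

  maxMatch : ∀ {n k} (x q : Code n k) → Σ ℕ (IsMaxMatch x q)
  maxMatch {n} x q = from n (matches≤n x q)
    where
    from : ∀ m → (∀ σ → matches x q σ ≤ m) → Σ ℕ (IsMaxMatch x q)
    from zero le = 0 , (Perm.id , n≤0⇒n≡0 (le Perm.id)) , le
    from (suc m) le with anyPermutation? n (λ σ → matches x q σ ℕ.≟ suc m)
                           (λ σ τ e p → trans (sym (matches-≈ x q σ τ e)) p)
    ... | yes (σ , e) = suc m , (σ , e) , le
    ... | no ne = from m λ σ → ≤-pred (≤∧≢⇒< (le σ) (λ e → ne (σ , e)))

  mm : ∀ {n k} → Code n k → Code n k → ℕ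
  mm x q = proj₁ (maxMatch x q)

  maxMatch-unique : ∀ {n k} (x q : Code n k) {m m′} → IsMaxMatch x q m → IsMaxMatch x q m′ → m ≡ m′
  maxMatch-unique x q ((σ , e) , le) ((σ′ , e′) , le′) =
    ≤-antisym (subst (_≤ _) e (le′ σ)) (subst (_≤ _) e′ (le σ′))

  bp≤mm : ∀ {n k} (x q : Code n k) → bp x q ≤ mm x q
  bp≤mm x q = proj₂ (proj₂ (maxMatch x q)) Perm.id

  mm≤n : ∀ {n k} (x q : Code n k) → mm x q ≤ n
  mm≤n x q with maxMatch x q
  ... | m , (σ , e) , _ = subst (_≤ _) e (matches≤n x q σ)

  -- Truncated subtraction loses nothing because bp ≤ mm, so the total number of pegs is recovered
  -- by addition.
  answers : ∀ {n k} (x q : Code n k) b w → Answer x q b w → (bp x q ≡ b) × (mm x q ≡ w + b)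
  answers x q b w (e , m , max , w≡) = e , trans m≡ (sym (trans (cong (_+ b) w≡)
      (m∸n+n≡m (subst₂ _≤_ e m≡ (bp≤mm x q)))))
    where
    m≡ = maxMatch-unique x q (proj₂ (maxMatch x q)) max

  answer : ∀ {n k} (x q : Code n k) → Answer x q (bp x q) (mm x q ∸ bp x q)
  answer x q = refl , mm x q , proj₂ (maxMatch x q) , refl

  present? : ∀ {n k} (x : Code n k) c → Dec (Σ (Fin n) λ i → lookup x i ≡ c)
  present? x c = any? (λ i → lookup x i ≟ c)

  present : ∀ {n k} → Code n k → Fin k → ℕ
  present x c = ⟦ present? x c ⟧

  -- A maximal matching that misses a present colour could be improved by one transposition.
  mm-present : ∀ {n k} (x q : Code n k) →
               (∀ i j → lookup q i ≡ lookup q j → i ≡ j ⊎ present x (lookup q i) ≡ 0) →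
               mm x q ≡ sumF n (λ i → present x (lookup q i))
  mm-present {n} {k} x q distinct with maxMatch x q
  ... | m , (σ , refl) , max = ≤-antisym
    (≤-trans (≤-reflexive (matches-sum x q σ))
      (≤-trans (sumF-mono n upper) (≤-reflexive (sumF-permute n (λ i → present x (lookup q i)) σ))))
    (≤-trans (≤-reflexive (sym (sumF-permute n (λ i → present x (lookup q i)) σ)))
      (≤-trans (sumF-mono n lower) (≤-reflexive (sym (matches-sum x q σ)))))
    where
    g : Permutation′ n → Fin n → ℕ
    g τ i = ⟦ lookup x i ≟ lookup q (τ ⟨$⟩ʳ i) ⟧
    upper : ∀ i → g σ i ≤ present x (lookup q (σ ⟨$⟩ʳ i))
    upper i with lookup x i ≟ lookup q (σ ⟨$⟩ʳ i)
    ... | yes e = ≤-reflexive (sym (⟦⟧-yes (present? x _) (i , e)))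
    ... | no _ = z≤n
    improve : ∀ i i′ → ¬ lookup x i ≡ lookup q (σ ⟨$⟩ʳ i) → lookup x i′ ≡ lookup q (σ ⟨$⟩ʳ i) → suc (matches x q σ) ≤ matches x q (transpose i i′ ∘ₚ σ)
    improve i i′ ne e = begin
      suc (matches x q σ)                               ≡⟨ +-comm 1 _ ⟩
      matches x q σ + 1                                 ≡⟨ cong₂ _+_ (matches-sum x q σ) (sym one) ⟩
      sumF n (g σ) + sumF n (λ j → ⟦ j ≟ i′ ⟧)          ≡⟨ sym (sumF-+ n (g σ) _) ⟩
      sumF n (λ j → g σ j + ⟦ j ≟ i′ ⟧)                 ≤⟨ sumF-mono n step ⟩
      sumF n (g τ)                                      ≡⟨ sym (matches-sum x q τ) ⟩
      matches x q τ                                     ∎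
      where
      open ≤-Reasoning
      τ = transpose i i′ ∘ₚ σ
      one : sumF n (λ j → ⟦ j ≟ i′ ⟧) ≡ 1
      one = trans (sumF-single n _ i′ (λ j ne → ⟦⟧-no (j ≟ i′) ne)) (⟦⟧-yes (i′ ≟ i′) refl)
      -- If i′ were matched as well, σ would send i and i′ to equal colours that occur in x, hence
      -- to the same place; then i = i′, but only i′ carries this colour.
      unmatched : ¬ lookup x i′ ≡ lookup q (σ ⟨$⟩ʳ i′)
      unmatched e′ with distinct (σ ⟨$⟩ʳ i) (σ ⟨$⟩ʳ i′) (trans (sym e) e′)
      ... | inj₂ z with () ← trans (sym z) (⟦⟧-yes (present? x _) (i′ , e))
      ... | inj₁ eq = ne (trans (cong (lookup x) (trans (sym (Perm.inverseˡ σ))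
        (trans (cong (Perm._⟨$⟩ˡ_ σ) eq) (Perm.inverseˡ σ)))) e)
      step : ∀ j → g σ j + ⟦ j ≟ i′ ⟧ ≤ g τ j
      step j with j ≟ i
      step j | yes refl = ≤-trans (≤-reflexive (cong₂ _+_ (⟦⟧-no (lookup x i ≟ _) ne)
        (⟦⟧-no (i ≟ i′) λ { refl → ne e }))) z≤n
      step j | no j≢i with j ≟ i′
      ... | yes refl = ≤-trans (≤-reflexive (cong (_+ 1) (⟦⟧-no (lookup x i′ ≟ _) unmatched)))
                               (≤-reflexive (sym (⟦⟧-yes (lookup x i′ ≟ _) e)))
      ... | no _ = ≤-reflexive (+-identityʳ _)
    lower : ∀ i → present x (lookup q (σ ⟨$⟩ʳ i)) ≤ g σ i
    lower i with lookup x i ≟ lookup q (σ ⟨$⟩ʳ i)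
    ... | yes _ = ⟦⟧≤1 (present? x _)
    ... | no ne with present? x (lookup q (σ ⟨$⟩ʳ i))
    ... | no _ = z≤n
    ... | yes (i′ , e) = ⊥-elim (<⇒≱ (improve i i′ ne e) (max (transpose i i′ ∘ₚ σ)))

-- From decision trees to strategies; existence of the minimum

module Strategies where

  open import Defs
  open import Data.Nat as ℕ using (ℕ; zero; suc; _<_; _≤_; s≤s; z≤n; _+_; _*_; _∸_; _^_; _<?_)
  open import Data.Nat.Properties hiding (_≟_)
  open import Data.Fin using (Fin; zero; suc; toℕ; fromℕ<; combine; finToFun; funToFin)
  open import Data.Fin.Properties using (_≟_; any?; all?)
  import Data.Fin.Properties as Fin
  import Data.Fin.Permutation as Perm
  open import Data.Vec using (Vec; []; _∷_; lookup; tabulate; replicate; toList)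
  open import Data.Vec.Properties using (lookup∘tabulate; lookup-replicate; length-toList; ≡-dec)
  open import Data.List as List using (List; []; _∷_; _++_; length)
  open import Data.List.Properties using (length-++)
  open import Data.List.Membership.Propositional using (_∈_; _∉_)
  open import Data.List.Membership.Propositional.Properties using (∈-++⁺ˡ; ∈-++⁺ʳ)
  open import Data.List.Relation.Unary.Any using (index; here; there)
  open import Data.List.Relation.Unary.Any.Properties using (lookup-index)
  open import Relation.Nullary.Decidable using (map′; _×-dec_; _→-dec_; ¬?; decidable-stable)
  open Sums
  open Learning
  open Matching

  CodeGame : ℕ → ℕ → Game
  CodeGame n k = record { Hidden = Code n k ; Query = Code n k ; Reply = ℕ × ℕ
                        ; val = λ x q → bp x q , mm x q ; Ok = λ _ _ → ⊤ }

  Wins-mono : ∀ {n k} T (s : Strategy n k) {S S′ : Code n k → Set} → (∀ x → S′ x → S x) → Wins T S s → Wins T S′ s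
  Wins-mono T stop i w x y sx sy = w x y (i x sx) (i y sy)
  Wins-mono (suc T) (ask q f) i w b a = Wins-mono T (f b a) (λ x (sx , e) → i x sx , e) (w b a)

  strategy : ∀ {n k t} {S : Code n k → Set} → Learn (CodeGame n k) (λ x y → x ≡ y) S t →
             Σ (Strategy n k) λ s → Wins t S s
  strategy (done y p) = stop , λ x x′ sx sx′ → trans (p x sx) (sym (p x′ sx′))
  strategy (ask q _ l) = ask q (λ b w → proj₁ (strategy (l (b , w + b)))) ,
    λ b w → Wins-mono _ (proj₁ (strategy (l (b , w + b))))
      (λ x (sx , a) → sx , cong₂ _,_ (proj₁ (answers x q b w a)) (proj₂ (answers x q b w a)))
      (proj₂ (strategy (l (b , w + b))))

  anyCode? : ∀ n {k} {P : Code n k → Set} → (∀ x → Dec (P x)) → Dec (Σ (Code n k) P)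
  anyCode? zero P? = map′ ([] ,_) (λ { ([] , p) → p }) (P? [])
  anyCode? (suc n) P? = map′ (λ (c , x , p) → c ∷ x , p) (λ { (c ∷ x , p) → c , x , p })
    (any? λ c → anyCode? n (λ x → P? (c ∷ x)))

  allCode? : ∀ n {k} {P : Code n k → Set} → (∀ x → Dec (P x)) → Dec (∀ x → P x)
  allCode? n P? with anyCode? n (λ x → ¬? (P? x))
  ... | yes (x , ¬p) = no (λ all → ¬p (all x))
  ... | no none = yes (λ x → decidable-stable (P? x) (λ ¬p → none (x , ¬p)))

  code-≟ : ∀ {n k} (x y : Code n k) → Dec (x ≡ y)
  code-≟ = ≡-dec _≟_

  answer? : ∀ {n k} (x q : Code n k) b w → Dec (Answer x q b w)
  answer? x q b w = map′ (λ { (refl , refl) → answer x q })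
    (λ { (e , m , max , e′) → e , trans e′ (cong (_∸ b) (maxMatch-unique x q max (proj₂ (maxMatch x q)))) ■ e })
    ((bp x q ℕ.≟ b) ×-dec (w ℕ.≟ mm x q ∸ bp x q))
    where
    _■_ : w ≡ mm x q ∸ b → bp x q ≡ b → w ≡ mm x q ∸ bp x q
    p ■ refl = p

  answer-bounds : ∀ {n k} (x q : Code n k) b w → Answer x q b w → b < suc n × w < suc n
  answer-bounds x q b w a with refl , e ← answers x q b w a =
    s≤s (≤-trans (bp≤mm x q) (mm≤n x q)) ,
    s≤s (≤-trans (m≤m+n w (bp x q)) (≤-trans (≤-reflexive (sym e)) (mm≤n x q)))

  -- A least T exists because solvability is decidable: both numbers of an answer are at most n, and
  -- on all other branches nothing is consistent, so `stop` wins.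
  solvable? : ∀ {n k} T {S : Code n k → Set} → (∀ x → Dec (S x)) → Dec (Σ (Strategy n k) (Wins T S))
  solvable? {n} {k} T {S} S? with allCode? n (λ x → allCode? n (λ y → S? x →-dec (S? y →-dec code-≟ x y)))
  ... | yes u = yes (stop , u)
  solvable? {n} {k} zero {S} S? | no ¬u = no λ { (stop , w) → ¬u w ; (ask q f , ()) }
  solvable? {n} {k} (suc T) {S} S? | no ¬u = map′ to from
    (anyCode? n λ q → all? λ i → all? λ j → solvable? T (λ x → S? x ×-dec answer? x q (toℕ {suc n} i) (toℕ {suc n} j)))
    where
    Next : Code n k → ℕ → ℕ → Set
    Next q b w = Σ (Strategy n k) (Wins T (λ x → S x × Answer x q b w))
    all-answers : ∀ q → (∀ (i j : Fin (suc n)) → Next q (toℕ i) (toℕ j)) → ∀ b w → Next q b w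
    all-answers q h b w with b <? suc n | w <? suc n
    ... | yes b< | yes w< = subst₂ (Next q) (Fin.toℕ-fromℕ< b<) (Fin.toℕ-fromℕ< w<) (h (fromℕ< b<) (fromℕ< w<))
    ... | no b≮ | _ = stop , λ x _ (_ , a) _ → ⊥-elim (b≮ (proj₁ (answer-bounds x q b w a)))
    ... | yes _ | no w≮ = stop , λ x _ (_ , a) _ → ⊥-elim (w≮ (proj₂ (answer-bounds x q b w a)))
    to : (Σ (Code n k) λ q → ∀ (i j : Fin (suc n)) → Next q (toℕ i) (toℕ j)) → Σ (Strategy n k) (Wins (suc T) S)
    to (q , h) = ask q (λ b w → proj₁ (all-answers q h b w)) , λ b w → proj₂ (all-answers q h b w)
    from : Σ (Strategy n k) (Wins (suc T) S) → Σ (Code n k) λ q → ∀ (i j : Fin (suc n)) → Next q (toℕ i) (toℕ j)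
    from (stop , w) = ⊥-elim (¬u w)
    from (ask q f , w) = q , λ i j → f (toℕ i) (toℕ j) , w (toℕ i) (toℕ j)

  least : {P : ℕ → Set} → (∀ n → Dec (P n)) → ∀ m → P m → Σ ℕ λ T → T ≤ m × P T × (∀ T′ → P T′ → T ≤ T′)
  least P? zero p = 0 , z≤n , p , λ _ _ → z≤n
  least {P} P? (suc m) p with P? 0
  ... | yes p₀ = 0 , z≤n , p₀ , λ _ _ → z≤n
  ... | no ¬p₀ with least (P? ∘ suc) m p
  ... | T , T≤ , pT , min = suc T , s≤s T≤ , pT , λ { zero p′ → ⊥-elim (¬p₀ p′) ; (suc T′) p′ → s≤s (min T′ p′) }

  minQueries : ∀ {n k t} → SolvableIn n k t → Σ ℕ λ T → T ≤ t × IsMinQueries n k T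
  minQueries {t = t} s with least (λ T → solvable? T (λ _ → yes tt)) t s
  ... | T , T≤ , p , min = T , T≤ , p , min

  -- Lower bounds: counting answers, and colours never asked

  outcome : ∀ {n k} (x q : Code n k) → Fin (suc n * suc n)
  outcome x q = combine (fromℕ< (proj₁ b)) (fromℕ< (proj₂ b))
    where b = answer-bounds x q _ _ (answer x q)

  outcome-injective : ∀ {n k} (x y q : Code n k) → outcome x q ≡ outcome y q →
                      bp x q ≡ bp y q × mm x q ∸ bp x q ≡ mm y q ∸ bp y q
  outcome-injective x y q e with Fin.combine-injective _ _ _ _ e
  ... | e₁ , e₂ = Fin.fromℕ<-injective _ _ _ _ e₁ , Fin.fromℕ<-injective _ _ _ _ e₂

  -- A branch that stops early is padded with zeros; injectivity survives because at `stop` at most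
  -- one codeword is left.
  path : ∀ {n k} T → Strategy n k → Code n k → Fin ((suc n * suc n) ^ T)
  path zero s x = zero
  path {n} (suc T) stop x = combine {suc n * suc n} zero (path T stop x)
  path (suc T) (ask q f) x = combine (outcome x q) (path T (f (bp x q) (mm x q ∸ bp x q)) x)

  path-injective : ∀ {n k} T (s : Strategy n k) {S} → Wins T S s → ∀ x y → S x → S y → path T s x ≡ path T s y → x ≡ y
  path-injective T stop w x y sx sy e = w x y sx sy
  path-injective (suc T) (ask q f) w x y sx sy e with Fin.combine-injective (outcome x q) _ (outcome y q) _ e
  ... | e₁ , e₂ with outcome-injective x y q e₁
  ... | e₃ , e₄ = path-injective T (f (bp x q) (mm x q ∸ bp x q)) (w _ _) x y
    (sx , answer x q) (sy , subst₂ (Answer y q) (sym e₃) (sym e₄) (answer y q))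
    (trans e₂ (cong₂ (λ b a → path T (f b a) y) (sym e₃) (sym e₄)))

  information : ∀ {n k T} → SolvableIn n k T → k ^ n ≤ (suc n * suc n) ^ T
  information {n} {k} {T} (s , w) = Fin.injective⇒≤ {f = λ i → path T s (tabulate (finToFun i))} λ {i} {j} e →
    finToFun-injective i j (λ l → trans (sym (lookup∘tabulate (finToFun i) l))
      (trans (cong (λ x → lookup x l) (path-injective T s w _ _ tt tt e)) (lookup∘tabulate (finToFun j) l)))
    where
    funToFin-cong : ∀ {m n} {f g : Fin m → Fin n} → (∀ i → f i ≡ g i) → funToFin f ≡ funToFin g
    funToFin-cong {zero} e = refl
    funToFin-cong {suc m} e = cong₂ combine (e zero) (funToFin-cong (e ∘ suc))
    finToFun-injective : ∀ (i j : Fin (k ^ n)) → (∀ l → finToFun i l ≡ finToFun j l) → i ≡ j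
    finToFun-injective i j e = trans (sym (Fin.funToFin-finToFin {n} {k} i)) (trans (funToFin-cong e) (Fin.funToFin-finToFin {n} {k} j))

  asked : ∀ {n k} → ℕ → Strategy n k → List (Fin k)
  asked T stop = []
  asked zero (ask q f) = []
  asked (suc T) (ask q f) = toList q ++ asked T (f 0 0)

  length-asked : ∀ {n k} T (s : Strategy n k) → length (asked T s) ≤ T * n
  length-asked T stop = z≤n
  length-asked zero (ask q f) = z≤n
  length-asked {n} (suc T) (ask q f) = ≤-trans (≤-reflexive (trans (length-++ (toList q)) (cong (_+ _) (length-toList q))))
    (+-monoʳ-≤ n (length-asked T (f 0 0)))

  lookup∈ : ∀ {A : Set} {n} (v : Vec A n) i → lookup v i ∈ toList v
  lookup∈ (a ∷ v) zero = here refl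
  lookup∈ (a ∷ v) (suc i) = there (lookup∈ v i)

  answer-zero : ∀ {n k} c (q : Code n k) → c ∉ toList q → Answer (replicate n c) q 0 0
  answer-zero {n} {k} c q c∉ = trans (bp-sum (replicate n c) q) (none (λ i → i)) , 0 ,
    ((Perm.id , trans (matches-sum (replicate n c) q Perm.id) (none _)) ,
     (λ σ → ≤-reflexive (trans (matches-sum (replicate n c) q σ) (none _)))) , refl
    where
    none : (g : Fin n → Fin n) → sumF n (λ i → ⟦ lookup (replicate n c) i ≟ lookup q (g i) ⟧) ≡ 0
    none g = trans (sumF-cong n (λ i → ⟦⟧-no (lookup (replicate n c) i ≟ lookup q (g i))
      (λ e → c∉ (subst (_∈ toList q) (trans (sym e) (lookup-replicate i c)) (lookup∈ q (g i)))))) (sumF-zero n)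

  unasked : ∀ {n k} T (s : Strategy n k) {S} → Wins T S s → ∀ c d → c ∉ asked T s → d ∉ asked T s →
            S (replicate n c) → S (replicate n d) → replicate n c ≡ replicate n d
  unasked T stop w c d c∉ d∉ sc sd = w _ _ sc sd
  unasked (suc T) (ask q f) w c d c∉ d∉ sc sd = unasked T (f 0 0) (w 0 0) c d
    (c∉ ∘ ∈-++⁺ʳ (toList q)) (d∉ ∘ ∈-++⁺ʳ (toList q))
    (sc , answer-zero c q (c∉ ∘ ∈-++⁺ˡ)) (sd , answer-zero d q (d∉ ∘ ∈-++⁺ˡ))

  fresh : ∀ {k} (l : List (Fin k)) → length l < k → Σ (Fin k) (_∉ l)
  fresh {k} l lt with any? (λ c → ¬? (c ∈? l))
    where open import Data.List.Membership.DecPropositional (_≟_ {k}) using (_∈?_)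
  ... | yes p = p
  ... | no none = ⊥-elim (<⇒≱ lt (Fin.injective⇒≤ {f = λ c → index (mem c)} λ {c} {d} e →
      trans (lookup-index (mem c)) (trans (cong (List.lookup l) e) (sym (lookup-index (mem d))))))
    where
    open import Data.List.Membership.DecPropositional (_≟_ {k}) using (_∈?_)
    mem : ∀ c → c ∈ l
    mem c = decidable-stable (c ∈? l) (λ c∉ → none (c , c∉))

  colours : ∀ {n k T} → 0 < n → SolvableIn n k T → k ≤ suc (T * n)
  colours {suc n} {k} {T} _ (s , w) with k ℕ.≤? suc (T * suc n)
  ... | yes le = le
  ... | no gt with fresh (asked T s) (≤-<-trans (length-asked T s) (≤-trans (n≤1+n _) (≰⇒> gt)))
  ... | c , c∉ with fresh (c ∷ asked T s) (≤-<-trans (s≤s (length-asked T s)) (≰⇒> gt))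
  ... | d , d∉ with unasked T s w c d c∉ (d∉ ∘ there) tt tt
  ... | e = ⊥-elim (d∉ (here (sym (cong (λ x → lookup x zero) e))))

-- Few colours: blanks and positions

module Positions where

  open import Defs using (Code; bp)
  open import Data.Nat as ℕ using (ℕ; zero; suc; _≤_; s≤s; z≤n; _+_; _*_; _∸_; NonZero; >-nonZero)
  open import Data.Nat.Properties hiding (_≟_)
  open import Data.Nat.Logarithm using (⌊log₂_⌋)
  open import Data.Nat.Tactic.RingSolver using (solve-∀)
  open import Data.Integer using (∣_∣) renaming (+_ to pos)
  open import Data.Fin using (Fin; zero; suc)
  open import Data.Fin.Properties using (_≟_; any?)
  open import Data.Vec using ([]; lookup; tabulate)
  open import Data.Vec.Properties using (lookup∘tabulate; tabulate∘lookup; tabulate-cong)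
  open Sums
  open Numbers
  open Learning
  open Matching
  open Strategies

  bp-tabulate : ∀ {n k} (x : Code n k) (g : Fin n → Fin k) → bp x (tabulate g) ≡ sumF n (λ i → ⟦ lookup x i ≟ g i ⟧)
  bp-tabulate {n} x g = trans (bp-sum x (tabulate g))
    (sumF-cong n (λ i → cong (λ c → ⟦ lookup x i ≟ c ⟧) (lookup∘tabulate g i)))

  ask-bp : ∀ {n k} {S : Code n k → Set} (g : Fin n → Fin k) →
           Learn (CodeGame n k) (λ x r → sumF n (λ i → ⟦ lookup x i ≟ g i ⟧) ≡ r) S 1
  ask-bp g = mapL proj₁ (λ _ s → s) (λ x r s e → trans (sym (bp-tabulate x g)) (cong proj₁ e)) (query (tabulate g) (λ _ _ → tt))

  ⟦⟧-pos : ∀ {P : Set} (d : Dec P) → 1 ≤ ⟦ d ⟧ → P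
  ⟦⟧-pos (yes p) _ = p

  module _ {n k κ : ℕ} (pal : Fin κ → Fin k) (pal-inj : ∀ i j → pal i ≡ pal j → i ≡ j) (bl : Fin n → Fin k) where

    -- The colour `bl i` is a blank: shown at an unassigned position it earns no black peg, so one
    -- query evaluates a partial assignment.
    Playable : Code n k → Set
    Playable x = (∀ i → ¬ lookup x i ≡ bl i) × (∀ i → Σ (Fin κ) λ v → lookup x i ≡ pal v)

    private
      f : Code n k → Fin n → Fin κ → ℕ
      f x i v = ⟦ lookup x i ≟ pal v ⟧

      evaluates : Placing.Evaluates κ (CodeGame n k) n 1 Playable f
      evaluates = record { eval = λ Q → mapL (λ r → r) (λ _ s → s)
        (λ x r (b , _) e → trans (sumF-cong n (λ i → agree x i (Q i) (b i))) e)
        (ask-bp (λ i → maybe pal (bl i) (Q i))) }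
        where
        agree : ∀ x i m → ¬ lookup x i ≡ bl i → Signed.hit κ m (f x i) ≡ ⟦ lookup x i ≟ maybe pal (bl i) m ⟧
        agree x i nothing ne = sym (⟦⟧-no (lookup x i ≟ bl i) ne)
        agree x i (just v) ne = refl

      f≤1 : ∀ x i → sumF κ (f x i) ≤ 1
      f≤1 x i = sumF≤1 κ (f x i) (λ v → ⟦⟧≤1 (lookup x i ≟ pal v))
        (λ u v p q → pal-inj u v (trans (sym (⟦⟧-pos (lookup x i ≟ pal u) p)) (⟦⟧-pos (lookup x i ≟ pal v) q)))

      colour : (Fin n → Fin κ → ℕ) → Fin n → Fin k
      colour F i with any? (λ v → F i v ℕ.≟ 1)
      ... | yes (v , _) = pal v
      ... | no _ = bl i

      colour-correct : ∀ x F → Playable x → (∀ i v → f x i v ≡ F i v) → ∀ i → lookup x i ≡ colour F i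
      colour-correct x F (_ , ex) e i with any? (λ v → F i v ℕ.≟ 1)
      ... | yes (v , p) = ⟦⟧-pos (lookup x i ≟ pal v) (≤-reflexive (sym (trans (e i v) p)))
      ... | no none with ex i
      ... | v , p = ⊥-elim (none (v , trans (sym (e i v)) (⟦⟧-yes (lookup x i ≟ pal v) p)))

      decode-correct : ∀ x F → Playable x → (∀ i v → f x i v ≡ F i v) → x ≡ tabulate (colour F)
      decode-correct x F s e = trans (sym (tabulate∘lookup x)) (tabulate-cong (colour-correct x F s e))

    -- Since κ < 2 ^ (p + 1), the κ root counts stay proportional to the block size 2 ^ p, and a
    -- block takes 122 * 2 ^ p queries. The constant 7808 is 32 * 122 * 2.
    positionPhase : 1 ≤ n → κ ≤ n → Σ ℕ λ T → T * ⌊log₂ n ⌋ ≤ 7808 * suc ⌊log₂ κ ⌋ * n ×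
                    Learn (CodeGame n k) (λ x y → x ≡ y) Playable T
    positionPhase 1≤n κ≤n = from (Placing.learnItems κ evaluates (suc p) p (Blocks.blockCost κ p) 1 (Blocks.block κ p)
        (s≤s z≤n) (n≤1+n p) p≤n (λ x _ i → f≤1 x i))
      where
      p = ⌊log₂ κ ⌋
      p≤n : pow2 p ≤ n
      p≤n with κ ℕ.≟ 0
      ... | yes refl = 1≤n
      ... | no ne = ≤-trans (pow2-log≤ κ (n≢0⇒n>0 ne)) κ≤n
      cost≤ : Blocks.blockCost κ p ≤ 122 * pow2 p
      cost≤ = ≤-trans (+-monoˡ-≤ (60 * pow2 p * 2) (*-monoˡ-≤ 1 (<⇒≤ (n<pow2-suc-log κ)))) (≤-reflexive (lem (pow2 p)))
        where
        lem : ∀ x → (x + x) * 1 + 60 * x * 2 ≡ 122 * x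
        lem = solve-∀
      instance
        nz : NonZero (pow2 p)
        nz = >-nonZero (pow2>0 p)
      from : (Σ ℕ λ T → T * pow2 p * ⌊log₂ n ⌋ ≤ 32 * suc p * Blocks.blockCost κ p * n * (1 + 1) ×
               Learn (CodeGame n k) (λ x (F : Fin n → Fin κ → ℕ) → ∀ i v → f x i v ≡ F i v) Playable T) →
             Σ ℕ λ T → T * ⌊log₂ n ⌋ ≤ 7808 * suc p * n × Learn (CodeGame n k) (λ x y → x ≡ y) Playable T
      from (T , le , l) = T , *-cancelʳ-≤ (T * ⌊log₂ n ⌋) (7808 * suc p * n) (pow2 p) le′ ,
                          mapL (λ F → tabulate (colour F)) (λ _ s → s) (λ x F s e → decode-correct x F s e) l
        where
        lem₁ : ∀ t l x → t * l * x ≡ t * x * l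
        lem₁ = solve-∀
        lem₂ : ∀ s x n → 32 * s * (122 * x) * n * (1 + 1) ≡ 7808 * s * n * x
        lem₂ = solve-∀
        le′ : T * ⌊log₂ n ⌋ * pow2 p ≤ 7808 * suc p * n * pow2 p
        le′ = ≤-trans (≤-reflexive (lem₁ T ⌊log₂ n ⌋ (pow2 p))) (≤-trans le
          (≤-trans (*-monoˡ-≤ (1 + 1) (*-monoˡ-≤ n (*-monoʳ-≤ (32 * suc p) cost≤))) (≤-reflexive (lem₂ (suc p) (pow2 p) n))))

  module _ {n k : ℕ} (c₀ c₁ : Fin k) (c₀≢c₁ : ¬ c₀ ≡ c₁) where

    private
      -- The query that plays c₀ on a set and c₁ elsewhere counts, up to a constant,
      -- the differences [x i ≡ c₀] − [x i ≡ c₁] over the set; the values are these differences plus 1.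
      f : Code n k → Fin n → Fin 1 → ℕ
      f x i _ = ⟦ lookup x i ≟ c₀ ⟧ + 1 ∸ ⟦ lookup x i ≟ c₁ ⟧

      f-spec : ∀ x i v → f x i v + ⟦ lookup x i ≟ c₁ ⟧ ≡ ⟦ lookup x i ≟ c₀ ⟧ + 1
      f-spec x i v = m∸n+n≡m (≤-trans (⟦⟧≤1 (lookup x i ≟ c₁)) (m≤n+m 1 _))

      f≤2 : ∀ x i → sumF 1 (f x i) ≤ 2
      f≤2 x i = ≤-trans (≤-reflexive (+-identityʳ _))
        (≤-trans (m∸n≤m _ ⟦ lookup x i ≟ c₁ ⟧) (+-monoˡ-≤ 1 (⟦⟧≤1 (lookup x i ≟ c₀))))

      Count : ℕ → Code n k → Set
      Count m x = sumF n (λ i → ⟦ lookup x i ≟ c₁ ⟧) ≡ m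

      evaluates : ∀ m → Placing.Evaluates 1 (CodeGame n k) n 1 (Count m) f
      evaluates m = record { eval = λ Q → mapL (λ r → r + size Q ∸ m) (λ _ s → s)
        (λ x r c e → trans (sym (m+n∸n≡m _ m)) (cong (_∸ m) (total x Q c e)))
        (ask-bp (λ i → colour (Q i))) }
        where
        colour : Maybe (Fin 1) → Fin k
        colour nothing = c₁
        colour (just _) = c₀
        one : Maybe (Fin 1) → ℕ
        one nothing = 0
        one (just _) = 1
        size : (Fin n → Maybe (Fin 1)) → ℕ
        size Q = sumF n (λ i → one (Q i))
        step : ∀ x i a → Signed.hit 1 a (f x i) + ⟦ lookup x i ≟ c₁ ⟧ ≡ ⟦ lookup x i ≟ colour a ⟧ + one a
        step x i nothing = sym (+-identityʳ _)
        step x i (just v) = f-spec x i v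
        total : ∀ x Q {r} → Count m x → sumF n (λ i → ⟦ lookup x i ≟ colour (Q i) ⟧) ≡ r →
                sumF n (λ i → Signed.hit 1 (Q i) (f x i)) + m ≡ r + size Q
        total x Q refl refl = trans (sym (sumF-+ n _ _)) (trans (sumF-cong n (λ i → step x i (Q i))) (sumF-+ n _ _))

      -- A block is a single position here; its value is at most 2, hence the two bits.
      single : Learn (Signed.Bounded 1 2 0) (Blocks.Is 1) (Blocks.LeafOk 1 2) 1
      single = mapL (λ r _ _ → ∣ r ∣) (λ _ s → s)
        (λ { H r s e zero [] → cong ∣_∣ (trans (sym (Blocks.sval⁺ 1 (λ _ → just zero) H)) e) })
        (query ((λ _ → just zero) Signed.⊝ Signed.none 1) λ H ok →
          H zero [] , s≤s (≤-trans (m≤m+n _ 0) (≤-trans (ok []) (s≤s (s≤s z≤n)))) , Blocks.sval⁺ 1 (λ _ → just zero) H)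

      -- The value 2 arises only if x i is c₀, so c₁ is wrong there; every other value rules out c₀.
      blankOf : (Fin n → Fin 1 → ℕ) → Fin n → Fin k
      blankOf F i with F i zero ℕ.≟ 2
      ... | yes _ = c₁
      ... | no _ = c₀

      blankOf-correct : ∀ x F → (∀ i v → f x i v ≡ F i v) → ∀ i → ¬ lookup x i ≡ blankOf F i
      blankOf-correct x F e i eq with F i zero ℕ.≟ 2
      ... | no ne = ne (trans (sym (e i zero)) (cong₂ (λ a b → a + 1 ∸ b) (⟦⟧-yes (lookup x i ≟ c₀) eq)
        (⟦⟧-no (lookup x i ≟ c₁) (λ eq′ → c₀≢c₁ (trans (sym eq) eq′)))))
      ... | yes p with () ← trans (sym (trans (sym (e i zero)) (cong₂ (λ a b → a + 1 ∸ b)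
        (⟦⟧-no (lookup x i ≟ c₀) (λ eq′ → c₀≢c₁ (trans (sym eq′) eq))) (⟦⟧-yes (lookup x i ≟ c₁) eq)))) p

    blankPhase : 1 ≤ n → Σ ℕ λ T → T * ⌊log₂ n ⌋ ≤ 129 * n ×
                 Learn (CodeGame n k) (λ x (bl : Fin n → Fin k) → ∀ i → ¬ lookup x i ≡ bl i) (λ _ → ⊤) T
    -- The number of queries does not depend on the count m, so `items 0` may state it.
    blankPhase 1≤n = suc (proj₁ (items 0)) , cost≤ ,
      bind (ask-bp (λ _ → c₁)) λ m → mapL blankOf (λ _ → proj₂) (λ x F _ → blankOf-correct x F) (proj₂ (proj₂ (items m)))
      where
      items = λ m → Placing.learnItems 1 (evaluates m) 2 0 1 2 single (s≤s z≤n) z≤n 1≤n (λ x _ i → f≤2 x i)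
      lem : ∀ t l → suc t * l ≡ l + t * 1 * l
      lem = solve-∀
      lem′ : ∀ n → n + 32 * 2 * 1 * n * 2 ≡ 129 * n
      lem′ = solve-∀
      cost≤ : suc (proj₁ (items 0)) * ⌊log₂ n ⌋ ≤ 129 * n
      cost≤ = ≤-trans (≤-reflexive (lem (proj₁ (items 0)) ⌊log₂ n ⌋))
        (≤-trans (+-mono-≤ (log≤ n 1≤n) (proj₁ (proj₂ (items 0)))) (≤-reflexive (lem′ n)))

  fewColours : ∀ n k → 2 ≤ k → k ≤ n → Σ ℕ λ T → T * ⌊log₂ n ⌋ ≤ 15745 * ⌊log₂ k ⌋ * n ×
               Learn (CodeGame n k) (λ x y → x ≡ y) (λ _ → ⊤) T
  fewColours n (suc (suc k)) (s≤s (s≤s z≤n)) k≤n = proj₁ blanks + proj₁ (position λ _ → zero) , cost≤ ,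
    bind (proj₂ (proj₂ blanks)) λ bl →
      weaken (λ x (_ , ne) → ne , λ i → lookup x i , refl) (proj₂ (proj₂ (position bl)))
    where
    K = suc (suc k)
    1≤n : 1 ≤ n
    1≤n = ≤-trans (s≤s z≤n) k≤n
    blanks = blankPhase {n} {K} zero (suc zero) (λ ()) 1≤n
    position = λ (bl : Fin n → Fin K) → positionPhase (λ v → v) (λ _ _ e → e) bl 1≤n k≤n
    l≥1 : 1 ≤ ⌊log₂ K ⌋
    l≥1 = pow2≤⇒≤log 1 K (s≤s (s≤s z≤n))
    lem : ∀ l n → 129 * l * n + 7808 * (l + l) * n ≡ 15745 * l * n
    lem = solve-∀
    cost≤ : (proj₁ blanks + proj₁ (position λ _ → zero)) * ⌊log₂ n ⌋ ≤ 15745 * ⌊log₂ K ⌋ * n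
    cost≤ = ≤-trans (≤-reflexive (*-distribʳ-+ ⌊log₂ n ⌋ (proj₁ blanks) _))
      (≤-trans (+-mono-≤
        (≤-trans (proj₁ (proj₂ blanks)) (*-monoˡ-≤ n (≤-trans (≤-reflexive (sym (*-identityʳ 129))) (*-monoʳ-≤ 129 l≥1))))
        (≤-trans (proj₁ (proj₂ (position λ _ → zero))) (*-monoˡ-≤ n (*-monoʳ-≤ 7808 (+-monoˡ-≤ ⌊log₂ K ⌋ l≥1)))))
        (≤-reflexive (lem ⌊log₂ K ⌋ n)))

-- Spreading heavy leaves to balance the tree

module Spreading (κ : ℕ) where

  open import Data.Nat as ℕ using (zero; suc; _<_; _≤_; z≤n; _+_; _*_; _∸_; _≤?_; _<?_)
  open import Data.Nat.Properties
  open import Data.Nat.Tactic.RingSolver using (solve-∀)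
  open import Data.Fin using (Fin; zero; suc)
  import Data.Fin.Properties as Fin
  open import Data.List using ([]; _∷_)
  open import Data.Maybe using (map)
  open import Data.Vec using ([]; _∷_)
  open import Relation.Nullary.Decidable using (_×-dec_)
  open Sums
  open Learning
  open Signed κ
  open Stages κ
  open Placing κ using (module Placement; ind; sumW-cong; sumW-sumF; sumW-eqW)

  -- Consecutive points i < j keep the distance w i + w j.
  points : ∀ n → (Fin n → ℕ) → ℕ → Fin n → ℕ
  points (suc n) w e zero = e + w zero
  points (suc n) w e (suc i) = points n (w ∘ suc) (e + w zero + w zero) i

  points≥ : ∀ n w e i → e ≤ points n w e i
  points≥ (suc n) w e zero = m≤m+n e _
  points≥ (suc n) w e (suc i) = ≤-trans (≤-trans (m≤m+n e _) (m≤m+n _ _)) (points≥ n (w ∘ suc) _ i)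

  points-injective : ∀ n w e → (∀ i → 1 ≤ w i) → ∀ i j → points n w e i ≡ points n w e j → i ≡ j
  points-injective (suc n) w e w≥1 zero zero eq = refl
  points-injective (suc n) w e w≥1 (suc i) (suc j) eq = cong suc (points-injective n (w ∘ suc) _ (w≥1 ∘ suc) i j eq)
  points-injective (suc n) w e w≥1 zero (suc j) eq =
    ⊥-elim (<⇒≱ (m<m+n (e + w zero) (w≥1 zero)) (≤-trans (points≥ n (w ∘ suc) _ j) (≤-reflexive (sym eq))))
  points-injective (suc n) w e w≥1 (suc i) zero eq =
    ⊥-elim (<⇒≱ (m<m+n (e + w zero) (w≥1 zero)) (≤-trans (points≥ n (w ∘ suc) _ i) (≤-reflexive eq)))

  points< : ∀ n w e → (∀ i → 1 ≤ w i) → ∀ i → points n w e i < e + 2 * sumF n w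
  points< (suc n) w e w≥1 zero = +-monoʳ-< e (≤-trans (m<m+n (w zero) (w≥1 zero))
    (+-mono-≤ (m≤m+n (w zero) _) (≤-trans (m≤m+n (w zero) _) (≤-reflexive (sym (+-identityʳ _))))))
  points< (suc n) w e w≥1 (suc i) = ≤-trans (points< n (w ∘ suc) _ (w≥1 ∘ suc) i) (≤-reflexive (lem e (w zero) _))
    where
    lem : ∀ e a s → e + a + a + 2 * s ≡ e + 2 * (a + s)
    lem = solve-∀

  In : ℕ → ℕ → ℕ → Set
  In A X s = A ≤ s × s < X

  in? : ∀ A X s → Dec (In A X s)
  in? A X s = (A ≤? s) ×-dec (s <? X)

  only : ∀ {P : Set} → Dec P → ℕ → ℕ
  only (yes _) c = c
  only (no _) c = 0

  weightIn : ∀ n → (Fin n → ℕ) → ℕ → ℕ → ℕ → ℕ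
  weightIn n w e A X = sumF n (λ i → only (in? A X (points n w e i)) (w i))

  -- A point lies past e by at least its own weight plus all weights before it, which the last point
  -- below X turns into a bound for the whole sum.
  weightIn≤-above : ∀ n w e A X → weightIn n w e A X ≤ X ∸ e
  weightIn≤-above zero w e A X = z≤n
  weightIn≤-above (suc n) w e A X with in? A X (e + w zero)
  ... | no _ = ≤-trans (weightIn≤-above n (w ∘ suc) (e + w zero + w zero) A X)
    (∸-monoʳ-≤ X (≤-trans (m≤m+n e _) (m≤m+n _ _)))
  ... | yes (_ , lt) = begin
    w zero + weightIn n (w ∘ suc) (e + w zero + w zero) A X ≤⟨ +-monoʳ-≤ (w zero) (weightIn≤-above n (w ∘ suc) _ A X) ⟩
    w zero + (X ∸ (e + w zero + w zero))                    ≤⟨ +-monoʳ-≤ (w zero) (∸-monoʳ-≤ X (m≤m+n (e + w zero) _)) ⟩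
    w zero + (X ∸ (e + w zero))                             ≡⟨ cong (w zero +_) (sym (∸-+-assoc X e (w zero))) ⟩
    w zero + (X ∸ e ∸ w zero)                               ≡⟨ m+[n∸m]≡n (≤-trans (≤-reflexive (sym (m+n∸m≡n e (w zero)))) (∸-monoˡ-≤ e (<⇒≤ lt))) ⟩
    X ∸ e                                                   ∎
    where open ≤-Reasoning

  -- An interval with two points contains the half-gaps that separate its points.
  weightIn≤ : ∀ n w e A X i j → ¬ i ≡ j → In A X (points n w e i) → In A X (points n w e j) → weightIn n w e A X ≤ X ∸ A
  weightIn≤ (suc n) w e A X i j ne pi pj with in? A X (e + w zero)
  weightIn≤ (suc n) w e A X zero j ne pi pj | no out = ⊥-elim (out pi)
  weightIn≤ (suc n) w e A X (suc i) zero ne pi pj | no out = ⊥-elim (out pj)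
  weightIn≤ (suc n) w e A X (suc i) (suc j) ne pi pj | no out = weightIn≤ n (w ∘ suc) _ A X i j (ne ∘ cong suc) pi pj
  weightIn≤ (suc n) w e A X i j ne pi pj | yes (A≤ , _) = begin
    w zero + weightIn n (w ∘ suc) (e + w zero + w zero) A X ≤⟨ +-monoʳ-≤ (w zero) (weightIn≤-above n (w ∘ suc) _ A X) ⟩
    w zero + (X ∸ (e + w zero + w zero))                    ≡⟨ cong (w zero +_) (sym (∸-+-assoc X (e + w zero) (w zero))) ⟩
    w zero + (X ∸ (e + w zero) ∸ w zero)                    ≡⟨ m+[n∸m]≡n (≤-trans (≤-reflexive (sym (m+n∸m≡n (e + w zero) (w zero)))) (∸-monoˡ-≤ (e + w zero) (<⇒≤ (later i j ne pi pj)))) ⟩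
    X ∸ (e + w zero)                                        ≤⟨ ∸-monoʳ-≤ X A≤ ⟩
    X ∸ A                                                   ∎
    where
    open ≤-Reasoning
    later : ∀ i j → ¬ i ≡ j → In A X (points (suc n) w e i) → In A X (points (suc n) w e j) → e + w zero + w zero < X
    later zero zero ne _ _ = ⊥-elim (ne refl)
    later (suc i) _ ne (_ , lt) _ = ≤-<-trans (points≥ n (w ∘ suc) _ i) lt
    later zero (suc j) ne _ (_ , lt) = ≤-<-trans (points≥ n (w ∘ suc) _ j) lt

  loc : ∀ h → ℕ → ℕ → Maybe (Word h)
  loc zero A s with s ℕ.≟ A
  ... | yes _ = just []
  ... | no _ = nothing
  loc (suc h) A s with s <? A + pow2 h
  ... | yes _ = map (false ∷_) (loc h A s)
  ... | no _ = map (true ∷_) (loc h (A + pow2 h) s)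

  loc-in : ∀ h A s {u} → loc h A s ≡ just u → In A (A + pow2 h) s
  loc-in zero A s eq with s ℕ.≟ A
  ... | yes refl = ≤-refl , ≤-reflexive (+-comm 1 s)
  loc-in (suc h) A s eq with s <? A + pow2 h
  loc-in (suc h) A s eq | yes lt with loc h A s in eq′
  ... | just _ = proj₁ (loc-in h A s eq′) , ≤-trans lt (+-monoʳ-≤ A (m≤m+n (pow2 h) _))
  loc-in (suc h) A s eq | no _ with loc h (A + pow2 h) s in eq′
  ... | just _ with loc-in h (A + pow2 h) s eq′
  ... | lo , hi = ≤-trans (m≤m+n A _) lo , ≤-trans hi (≤-reflexive (+-assoc A _ _))

  loc-injective : ∀ h A s s′ {u} → loc h A s ≡ just u → loc h A s′ ≡ just u → s ≡ s′
  loc-injective zero A s s′ e e′ with s ℕ.≟ A | s′ ℕ.≟ A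
  ... | yes p | yes p′ = trans p (sym p′)
  loc-injective (suc h) A s s′ e e′ with s <? A + pow2 h | s′ <? A + pow2 h
  loc-injective (suc h) A s s′ e e′ | yes _ | yes _ with loc h A s in p | loc h A s′ in p′
  loc-injective (suc h) A s s′ refl refl | yes _ | yes _ | just _ | just _ = loc-injective h A s s′ p p′
  loc-injective (suc h) A s s′ e e′ | no _ | no _ with loc h (A + pow2 h) s in p | loc h (A + pow2 h) s′ in p′
  loc-injective (suc h) A s s′ refl refl | no _ | no _ | just _ | just _ = loc-injective h (A + pow2 h) s s′ p p′
  loc-injective (suc h) A s s′ e e′ | yes _ | no _ with loc h A s | loc h (A + pow2 h) s′
  loc-injective (suc h) A s s′ refl () | yes _ | no _ | just _ | just _
  loc-injective (suc h) A s s′ e e′ | no _ | yes _ with loc h (A + pow2 h) s | loc h A s′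
  loc-injective (suc h) A s s′ refl () | no _ | yes _ | just _ | just _

  loc-total : ∀ h A s → In A (A + pow2 h) s → Σ (Word h) λ u → loc h A s ≡ just u
  loc-total zero A s (lo , hi) with s ℕ.≟ A
  ... | yes _ = [] , refl
  ... | no ne = ⊥-elim (ne (≤-antisym (≤-pred (≤-trans hi (≤-reflexive (+-comm A 1)))) lo))
  loc-total (suc h) A s (lo , hi) with s <? A + pow2 h
  ... | yes lt with loc-total h A s (lo , lt)
  ... | u , e = false ∷ u , cong (map (false ∷_)) e
  loc-total (suc h) A s (lo , hi) | no ge with loc-total h (A + pow2 h) s (≮⇒≥ ge , ≤-trans hi (≤-reflexive (sym (+-assoc A _ _))))
  ... | u , e = true ∷ u , cong (map (true ∷_)) e

  loc-out : ∀ h A s → ¬ In A (A + pow2 h) s → loc h A s ≡ nothing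
  loc-out h A s out with loc h A s in eq
  ... | nothing = refl
  ... | just u = ⊥-elim (out (loc-in h A s eq))

  side : ℕ → ℕ → Bool → ℕ
  side h A false = A
  side h A true = A + pow2 h

  ind-side : ∀ h A s b u → ind (loc (suc h) A s) (b ∷ u) ≡ ind (loc h (side h A b) s) u
  ind-side h A s b u with s <? A + pow2 h
  ind-side h A s false u | yes _ with loc h A s
  ... | nothing = refl
  ... | just _ = refl
  ind-side h A s true u | yes lt
    rewrite loc-out h (A + pow2 h) s (λ (lo , _) → <⇒≱ lt lo) with loc h A s
  ... | nothing = refl
  ... | just _ = refl
  ind-side h A s false u | no ge
    rewrite loc-out h A s (λ (_ , hi) → ge hi) with loc h (A + pow2 h) s
  ... | nothing = refl
  ... | just _ = refl
  ind-side h A s true u | no _ with loc h (A + pow2 h) s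
  ... | nothing = refl
  ... | just _ = refl

  inn : ∀ {h} → Maybe (Word h) → ℕ → ℕ
  inn l c = maybe (λ _ → c) 0 l

  inn≤ : ∀ h A s {c w} → c ≤ w → inn (loc h A s) c ≤ only (in? A (A + pow2 h) s) w
  inn≤ h A s le with loc h A s in eq
  ... | nothing = z≤n
  ... | just u with in? A (A + pow2 h) s
  ... | yes _ = le
  ... | no out = ⊥-elim (out (loc-in h A s eq))

  module Spaced {n : ℕ} (w : Fin n → ℕ) where

    s : Fin n → ℕ
    s = points n w 0

    ℓ : ∀ h → ℕ → Fin n → Maybe (Word h)
    ℓ h A i = loc h A (s i)

    open Placement using (placed)

    Occupied : ℕ → ℕ → Set
    Occupied h A = Σ (Fin n) λ i → In A (A + pow2 h) (s i)

    occupied? : ∀ h A → Dec (Occupied h A)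
    occupied? h A = Fin.any? (λ i → in? A (A + pow2 h) (s i))

    empty : ∀ {h A} → Dec (Occupied h A) → Dec (Occupied h (A + pow2 h)) → Maybe Bool
    empty (no _) _ = just false
    empty (yes _) (no _) = just true
    empty (yes _) (yes _) = nothing

    -- It depends on the weights alone, which are known when the tree is built, and not on the
    -- hidden items.
    shape : ℕ → ℕ → Shape
    shape zero A π = nothing
    shape (suc h) A [] = empty {h} {A} (occupied? h A) (occupied? h (A + pow2 h))
    shape (suc h) A (b ∷ π) = shape h (side h A b) π

    module _ (f : Fin n → Fin κ → ℕ) where

      At : ∀ h → ℕ → Hid h → Set
      At h A H = ∀ v u → H v u ≡ placed (ℓ h A) f v u

      At-sub : ∀ h A {H} b → At (suc h) A H → At h (side h A b) (sub b H)
      At-sub h A b at v u = trans (at v (b ∷ u)) (sumF-cong n (λ i → cong (_* f i v) (ind-side h A (s i) b u)))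

      cnt-at : ∀ h A {H} → At h A H → ∀ v → cnt H v ≡ sumF n (λ i → inn (ℓ h A i) (f i v))
      cnt-at h A at v = trans (sumW-cong h (at v)) (trans (sumW-sumF h n _) (sumF-cong n (λ i → total (ℓ h A i) (f i v))))
        where
        total : ∀ l c → sumW h (λ u → ind l u * c) ≡ inn l c
        total nothing c = sumW-zero h
        total (just u) c = sumW-eqW h u (λ _ → c)

      cnt-empty : ∀ h A {H} → ¬ Occupied h A → At h A H → ∀ v → cnt H v ≡ 0
      cnt-empty h A ne at v = trans (cnt-at h A at v) (trans
        (sumF-cong n (λ i → cong (λ l → inn l (f i v)) (loc-out h A (s i) (λ p → ne (i , p))))) (sumF-zero n))

      module _ (f≤ : ∀ i → sumF κ (f i) ≤ w i) where

        load-at : ∀ h A {H} → At h A H → load H ≤ weightIn n w 0 A (A + pow2 h)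
        load-at h A {H} at = begin
          sumF κ (cnt H)                                      ≡⟨ sumF-cong κ (cnt-at h A at) ⟩
          sumF κ (λ v → sumF n (λ i → inn (ℓ h A i) (f i v))) ≡⟨ sumF-swap κ n _ ⟩
          sumF n (λ i → sumF κ (λ v → inn (ℓ h A i) (f i v))) ≡⟨ sumF-cong n (λ i → out (ℓ h A i) (f i)) ⟩
          sumF n (λ i → inn (ℓ h A i) (sumF κ (f i)))         ≤⟨ sumF-mono n (λ i → inn≤ h A (s i) (f≤ i)) ⟩
          weightIn n w 0 A (A + pow2 h)                       ∎
          where
          open ≤-Reasoning
          out : ∀ l (g : Fin κ → ℕ) → sumF κ (λ v → inn {h} l (g v)) ≡ inn l (sumF κ g)
          out nothing g = sumF-zero κ
          out (just _) g = refl

        -- Two occupied halves hold two distinct points, so the spacing bounds the weight by the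
        -- length of the interval, which is the number of leaves.
        node-at : ∀ h A {H} → At (suc h) A H → Node (shape (suc h) A []) H
        node-at h A {H} at with occupied? h A | occupied? h (A + pow2 h)
        ... | no ne | _ = cnt-empty h A ne (At-sub h A false at)
        ... | yes _ | no ne = cnt-empty h (A + pow2 h) ne (At-sub h A true at)
        ... | yes (i , lo , hi) | yes (j , lo′ , hi′) = ≤-trans (load-at (suc h) A at)
          (≤-trans (weightIn≤ n w 0 A (A + pow2 (suc h)) i j ne
              (lo , ≤-trans hi (+-monoʳ-≤ A (m≤m+n (pow2 h) _)))
              (≤-trans (m≤m+n A _) lo′ , ≤-trans hi′ (≤-reflexive (+-assoc A _ _))))
            (≤-reflexive (m+n∸m≡n A _)))
          where
          ne : ¬ i ≡ j
          ne refl = <⇒≱ hi lo′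

        good-at : ∀ h A {H} → At h A H → Good h (shape h A) H
        good-at zero A at = tip
        good-at (suc h) A at = fork (node-at h A at) (λ b → good-at h (side h A b) (At-sub h A b at))

    module _ (w≥1 : ∀ i → 1 ≤ w i) (h : ℕ) (fits : 2 * sumF n w ≤ pow2 h) where

      leaf : ∀ i → Σ (Word h) λ u → ℓ h 0 i ≡ just u
      leaf i = loc-total h 0 (s i) (z≤n , ≤-trans (points< n w 0 w≥1 i) fits)

      ℓ-injective : ∀ i j u → ℓ h 0 i ≡ just u → ℓ h 0 j ≡ just u → i ≡ j
      ℓ-injective i j u e e′ = points-injective n w 0 w≥1 i j (loc-injective h 0 (s i) (s j) e e′)

-- Many colours: finding those that occur

module Colours where

  open import Defs using (Code)
  open import Data.Nat as ℕ using (ℕ; zero; suc; _<_; _≤_; s≤s; z≤n; _+_; _*_; _/_; NonZero; >-nonZero; _<?_; _≤?_)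
  open import Data.Nat.Properties hiding (_≟_)
  open import Data.Nat.Logarithm using (⌊log₂_⌋; ⌊log₂⌋-mono-≤)
  open import Data.Nat.Tactic.RingSolver using (solve-∀)
  open import Data.Integer using () renaming (+_ to pos)
  open import Data.Fin using (Fin; zero; suc; toℕ; fromℕ<; inject≤; combine; remQuot)
  open import Data.Fin.Properties using (_≟_; any?)
  import Data.Fin.Properties as Fin
  open import Data.Maybe.Properties using (just-injective)
  open import Data.Vec using (lookup; tabulate)
  open import Data.Vec.Properties using (lookup∘tabulate)
  open Sums
  open Numbers
  open Learning
  open Matching
  open Strategies
  open Positions

  present-lookup : ∀ {n k} (x : Code n k) i → present x (lookup x i) ≡ 1
  present-lookup x i = ⟦⟧-yes (present? x _) (i , refl)

  sumF-one : ∀ n → sumF n (λ _ → 1) ≡ n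
  sumF-one zero = refl
  sumF-one (suc n) = cong suc (sumF-one n)

  -- Each position of x accounts for at most one cell.
  present-cells : ∀ {n k a b} (x : Code n k) (h : Fin a → Fin b → Fin k) →
                  (∀ g j g′ j′ → h g j ≡ h g′ j′ → (g ≡ g′ × j ≡ j′) ⊎ present x (h g j) ≡ 0) →
                  sumF a (λ g → sumF b (λ j → present x (h g j))) ≤ n
  present-cells {n} {k} {a} {b} x h distinct = begin
    sumF a (λ g → sumF b (λ j → present x (h g j)))                  ≤⟨ sumF-mono a (λ g → sumF-mono b (λ j → occurs (h g j))) ⟩
    sumF a (λ g → sumF b (λ j → sumF n (λ i → e g j i)))             ≡⟨ sumF-cong a (λ g → sumF-swap b n _) ⟩
    sumF a (λ g → sumF n (λ i → sumF b (λ j → e g j i)))             ≡⟨ sumF-swap a n _ ⟩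
    sumF n (λ i → sumF a (λ g → sumF b (λ j → e g j i)))             ≤⟨ sumF-mono n one ⟩
    sumF n (λ _ → 1)                                                 ≡⟨ sumF-one n ⟩
    n                                                                ∎
    where
    open ≤-Reasoning
    e : Fin a → Fin b → Fin n → ℕ
    e g j i = ⟦ lookup x i ≟ h g j ⟧
    occurs : ∀ c → present x c ≤ sumF n (λ i → ⟦ lookup x i ≟ c ⟧)
    occurs c with present? x c
    ... | no _ = z≤n
    ... | yes (i , p) = ≤-trans (≤-reflexive (sym (⟦⟧-yes (lookup x i ≟ c) p))) (≤-sumF n _ i)
    same : ∀ i g j g′ j′ → 1 ≤ e g j i → 1 ≤ e g′ j′ i → g ≡ g′ × j ≡ j′
    same i g j g′ j′ p p′ with ⟦⟧-pos (lookup x i ≟ h g j) p | ⟦⟧-pos (lookup x i ≟ h g′ j′) p′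
    ... | q | q′ with distinct g j g′ j′ (trans (sym q) q′)
    ... | inj₁ r = r
    ... | inj₂ z with () ← trans (sym z) (trans (cong (present x) (sym q)) (present-lookup x i))
    one : ∀ i → sumF a (λ g → sumF b (λ j → e g j i)) ≤ 1
    one i = sumF≤1 a _
      (λ g → sumF≤1 b _ (λ j → ⟦⟧≤1 (lookup x i ≟ h g j)) (λ j j′ p p′ → proj₂ (same i g j g j′ p p′)))
      (λ g g′ p p′ → proj₁ (same i g _ g′ _ (proj₂ (sumF-pos b _ p)) (proj₂ (sumF-pos b _ p′))))

  ask-mm : ∀ {n k} {S : Code n k → Set} (h : Fin n → Fin k) →
           (∀ x → S x → ∀ i j → h i ≡ h j → i ≡ j ⊎ present x (h i) ≡ 0) →
           Learn (CodeGame n k) (λ x r → sumF n (λ i → present x (h i)) ≡ r) S 1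
  ask-mm {n} h distinct = mapL proj₂ (λ _ s → s) (λ x r s e → trans (sym (sum≡ x s)) (cong proj₂ e)) (query (tabulate h) (λ _ _ → tt))
    where
    col : ∀ i → lookup (tabulate h) i ≡ h i
    col = lookup∘tabulate h
    sum≡ : ∀ x → _ → mm x (tabulate h) ≡ sumF n (λ i → present x (h i))
    sum≡ x s = trans (mm-present x (tabulate h) λ i j e → case i (distinct x s i j (trans (sym (col i)) (trans e (col j)))))
      (sumF-cong n (λ i → cong (present x) (col i)))
      where
      case : ∀ i {j} → i ≡ j ⊎ present x (h i) ≡ 0 → i ≡ j ⊎ present x (lookup (tabulate h) i) ≡ 0
      case i (inj₁ e) = inj₁ e
      case i (inj₂ z) = inj₂ (trans (cong (present x) (col i)) z)

  module _ {n k : ℕ} (n<k : n < k) where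

    -- Among n + 1 colours one is absent.
    absentPhase : Learn (CodeGame n k) (λ x c → present x c ≡ 0) (λ _ → ⊤) (suc n * 1)
    absentPhase = mapL (λ F → pick F (any? (λ i → F i ℕ.≟ 0))) (λ _ s → s) (λ x F _ e → correct x F e (any? (λ i → F i ℕ.≟ 0)))
      (learnFin (suc n) λ i → ask-bp (λ _ → col i))
      where
      col : Fin (suc n) → Fin k
      col i = inject≤ i n<k
      pick : (F : Fin (suc n) → ℕ) → Dec (Σ (Fin (suc n)) λ i → F i ≡ 0) → Fin k
      pick F (yes (i , _)) = col i
      pick F (no _) = col zero
      correct : ∀ x F → (∀ i → sumF n (λ j → ⟦ lookup x j ≟ col i ⟧) ≡ F i) → ∀ d → present x (pick F d) ≡ 0
      correct x F e (yes (i , z)) = ⟦⟧-no (present? x (col i)) λ (j , p) →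
        <⇒≢ (≤-trans (≤-reflexive (sym (⟦⟧-yes (lookup x j ≟ col i) p))) (≤-sumF n _ j)) (sym (trans (e i) z))
      correct x F e (no none) = ⊥-elim (<⇒≱ ≤-refl (Fin.injective⇒≤ {f = λ i → proj₁ (place i)} λ {i} {j} eq →
        Fin.inject≤-injective n<k n<k i j (trans (sym (proj₂ (place i))) (trans (cong (lookup x) eq) (proj₂ (place j))))))
        where
        place : ∀ i → Σ (Fin n) λ j → lookup x j ≡ col i
        place i with sumF-pos n (λ j → ⟦ lookup x j ≟ col i ⟧) (subst (1 ≤_) (sym (e i)) (n≢0⇒n>0 (λ z → none (i , z))))
        ... | j , p = j , ⟦⟧-pos (lookup x j ≟ col i) p

  module Cells {n k : ℕ} .{{_ : NonZero n}} (c₀ : Fin k) where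

    G : ℕ
    G = suc (k / n)

    k≤ : k ≤ G * n
    k≤ = <⇒≤ (m<suc[m/n]*n k n)

    -- Cells beyond k show c₀, which will be an absent colour and may then be repeated without
    -- changing the number of pegs.
    colourAt : (c : ℕ) → Dec (c < k) → Fin k
    colourAt c (yes p) = fromℕ< p
    colourAt c (no _) = c₀

    cell : Fin G → Fin n → Fin k
    cell g j = colourAt (toℕ (combine g j)) (toℕ (combine g j) <? k)

    cell-distinct : ∀ g j g′ j′ → cell g j ≡ cell g′ j′ → (g ≡ g′ × j ≡ j′) ⊎ cell g j ≡ c₀
    cell-distinct g j g′ j′ e with toℕ (combine g j) <? k | toℕ (combine g′ j′) <? k
    ... | no _ | _ = inj₂ refl
    ... | yes _ | no _ = inj₂ e
    ... | yes p | yes p′ = inj₁ (Fin.combine-injective g j g′ j′ (Fin.toℕ-injective (Fin.fromℕ<-injective _ _ p p′ e)))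

    row : Fin k → Fin G
    row c = proj₁ (remQuot {G} n (inject≤ c k≤))

    col : Fin k → Fin n
    col c = proj₂ (remQuot {G} n (inject≤ c k≤))

    cell-at : ∀ c → cell (row c) (col c) ≡ c
    cell-at c = trans (cong (λ m → colourAt m (m <? k)) idx) (here (toℕ c <? k))
      where
      idx : toℕ (combine (row c) (col c)) ≡ toℕ c
      idx = trans (cong toℕ (Fin.combine-remQuot {G} n (inject≤ c k≤))) (Fin.toℕ-inject≤ c k≤)
      here : ∀ d → colourAt (toℕ c) d ≡ c
      here (yes p) = Fin.fromℕ<-toℕ c p
      here (no np) = ⊥-elim (np (Fin.toℕ<n c))

    module Rows (m : Fin G → ℕ) where

      E : Enumeration (λ g → 1 ≤ m g)
      E = enumerate G (λ g → 1 ≤? m g)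
      open Enumeration E

      Counts : Code n k → Set
      Counts x = present x c₀ ≡ 0 × (∀ g → sumF n (λ j → present x (cell g j)) ≡ m g)

      rowOf′ : ∀ {i} → Dec (i < size) → Maybe (Fin G)
      rowOf′ (yes p) = just (item (fromℕ< p))
      rowOf′ (no _) = nothing

      -- Each position of a query serves one slot, so a query shows at most one colour of each row.
      -- The n slots suffice: every listed row contains a colour that occurs in x, and there are at
      -- most n of these.
      rowOf : Fin n → Maybe (Fin G)
      rowOf i = rowOf′ (toℕ i <? size)

      rowOf-injective : ∀ i j {g} → rowOf i ≡ just g → rowOf j ≡ just g → i ≡ j
      rowOf-injective i j e e′ with toℕ i <? size | toℕ j <? size
      ... | yes p | yes p′ = Fin.toℕ-injective (Fin.fromℕ<-injective _ _ p p′
        (injective _ _ (trans (just-injective e) (sym (just-injective e′)))))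

      rowOf-pos : ∀ i {g} → rowOf i ≡ just g → 1 ≤ m g
      rowOf-pos i e with toℕ i <? size
      rowOf-pos i refl | yes p = sound (fromℕ< p)

      slotOf : size ≤ n → ∀ g → 1 ≤ m g → Σ (Fin n) λ i → rowOf i ≡ just g
      slotOf le g p = i , at (toℕ i <? size)
        where
        i = inject≤ (find g p) le
        at : ∀ d → rowOf′ {toℕ i} d ≡ just g
        at (yes lt) = cong just (trans (cong item (Fin.toℕ-injective (trans (Fin.toℕ-fromℕ< lt) (Fin.toℕ-inject≤ (find g p) le)))) (item-find g p))
        at (no nlt) = ⊥-elim (nlt (subst (_< size) (sym (Fin.toℕ-inject≤ (find g p) le)) (Fin.toℕ<n (find g p))))

      slotCell : Maybe (Fin G) → Fin n → Fin k
      slotCell r v = maybe (λ g → cell g v) c₀ r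

      f : Code n k → Fin n → Fin n → ℕ
      f x i v = present x (slotCell (rowOf i) v)

      cells-ok : ∀ x → Counts x → ∀ g j g′ j′ → cell g j ≡ cell g′ j′ → (g ≡ g′ × j ≡ j′) ⊎ present x (cell g j) ≡ 0
      cells-ok x (z , _) g j g′ j′ e with cell-distinct g j g′ j′ e
      ... | inj₁ p = inj₁ p
      ... | inj₂ p = inj₂ (trans (cong (present x) p) z)

      slots-ok : ∀ x → Counts x → ∀ i v j v′ → slotCell (rowOf i) v ≡ slotCell (rowOf j) v′ →
                 (i ≡ j × v ≡ v′) ⊎ present x (slotCell (rowOf i) v) ≡ 0
      slots-ok x c i v j v′ e with rowOf i in p | rowOf j in p′
      ... | nothing | _ = inj₂ (proj₁ c)
      ... | just g | nothing = inj₂ (trans (cong (present x) e) (proj₁ c))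
      ... | just g | just g′ with cells-ok x c g v g′ v′ e
      ... | inj₂ z = inj₂ z
      ... | inj₁ (refl , refl) = inj₁ (rowOf-injective i j p p′ , refl)

      size≤n : ∀ x → Counts x → size ≤ n
      size≤n x c = ≤-trans (≤-reflexive (sym (*-identityʳ size))) (≤-trans (size* 1 m (λ _ p → p))
        (≤-trans (≤-reflexive (sumF-cong G (λ g → sym (proj₂ c g)))) (present-cells x cell (cells-ok x c))))

      evaluates : Placing.Evaluates n (CodeGame n k) n 1 Counts f
      evaluates = record { eval = λ Q → mapL (λ r → r) (λ _ s → s)
        (λ x r c e → trans (sumF-cong n (λ i → agree x c i (Q i))) e)
        (ask-mm (λ i → asked′ i (Q i)) (λ x c i j → distinct x c i j (Q i) (Q j))) }
        where
        asked′ : Fin n → Maybe (Fin n) → Fin k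
        asked′ i q = maybe (slotCell (rowOf i)) c₀ q
        agree : ∀ x → Counts x → ∀ i q → Signed.hit n q (f x i) ≡ present x (asked′ i q)
        agree x c i nothing = sym (proj₁ c)
        agree x c i (just v) = refl
        distinct : ∀ x → Counts x → ∀ i j a b → asked′ i a ≡ asked′ j b → i ≡ j ⊎ present x (asked′ i a) ≡ 0
        distinct x c i j nothing b e = inj₂ (proj₁ c)
        distinct x c i j (just v) nothing e = inj₂ (trans (cong (present x) e) (proj₁ c))
        distinct x c i j (just v) (just v′) e with slots-ok x c i v j v′ e
        ... | inj₁ (p , _) = inj₁ p
        ... | inj₂ z = inj₂ z

      -- Empty slots still get weight 1, because the points are distinct only for positive weights.
      w : Fin n → ℕ
      w i = maybe m 1 (rowOf i)

      w≥1 : ∀ i → 1 ≤ w i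
      w≥1 i with rowOf i in eq
      ... | nothing = ≤-refl
      ... | just g = rowOf-pos i eq

      f-sum : ∀ x → Counts x → ∀ i → sumF n (f x i) ≤ w i × w i ≤ sumF n (f x i) + 1
      f-sum x c i with rowOf i
      ... | just g = ≤-reflexive (proj₂ c g) , ≤-trans (≤-reflexive (sym (proj₂ c g))) (m≤m+n _ 1)
      ... | nothing = ≤-trans (≤-reflexive (trans (sumF-cong n (λ _ → proj₁ c)) (sumF-zero n))) z≤n , m≤n+m 1 _

      f-total : ∀ x → Counts x → sumF n (λ i → sumF n (f x i)) ≤ n
      f-total x c = present-cells x (λ i → slotCell (rowOf i)) (slots-ok x c)

      w-total : ∀ x → Counts x → sumF n w ≤ n + n
      w-total x c = ≤-trans (sumF-mono n (λ i → proj₂ (f-sum x c i)))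
        (≤-trans (≤-reflexive (sumF-+ n _ _)) (+-mono-≤ (f-total x c) (≤-reflexive (sumF-one n))))

      open Spreading n using (module Spaced)
      open Spaced w

      -- The weights add up to at most 2 n, and the spacing doubles this.
      h : ℕ
      h = 3 + ⌊log₂ n ⌋

      4n≤ : 2 * (n + n) ≤ pow2 h
      4n≤ = ≤-trans (≤-reflexive (lem n)) (+-mono-≤ (+-mono-≤ n≤ n≤) (+-mono-≤ n≤ n≤))
        where
        n≤ : n ≤ pow2 (suc ⌊log₂ n ⌋)
        n≤ = <⇒≤ (n<pow2-suc-log n)
        lem : ∀ n → 2 * (n + n) ≡ (n + n) + (n + n)
        lem = solve-∀

      gameCost : ℕ
      gameCost = n * 1 + 60 * pow2 h * (1 + 1)

      Solved : Code n k → (Fin n → Fin n → ℕ) → Set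
      Solved x F = ∀ i v → f x i v ≡ F i v

      game : Learn (CodeGame n k) Solved Counts gameCost
      game with 2 * sumF n w ≤? pow2 h
      ... | no ¬fits = done (λ _ _ → 0) λ x c → ⊥-elim (¬fits (≤-trans (*-monoʳ-≤ 2 (w-total x c)) 4n≤))
      -- Column v shown in all slots at once yields the root count of item v.
      ... | yes fits = bind (learnFin n λ v → Placing.Evaluates.eval evaluates (λ _ → just v)) λ r →
        mapL (λ X i v → X v (proj₁ (place i)))
          (λ x (c , e) → ((λ v → trans (sym (e v)) (sym (root x v))) , good-at (f x) (λ i → proj₁ (f-sum x c i)) h 0 (λ _ _ → refl) ,
              (λ v → ≤-<-trans (≤-trans (≤-reflexive (root x v)) (≤-trans (sumF-mono n (λ i → ≤-sumF n (f x i) v)) (f-total x c))) n<)) , c)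
          (λ x X _ is i v → trans (sym (at-placed (ℓ h 0) (ℓ-injective w≥1 h fits) (f x) i v _ (proj₂ (place i)))) (is v _))
          (simulate (λ x → placed (ℓ h 0) (f x)) (Placing.evalSigned n evaluates (ℓ h 0)) (Blocks.solveAll n h (shape h 0) r))
        where
        open Placing n using (module Placement)
        open Placement using (placed; at-placed)
        place = leaf w≥1 h fits
        root : ∀ x v → Stages.cnt n (placed (ℓ h 0) (f x)) v ≡ sumF n (λ i → f x i v)
        root x v = trans (cnt-at (f x) h 0 (λ _ _ → refl) v) (sumF-cong n (λ i → at i))
          where
          at : ∀ i → Spreading.inn n (ℓ h 0 i) (f x i v) ≡ f x i v
          at i rewrite proj₂ (place i) = refl
        n< : n < pow2 (suc h)
        n< = <-trans (n<pow2-suc-log n) (pow2-strict {suc ⌊log₂ n ⌋} {suc h} (s≤s (s≤s (m≤n+m ⌊log₂ n ⌋ 2))))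
          where
          pow2-strict : ∀ {a b} → a < b → pow2 a < pow2 b
          pow2-strict {a} lt = ≤-trans (m<m+n (pow2 a) (pow2>0 a)) (pow2-mono lt)

      presence : (Fin n → Fin n → ℕ) → Fin k → ℕ
      presence F c with size ≤? n | 1 ≤? m (row c)
      ... | yes le | yes p = F (proj₁ (slotOf le (row c) p)) (col c)
      ... | _ | _ = 0

      presence-correct : ∀ x F → Counts x → Solved x F → ∀ c → present x c ≡ presence F c
      presence-correct x F cs e c with size ≤? n | 1 ≤? m (row c)
      ... | no ne | _ = ⊥-elim (ne (size≤n x cs))
      ... | yes le | yes p = trans (cong (present x) (sym (trans (cong (λ r → slotCell r (col c)) (proj₂ (slotOf le (row c) p))) (cell-at c)))) (e _ _)
      ... | yes le | no np = n≤0⇒n≡0 (≤-trans (≤-reflexive (cong (present x) (sym (cell-at c))))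
        (≤-trans (≤-sumF n (λ j → present x (cell (row c) j)) (col c))
          (≤-trans (≤-reflexive (proj₂ cs (row c))) (≤-pred (≰⇒> np)))))

    colourPhase : Learn (CodeGame n k) (λ x (P : Fin k → ℕ) → ∀ c → present x c ≡ P c)
                    (λ x → present x c₀ ≡ 0) (G * 1 + (n * 1 + 60 * pow2 (3 + ⌊log₂ n ⌋) * (1 + 1)))
    colourPhase = bind (learnFin G λ g → ask-mm (cell g) (distinct g)) λ m →
      mapL (Rows.presence m) (λ _ s → s) (λ x F c e → Rows.presence-correct m x F c e) (Rows.game m)
      where
      distinct : ∀ g x → present x c₀ ≡ 0 → ∀ i j → cell g i ≡ cell g j → i ≡ j ⊎ present x (cell g i) ≡ 0
      distinct g x z i j e with cell-distinct g i g j e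
      ... | inj₁ (_ , p) = inj₁ p
      ... | inj₂ p = inj₂ (trans (cong (present x) p) z)

  manyColours : ∀ n k .{{_ : NonZero n}} → 2 ≤ n → n < k →
                Learn (CodeGame n k) (λ x y → x ≡ y) (λ _ → ⊤)
                  (suc n * 1 + (suc (k / n) * 1 + (n * 1 + 60 * pow2 (3 + ⌊log₂ n ⌋) * (1 + 1)) + 15616 * n))
  manyColours n k 2≤n n<k = bind (absentPhase n<k) λ c₀ →
    bind (weaken (λ _ → proj₂) (Cells.colourPhase c₀)) λ P → weaken (λ x ((_ , z) , p) → z , p) (finish c₀ P)
    where
    finish : ∀ c₀ (P : Fin k → ℕ) → Learn (CodeGame n k) (λ x y → x ≡ y) (λ x → present x c₀ ≡ 0 × (∀ c → present x c ≡ P c)) (15616 * n)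
    finish c₀ P with Enumeration.size (enumerate k (λ c → 1 ≤? P c)) ≤? n
    ... | no gt = done (tabulate λ _ → c₀) λ x (_ , p) → ⊥-elim (gt (≤-trans (≤-reflexive (sym (*-identityʳ size)))
        (≤-trans (size* 1 P (λ _ q → q)) (≤-trans (≤-reflexive (sumF-cong k (λ c → trans (sym (p c)) (sym (+-identityʳ _)))))
          (present-cells {b = 1} x (λ c _ → c) (λ { c zero c′ zero e → inj₁ (e , refl) }))))))
      where open Enumeration (enumerate k (λ c → 1 ≤? P c))
    ... | yes le = relax time (weaken playable (proj₂ (proj₂ phase)))
      where
      open Enumeration (enumerate k (λ c → 1 ≤? P c))
      -- The colours that occur form the palette, and the absent c₀ is a blank at every position.
      phase = positionPhase item injective (λ _ → c₀) (≤-trans (s≤s z≤n) 2≤n) le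
      playable : ∀ x → present x c₀ ≡ 0 × (∀ c → present x c ≡ P c) → Playable item injective (λ _ → c₀) x
      playable x (z , p) =
        (λ i e → 0≢1+n (trans (sym z) (trans (cong (present x) (sym e)) (present-lookup x i)))) ,
        (λ i → find (lookup x i) (known i) , sym (item-find (lookup x i) (known i)))
        where
        known : ∀ i → 1 ≤ P (lookup x i)
        known i = ≤-reflexive (trans (sym (present-lookup x i)) (p (lookup x i)))
      l≥1 : 1 ≤ ⌊log₂ n ⌋
      l≥1 = pow2≤⇒≤log 1 n 2≤n
      instance
        nz : NonZero ⌊log₂ n ⌋
        nz = >-nonZero l≥1
      lem : ∀ l n → 7808 * (l + l) * n ≡ 15616 * n * l
      lem = solve-∀
      size-log : ⌊log₂ size ⌋ ≤ ⌊log₂ n ⌋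
      size-log = ⌊log₂⌋-mono-≤ le
      time : proj₁ phase ≤ 15616 * n
      time = *-cancelʳ-≤ (proj₁ phase) (15616 * n) ⌊log₂ n ⌋ (≤-trans (proj₁ (proj₂ phase))
        (≤-trans (*-monoˡ-≤ n (*-monoʳ-≤ 7808 (+-mono-≤ l≥1 size-log))) (≤-reflexive (lem ⌊log₂ n ⌋ n))))

-- Assembling both bounds

open import Data.Nat using (ℕ; suc; _+_; _*_; _≤_; _<_; _^_; _/_; s≤s; z≤n; NonZero; >-nonZero; _≤?_)
open import Data.Nat.Properties
open import Data.Nat.DivMod using (m/n*n≤m)
open import Data.Nat.Logarithm using (⌊log₂_⌋; ⌊log₂⌋-mono-≤; ⌊log₂[2^n]⌋≡n)
open import Data.Nat.Tactic.RingSolver using (solve-∀)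
open Sums
open Numbers
open Learning
open Strategies
open Positions
open Colours

lowerBound : ∀ n k T → 2 ≤ n → 2 ≤ k → SolvableIn n k T →
             n * n * ⌊log₂ k ⌋ + k * ⌊log₂ n ⌋ ≤ 6 * T * (n * ⌊log₂ n ⌋)
lowerBound n k T 2≤n 2≤k s = ≤-trans (+-mono-≤ bits tints) (≤-reflexive (lem T n ⌊log₂ n ⌋))
  where
  open ≤-Reasoning
  lem : ∀ t n l → n * (t * (4 * l)) + 2 * t * n * l ≡ 6 * t * (n * l)
  lem = solve-∀
  l≥1 : 1 ≤ ⌊log₂ n ⌋
  l≥1 = pow2≤⇒≤log 1 n 2≤n
  outcomes : suc n * suc n ≤ 2 ^ (4 * ⌊log₂ n ⌋)
  outcomes = begin
    suc n * suc n                                           ≤⟨ *-mono-≤ (n<pow2-suc-log n) (n<pow2-suc-log n) ⟩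
    pow2 (suc ⌊log₂ n ⌋) * pow2 (suc ⌊log₂ n ⌋)             ≡⟨ sym (pow2-+ (suc ⌊log₂ n ⌋) _) ⟩
    -- For n ≥ 2 the logarithm is at least 1 and absorbs each successor.
    pow2 (suc ⌊log₂ n ⌋ + suc ⌊log₂ n ⌋)                    ≤⟨ pow2-mono (+-mono-≤ (+-monoˡ-≤ ⌊log₂ n ⌋ l≥1) (+-monoˡ-≤ ⌊log₂ n ⌋ l≥1)) ⟩
    pow2 (⌊log₂ n ⌋ + ⌊log₂ n ⌋ + (⌊log₂ n ⌋ + ⌊log₂ n ⌋))  ≡⟨ cong pow2 (four ⌊log₂ n ⌋) ⟩
    pow2 (4 * ⌊log₂ n ⌋)                                    ≡⟨ pow2≡2^ (4 * ⌊log₂ n ⌋) ⟩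
    2 ^ (4 * ⌊log₂ n ⌋)                                     ∎
    where
    four : ∀ l → l + l + (l + l) ≡ 4 * l
    four = solve-∀
  exponent : n * ⌊log₂ k ⌋ ≤ T * (4 * ⌊log₂ n ⌋)
  exponent = begin
    n * ⌊log₂ k ⌋                                    ≡⟨ sym (⌊log₂[2^n]⌋≡n _) ⟩
    ⌊log₂ 2 ^ (n * ⌊log₂ k ⌋) ⌋                      ≤⟨ ⌊log₂⌋-mono-≤ powers ⟩
    ⌊log₂ 2 ^ (T * (4 * ⌊log₂ n ⌋)) ⌋                ≡⟨ ⌊log₂[2^n]⌋≡n _ ⟩
    T * (4 * ⌊log₂ n ⌋)                              ∎
    where
    powers : 2 ^ (n * ⌊log₂ k ⌋) ≤ 2 ^ (T * (4 * ⌊log₂ n ⌋))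
    powers = begin
      2 ^ (n * ⌊log₂ k ⌋)           ≡⟨ cong (2 ^_) (*-comm n _) ⟩
      2 ^ (⌊log₂ k ⌋ * n)           ≡⟨ sym (^-*-assoc 2 ⌊log₂ k ⌋ n) ⟩
      (2 ^ ⌊log₂ k ⌋) ^ n           ≤⟨ ^-monoˡ-≤ n (≤-trans (≤-reflexive (sym (pow2≡2^ ⌊log₂ k ⌋))) (pow2-log≤ k (≤-trans (s≤s z≤n) 2≤k))) ⟩
      k ^ n                         ≤⟨ information {n} {k} {T} s ⟩
      (suc n * suc n) ^ T           ≤⟨ ^-monoˡ-≤ T outcomes ⟩
      (2 ^ (4 * ⌊log₂ n ⌋)) ^ T     ≡⟨ ^-*-assoc 2 (4 * ⌊log₂ n ⌋) T ⟩
      2 ^ (4 * ⌊log₂ n ⌋ * T)       ≡⟨ cong (2 ^_) (*-comm (4 * ⌊log₂ n ⌋) T) ⟩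
      2 ^ (T * (4 * ⌊log₂ n ⌋))     ∎
  bits : n * n * ⌊log₂ k ⌋ ≤ n * (T * (4 * ⌊log₂ n ⌋))
  bits = ≤-trans (≤-reflexive (*-assoc n n _)) (*-monoʳ-≤ n exponent)
  k≤ : k ≤ suc (T * n)
  k≤ = colours {n} {k} {T} (≤-trans (s≤s z≤n) 2≤n) s
  tints : k * ⌊log₂ n ⌋ ≤ 2 * T * n * ⌊log₂ n ⌋
  -- From 2 ≤ k ≤ T n + 1 it follows that T n ≥ 1, which absorbs the 1.
  tints = *-monoˡ-≤ ⌊log₂ n ⌋ (≤-trans k≤ (≤-trans (+-monoˡ-≤ (T * n) (≤-pred (≤-trans 2≤k k≤))) (≤-reflexive (two T n))))
    where
    two : ∀ t n → t * n + t * n ≡ 2 * t * n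
    two = solve-∀

-- The upper bound with its denominators log n and n cleared.
Bound : ℕ → ℕ → ℕ → ℕ → Set
Bound C n k T = T * (n * ⌊log₂ n ⌋) ≤ C * (n * n * ⌊log₂ k ⌋ + k * ⌊log₂ n ⌋)

-- The summand d pads the constant, so that both ranges of k share one: 15745 + 834 = 15616 + 963.
fewBound : ∀ c d n k T → T * ⌊log₂ n ⌋ ≤ c * ⌊log₂ k ⌋ * n → Bound (c + d) n k T
fewBound c d n k T le = ≤-trans (≤-reflexive (lem₁ T n ⌊log₂ n ⌋)) (≤-trans (*-monoˡ-≤ n le)
  (≤-trans (≤-reflexive (lem₂ c n ⌊log₂ k ⌋)) (*-mono-≤ (m≤m+n c d) (m≤m+n _ _))))
  where
  lem₁ : ∀ t n l → t * (n * l) ≡ t * l * n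
  lem₁ = solve-∀
  lem₂ : ∀ c n l → c * l * n * n ≡ c * (n * n * l)
  lem₂ = solve-∀

-- In 963 = 960 + 2 + 1, the tree on the groups accounts for 60 * 8 * 2, the linear phases for 2,
-- and the last n ≥ 2 absorbs the two additive units.
manyBound : ∀ c n k .{{_ : NonZero n}} → 2 ≤ n → n ≤ k →
  Bound (suc c + 963) n k (suc n * 1 + (suc (k / n) * 1 + (n * 1 + 60 * pow2 (3 + ⌊log₂ n ⌋) * (1 + 1)) + suc c * n))
manyBound c n k 2≤n n≤k = begin
  T * (n * l)                                        ≤⟨ *-monoˡ-≤ (n * l) T≤ ⟩
  (C * n + k / n) * (n * l)                          ≡⟨ lem₁ C n (k / n) l ⟩
  C * (n * n * l) + k / n * n * l                    ≤⟨ +-mono-≤ (*-monoʳ-≤ C (*-monoʳ-≤ (n * n) (⌊log₂⌋-mono-≤ n≤k)))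
                                                                (≤-trans (*-monoˡ-≤ l (m/n*n≤m k n)) (m≤n*m (k * l) C)) ⟩
  C * (n * n * ⌊log₂ k ⌋) + C * (k * l)              ≡⟨ sym (*-distribˡ-+ C (n * n * ⌊log₂ k ⌋) (k * l)) ⟩
  C * (n * n * ⌊log₂ k ⌋ + k * l)                    ∎
  where
  open ≤-Reasoning
  l = ⌊log₂ n ⌋
  C = suc c + 963
  T = suc n * 1 + (suc (k / n) * 1 + (n * 1 + 60 * pow2 (3 + l) * (1 + 1)) + suc c * n)
  lem₀ : ∀ c n y x → suc n * 1 + (suc y * 1 + (n * 1 + 60 * (((x + x) + (x + x)) + ((x + x) + (x + x))) * (1 + 1)) + suc c * n) ≡
         (suc c * n + (2 * n + 960 * x)) + (2 + y)
  lem₀ = solve-∀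
  lem₁ : ∀ c n y l → (c * n + y) * (n * l) ≡ c * (n * n * l) + y * n * l
  lem₁ = solve-∀
  lem₂ : ∀ c n y → (suc c * n + (2 * n + 960 * n)) + (n + y) ≡ (suc c + 963) * n + y
  lem₂ = solve-∀
  T≤ : T ≤ C * n + k / n
  T≤ = ≤-trans (≤-reflexive (lem₀ c n (k / n) (pow2 l)))
    (≤-trans (+-mono-≤ (+-monoʳ-≤ (suc c * n) (+-monoʳ-≤ (2 * n) (*-monoʳ-≤ 960 (pow2-log≤ n (≤-trans (s≤s z≤n) 2≤n))))) (+-monoˡ-≤ (k / n) 2≤n))
      (≤-reflexive (lem₂ c n (k / n))))

upperBound : ∀ n k → 2 ≤ n → 2 ≤ k → Dec (k ≤ n) → Σ ℕ λ T → SolvableIn n k T × Bound 16579 n k T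
upperBound n k 2≤n 2≤k (yes k≤n) = few (fewColours n k 2≤k k≤n)
  where
  few : (Σ ℕ λ T → T * ⌊log₂ n ⌋ ≤ 15745 * ⌊log₂ k ⌋ * n × Learn (CodeGame n k) (λ x y → x ≡ y) (λ _ → ⊤) T) →
        Σ ℕ λ T → SolvableIn n k T × Bound 16579 n k T
  few (T , le , l) = T , strategy l , fewBound 15745 834 n k T le
upperBound n k 2≤n 2≤k (no k≰n) = _ , strategy (manyColours n k 2≤n (≰⇒> k≰n)) , manyBound 15615 n k 2≤n (≰⇒≥ k≰n)
  where
  instance
    nz : NonZero n
    nz = >-nonZero (≤-trans (s≤s z≤n) 2≤n)

leastBound : ∀ n k → 2 ≤ n → 2 ≤ k → (Σ ℕ λ T → SolvableIn n k T × Bound 16579 n k T) →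
  Σ ℕ λ T → IsMinQueries n k T ×
    (n * n * ⌊log₂ k ⌋ + k * ⌊log₂ n ⌋ ≤ 6 * T * (n * ⌊log₂ n ⌋)) ×
    (T * (n * ⌊log₂ n ⌋) ≤ 16579 * (n * n * ⌊log₂ k ⌋ + k * ⌊log₂ n ⌋))
leastBound n k 2≤n 2≤k (t , s , le) = from (minQueries {n} {k} {t} s)
  where
  from : (Σ ℕ λ T → T ≤ t × IsMinQueries n k T) → _
  from (T , T≤t , min) = T , min , lowerBound n k T 2≤n 2≤k (proj₁ min) , ≤-trans (*-monoˡ-≤ (n * ⌊log₂ n ⌋) T≤t) le

-- Both estimates are multiplied by n * log n, so c is 1 / c′. For n and k at least 2 the rounded
-- logarithms are positive and within a factor 2 of the real ones, which leaves the order of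
-- magnitude unchanged.
theorem2 : Σ ℕ λ c′ → Σ ℕ λ C → 0 < c′ × 0 < C ×
    (∀ n k → 2 ≤ n → 2 ≤ k → Σ ℕ λ T → IsMinQueries n k T ×
    (n * n * ⌊log₂ k ⌋ + k * ⌊log₂ n ⌋ ≤ c′ * T * (n * ⌊log₂ n ⌋)) ×
    (T * (n * ⌊log₂ n ⌋) ≤ C * (n * n * ⌊log₂ k ⌋ + k * ⌊log₂ n ⌋)))
theorem2 = 6 , 16579 , s≤s z≤n , s≤s z≤n , λ n k 2≤n 2≤k → leastBound n k 2≤n 2≤k (upperBound n k 2≤n 2≤k (k ≤? n))
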